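{- Let $m \ge 4$ be even and let $a,b$ be integers with $1 \le a \le b < \frac{m}{2}$. Then the graph $B_1(m;a,b)$ is a nut graph if and only if all of the following hold: (i) $m \equiv 2 \pmod 4$; (ii) $a$ and $b$ are both even; (iii) $\gcd(\frac m2, a, b)=1$; (iv) if $5 \mid m$, then at least one of $a, b, a-b, a+b$ is divisible by $5$.
   Context: A graph is a nut graph if $0$ is an adjacency eigenvalue of multiplicity one and a corresponding eigenvector has no zero entries. $B_1(m;a,b)$ is the graph on vertices $x_0,\dots,x_{m-1},y_0,\dots,y_{m-1}$ (indices mod $m$) with edges $x_ix_{i\pm a}$, $x_ix_{i+m/2}$, $y_iy_{i\pm b}$, $y_iy_{i+m/2}$ and $x_iy_i$ for all $i$. -}

module Defs where

open import Data.Bool using (Bool; true; false; _∨_; if_then_else_)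
open import Data.Nat using (ℕ; zero; suc; _∸_; _≡ᵇ_; NonZero)
import Data.Nat as ℕ
open import Data.Nat.DivMod using (_%_; _/_)
open import Data.Fin using (Fin; toℕ; splitAt)
import Data.Fin as Fin
open import Data.Sum using (_⊎_; inj₁; inj₂)
open import Data.Product using (Σ; ∃; _×_; _,_)
open import Data.Rational using (ℚ; 0ℚ; 1ℚ; _+_; _*_)
open import Relation.Binary.PropositionalEquality using (_≡_; _≢_)

sumℚ : (n : ℕ) → (Fin n → ℚ) → ℚ
sumℚ zero    f = 0ℚ
sumℚ (suc n) f = f Fin.zero + sumℚ n (λ i → f (Fin.suc i))

adjMatrix : {n : ℕ} → (Fin n → Fin n → Bool) → Fin n → Fin n → ℚ
adjMatrix adj u v = if adj u v then 1ℚ else 0ℚ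

InKernel : (n : ℕ) → (Fin n → Fin n → Bool) → (Fin n → ℚ) → Set
InKernel n adj x = ∀ u → sumℚ n (λ v → adjMatrix adj u v * x v) ≡ 0ℚ

-- Nut graph: 0 is an eigenvalue of multiplicity one (the adjacency matrix is
-- symmetric, so multiplicity = dimension of the kernel; here: the kernel is
-- spanned by a single nonzero vector x) and the corresponding eigenvector x has
-- no zero entries.
IsNutGraph : (n : ℕ) → (Fin n → Fin n → Bool) → Set
IsNutGraph n adj =
  Σ (Fin n → ℚ) λ x →
    InKernel n adj x
    × (∀ v → x v ≢ 0ℚ)
    × (∀ y → InKernel n adj y → Σ ℚ λ c → ∀ v → y v ≡ c * x v)

circ : (m : ℕ) → .{{_ : NonZero m}} → ℕ → Fin m → Fin m → Bool
circ m d i j = ((toℕ i ℕ.+ d) % m) ≡ᵇ toℕ j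

rimAdj : (m : ℕ) → .{{_ : NonZero m}} → ℕ → Fin m → Fin m → Bool
rimAdj m d i j = circ m d i j ∨ circ m (m ∸ d) i j ∨ circ m (m / 2) i j

-- The graph B₁(m; a, b) on vertex set Fin (m + m):
-- vertex k < m is x_k, vertex m + k is y_k.
B₁ : (m : ℕ) → .{{_ : NonZero m}} → ℕ → ℕ → Fin (m ℕ.+ m) → Fin (m ℕ.+ m) → Bool
B₁ m a b u v with splitAt m u | splitAt m v
... | inj₁ i | inj₁ j = rimAdj m a i j
... | inj₂ i | inj₂ j = rimAdj m b i j
... | inj₁ i | inj₂ j = toℕ i ≡ᵇ toℕ j
... | inj₂ i | inj₁ j = toℕ i ≡ᵇ toℕ j

{-# OPTIONS --safe #-}

-- Write m = 2k and let T be the cyclic shift. A kernel vector is a pair of m-periodic sequences (x , y)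
-- with (X + T^k) x + y = 0 = x + (Y + T^k) y, where X = T^a + T^(-a) and Y = T^b + T^(-b).
--
-- Sufficiency. For k odd and a, b even, the parts of x with T^k = ε = ± 1 (the one for ε = -1 multiplied
-- by (-1)^i) are k-periodic and killed by D = (X + ε) (Y + ε) - 1. The annihilator of a vector in the
-- group ring of ℤ/k is stable under ψ : T ↦ T², so ψ(D) kills them too, and ψ(X) = X² - 2. For ε = 1
-- the two relations give X² = 0, hence x = 0. For ε = -1 they give X Y = X + Y and
-- (X + Y - 4) (X + Y + 1) = 0: the first factor gives constants by the gcd condition, the second forces
-- primitive fifth roots of unity, which the condition modulo 5 excludes.
--
-- The stability under ψ replaces the irreducibility of cyclotomic polynomials. If D x = 0 and
-- y = ψ(D) x, then y ψ(y) = 0. Since ψ(y) ≡ y² modulo 2, this makes y divisible by 2, and y / 2 has the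
-- same property, so y = 0 by descent.
--
-- Necessity. If the kernel is a line without zero entries, then a kernel vector with one zero entry
-- vanishes. Applied to differences of a vector and its reflections this gives x_i = (-1)^i x_0, whence
-- the parities; for the other conditions one exhibits nonzero kernel vectors with a zero entry.
module Submission where

open import Defs
open import Algebra.Properties.AbelianGroup using () renaming (∙-cancelʳ to cancelʳ)
open import Data.Bool using (Bool; true; false; T; _∨_; if_then_else_)
open import Data.Empty using (⊥; ⊥-elim)
open import Data.Fin using (Fin; toℕ; fromℕ<; splitAt; join; _↑ˡ_; _↑ʳ_)
import Data.Fin as Fin
import Data.Fin.Properties as Finₚ
open import Data.Integer using (ℤ; +_; 0ℤ; 1ℤ; -1ℤ)
  renaming (∣_∣ to abs; _+_ to infixl 6 _+ᶻ_; _*_ to infixl 7 _*ᶻ_; -_ to infix 8 -ᶻ_; _-_ to infixl 6 _-ᶻ_)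
open import Data.Integer.DivMod using (_%ℕ_; _/ℕ_; n%ℕd<d; a≡a%ℕn+[a/ℕn]*n)
import Data.Integer.Properties as ℤₚ
open import Data.Integer.Tactic.RingSolver using () renaming (solve-∀ to ℤ-ring)
open import Data.List using (List; []; _∷_; _++_)
open import Data.Nat
  using (ℕ; zero; suc; _≤_; _<_; _∸_; _+_; _*_; _≡ᵇ_; NonZero; ≢-nonZero⁻¹; >-nonZero; z≤n; s≤s)
open import Data.Nat.Coprimality using (Coprime; coprime-divisor)
open import Data.Nat.DivMod
  using (_%_; _/_; m≡m%n+[m/n]*n; m%n<n; m<n⇒m%n≡m; m/n*n≡m; [m+n]%n≡m%n; [m+kn]%n≡m%n; m%n%n≡m%n; %-distribˡ-+)
open import Data.Nat.Divisibility
  using (_∣_; divides; _∣?_; _∣0; ∣-refl; ∣-trans; 0∣⇒≡0; ∣1⇒≡1; ∣⇒≤; n∣m*n; m∣m*n; ∣m⇒∣m*n; ∣n⇒∣m*n;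
         ∣m∣n⇒∣m+n; ∣m+n∣m⇒∣n)
open import Data.Nat.GCD using (gcd; gcd-GCD; gcd[m,n]∣m; gcd[m,n]∣n; c*gcd[m,n]≡gcd[cm,cn]; module Bézout)
open import Data.Nat.Primality using (prime?; prime⇒irreducible)
import Data.Nat.Properties as ℕₚ
open import Data.Nat.Tactic.RingSolver using () renaming (solve-∀ to ℕ-ring)
open import Data.Product using (Σ; ∃; _×_; _,_; proj₁; proj₂)
open import Data.Rational using (ℚ; 0ℚ; 1ℚ; ↥_; ↧_; 1/_; toℚᵘ; fromℚᵘ; ≢-nonZero)
  renaming (_+_ to infixl 6 _+ℚ_; _*_ to infixl 7 _*ℚ_)
import Data.Rational.Properties as ℚₚ
open import Data.Rational.Unnormalised using (mkℚᵘ; *≡*)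
  renaming (_+_ to infixl 6 _+ᵘ_; _*_ to infixl 7 _*ᵘ_)
import Data.Rational.Unnormalised.Properties as ℚᵘₚ
open import Data.Sum using (_⊎_; inj₁; inj₂)
open import Function.Bundles using (_⇔_; mk⇔)
open import Relation.Binary.Definitions using (tri<; tri≈; tri>)
open import Relation.Binary.PropositionalEquality
  using (_≡_; _≢_; _≗_; refl; sym; trans; cong; cong₂; subst; module ≡-Reasoning)
open import Relation.Nullary using (¬_; yes; no)
open import Relation.Nullary.Decidable using (from-yes)
open ≡-Reasoning

-- Operators on periodic sequences

-- The model is the argument with roots of unity: a solution ζ of (α + ε) (β + ε) = 1 with α = ζ^a +
-- ζ^(-a) and β = ζ^b + ζ^(-b) has the conjugate solution ζ², and the two equations determine α and
-- β. Roots of unity are never formed here. A sequence of period k is used both as a vector and as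
-- an element of ℤ[ℤ/k], and each polynomial identity becomes a linear recurrence.
--
-- The relation y ψ(y) = 0 holds because y ψ(y) = ψ(D) x · ψ²(D) ψ(x) contains the factor ψ(D) ψ(x)
-- = ψ(D x) = 0. The descent needs integers and an injective ψ: hence denominators are cleared,
-- projections are kept as twice themselves, and k must be odd.
--
-- The numbers 4 and -1 arise as follows. For ε = -1 put S = X + Y = X Y. Then X² Y² = X² + 2 X Y +
-- Y² turns ψ(D) = 0 into X² + Y² = X Y + 4, that is S² - 3 S - 4 = 0. For S = 4 both X and Y are
-- roots of (t - 2)²; for S = -1 they are roots of t² + t - 1, solved by 2 cos (2π/5) and 2 cos
-- (4π/5).

Seq : Set
Seq = ℕ → ℤ

Period : ℕ → Seq → Set
Period k s = ∀ i → s (i + k) ≡ s i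

period-* : ∀ {k s} → Period k s → ∀ n → Period (n * k) s
period-* {k} {s} p zero    i = cong s (ℕₚ.+-identityʳ i)
period-* {k} {s} p (suc n) i = begin
  s (i + (k + n * k)) ≡⟨ cong s (ℕ-+ i k (n * k)) ⟩
  s (i + n * k + k)   ≡⟨ p (i + n * k) ⟩
  s (i + n * k)       ≡⟨ period-* {k} {s} p n i ⟩
  s i                 ∎
  where
  ℕ-+ : ∀ i k n → i + (k + n) ≡ i + n + k
  ℕ-+ = ℕ-ring

Poly : Set
Poly = List (ℤ × ℕ)

-- Σ c Tˡ over the entries (c , l) of the list, evaluated at T = (shift by d)
op : Poly → ℕ → Seq → Seq
op []            d s i = 0ℤ
op ((c , l) ∷ L) d s i = c *ᶻ s (i + l * d) +ᶻ op L d s i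

op-cong : ∀ L d {s t} → s ≗ t → op L d s ≗ op L d t
op-cong []            d e i = refl
op-cong ((c , l) ∷ L) d e i = cong₂ (λ u v → c *ᶻ u +ᶻ v) (e _) (op-cong L d e i)

op-linear : ∀ L d c s t i → op L d (λ j → c *ᶻ s j +ᶻ t j) i ≡ c *ᶻ op L d s i +ᶻ op L d t i
op-linear []             d c s t i = ring c
  where
  ring : ∀ c → 0ℤ ≡ c *ᶻ 0ℤ +ᶻ 0ℤ
  ring = ℤ-ring
op-linear ((c′ , l) ∷ L) d c s t i =
  trans (cong (c′ *ᶻ (c *ᶻ s (i + l * d) +ᶻ t (i + l * d)) +ᶻ_) (op-linear L d c s t i))
        (ring c c′ (s (i + l * d)) (t (i + l * d)) (op L d s i) (op L d t i))
  where
  ring : ∀ c c′ u v p q → c′ *ᶻ (c *ᶻ u +ᶻ v) +ᶻ (c *ᶻ p +ᶻ q) ≡ c *ᶻ (c′ *ᶻ u +ᶻ p) +ᶻ (c′ *ᶻ v +ᶻ q)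
  ring = ℤ-ring

op-0 : ∀ L d i → op L d (λ _ → 0ℤ) i ≡ 0ℤ
op-0 []            d i = refl
op-0 ((c , l) ∷ L) d i = trans (cong₂ _+ᶻ_ (ℤₚ.*-zeroʳ c) (op-0 L d i)) refl

op-scale : ∀ L d c s i → op L d (λ j → c *ᶻ s j) i ≡ c *ᶻ op L d s i
op-scale L d c s i = begin
  op L d (λ j → c *ᶻ s j) i             ≡⟨ op-cong L d (λ j → sym (ℤₚ.+-identityʳ _)) i ⟩
  op L d (λ j → c *ᶻ s j +ᶻ 0ℤ) i       ≡⟨ op-linear L d c s (λ _ → 0ℤ) i ⟩
  c *ᶻ op L d s i +ᶻ op L d (λ _ → 0ℤ) i ≡⟨ cong (c *ᶻ op L d s i +ᶻ_) (op-0 L d i) ⟩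
  c *ᶻ op L d s i +ᶻ 0ℤ                 ≡⟨ ℤₚ.+-identityʳ _ ⟩
  c *ᶻ op L d s i                       ∎

op-shift : ∀ L d s n i → op L d (λ j → s (j + n)) i ≡ op L d s (i + n)
op-shift []            d s n i = refl
op-shift ((c , l) ∷ L) d s n i = cong₂ (λ u v → c *ᶻ s u +ᶻ v) (swap i (l * d) n) (op-shift L d s n i)
  where
  swap : ∀ i l n → i + l + n ≡ i + n + l
  swap = ℕ-ring

op-comm : ∀ L d M e s → op L d (op M e s) ≗ op M e (op L d s)
op-comm []            d M e s i = sym (op-0 M e i)
op-comm ((c , l) ∷ L) d M e s i = begin
  c *ᶻ op M e s (i + l * d) +ᶻ op L d (op M e s) i
    ≡⟨ cong₂ (λ u v → c *ᶻ u +ᶻ v) (sym (op-shift M e s (l * d) i)) (op-comm L d M e s i) ⟩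
  c *ᶻ op M e (λ j → s (j + l * d)) i +ᶻ op M e (op L d s) i
    ≡⟨ sym (op-linear M e c (λ j → s (j + l * d)) (op L d s) i) ⟩
  op M e (op ((c , l) ∷ L) d s) i ∎

op-period : ∀ L d {k s} → Period k s → Period k (op L d s)
op-period L d {k} {s} p i = trans (sym (op-shift L d s k i)) (op-cong L d p i)

op-stretch : ∀ L d e s i → op L (e * d) s (e * i) ≡ op L d (λ j → s (e * j)) i
op-stretch []            d e s i = refl
op-stretch ((c , l) ∷ L) d e s i = cong₂ (λ u v → c *ᶻ s u +ᶻ v) (ring e i l d) (op-stretch L d e s i)
  where
  ring : ∀ e i l d → e * i + l * (e * d) ≡ e * (i + l * d)
  ring = ℕ-ring

-- Congruence modulo 2 and the Frobenius map

infix 4 _≡₂_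
-- The quotient is kept as data, since the descent takes the sequence of quotients as its next
-- sequence.
record _≡₂_ (x y : ℤ) : Set where
  constructor _,_
  field
    quotient : ℤ
    equality : x ≡ y +ᶻ + 2 *ᶻ quotient
open _≡₂_

square-≡₂ : ∀ c → c *ᶻ c ≡₂ c
square-≡₂ c with c %ℕ 2 | n%ℕd<d c 2 | a≡a%ℕn+[a/ℕn]*n c 2
... | 0 | _ | c≡ = + 2 *ᶻ (c /ℕ 2) *ᶻ (c /ℕ 2) +ᶻ -ᶻ (c /ℕ 2) ,
  trans (cong (λ c → c *ᶻ c) c≡) (trans (ring (c /ℕ 2))
    (cong (_+ᶻ + 2 *ᶻ (+ 2 *ᶻ (c /ℕ 2) *ᶻ (c /ℕ 2) +ᶻ -ᶻ (c /ℕ 2))) (sym c≡)))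
  where
  ring : ∀ q → (+ 0 +ᶻ q *ᶻ + 2) *ᶻ (+ 0 +ᶻ q *ᶻ + 2) ≡ (+ 0 +ᶻ q *ᶻ + 2) +ᶻ + 2 *ᶻ (+ 2 *ᶻ q *ᶻ q +ᶻ -ᶻ q)
  ring = ℤ-ring
... | 1 | _ | c≡ = + 2 *ᶻ (c /ℕ 2) *ᶻ (c /ℕ 2) +ᶻ (c /ℕ 2) ,
  trans (cong (λ c → c *ᶻ c) c≡) (trans (ring (c /ℕ 2))
    (cong (_+ᶻ + 2 *ᶻ (+ 2 *ᶻ (c /ℕ 2) *ᶻ (c /ℕ 2) +ᶻ (c /ℕ 2))) (sym c≡)))
  where
  ring : ∀ q → (+ 1 +ᶻ q *ᶻ + 2) *ᶻ (+ 1 +ᶻ q *ᶻ + 2) ≡ (+ 1 +ᶻ q *ᶻ + 2) +ᶻ + 2 *ᶻ (+ 2 *ᶻ q *ᶻ q +ᶻ q)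
  ring = ℤ-ring
... | suc (suc _) | s≤s (s≤s ()) | _

-- In (c Tˡ + L)² = c² T²ˡ + 2 c Tˡ L + L² the cross term is even, and c² ≡ c modulo 2.
frobenius : ∀ L d s i → op L d (op L d s) i ≡₂ op L (2 * d) s i
frobenius []            d s i = 0ℤ , refl
frobenius ((c , l) ∷ L) d s i =
  let (t , e)  = frobenius L d s i
      (t′ , f) = square-≡₂ c
      v      = s (i + l * (2 * d))
      r      = op L d s (i + l * d)
  in t′ *ᶻ v +ᶻ c *ᶻ r +ᶻ t , (begin
  c *ᶻ (c *ᶻ s (i + l * d + l * d) +ᶻ r) +ᶻ op L d (op ((c , l) ∷ L) d s) i
    ≡⟨ cong₂ (λ a b → c *ᶻ (c *ᶻ s a +ᶻ r) +ᶻ b) (double i l d)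
         (trans (op-linear L d c (λ j → s (j + l * d)) (op L d s) i)
                (cong₂ (λ a b → c *ᶻ a +ᶻ b) (op-shift L d s (l * d) i) e)) ⟩
  c *ᶻ (c *ᶻ v +ᶻ r) +ᶻ (c *ᶻ r +ᶻ (op L (2 * d) s i +ᶻ + 2 *ᶻ t))
    ≡⟨ expand c v r (op L (2 * d) s i) t ⟩
  (c *ᶻ c) *ᶻ v +ᶻ (+ 2 *ᶻ (c *ᶻ r) +ᶻ (op L (2 * d) s i +ᶻ + 2 *ᶻ t))
    ≡⟨ cong (λ a → a *ᶻ v +ᶻ (+ 2 *ᶻ (c *ᶻ r) +ᶻ (op L (2 * d) s i +ᶻ + 2 *ᶻ t))) f ⟩
  (c +ᶻ + 2 *ᶻ t′) *ᶻ v +ᶻ (+ 2 *ᶻ (c *ᶻ r) +ᶻ (op L (2 * d) s i +ᶻ + 2 *ᶻ t))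
    ≡⟨ collect c v r (op L (2 * d) s i) t t′ ⟩
  c *ᶻ v +ᶻ op L (2 * d) s i +ᶻ + 2 *ᶻ (t′ *ᶻ v +ᶻ c *ᶻ r +ᶻ t) ∎)
  where
  double : ∀ i l d → i + l * d + l * d ≡ i + l * (2 * d)
  double = ℕ-ring
  expand : ∀ c v r q t → c *ᶻ (c *ᶻ v +ᶻ r) +ᶻ (c *ᶻ r +ᶻ (q +ᶻ + 2 *ᶻ t))
                       ≡ (c *ᶻ c) *ᶻ v +ᶻ (+ 2 *ᶻ (c *ᶻ r) +ᶻ (q +ᶻ + 2 *ᶻ t))
  expand = ℤ-ring
  collect : ∀ c v r q t t′ → (c +ᶻ + 2 *ᶻ t′) *ᶻ v +ᶻ (+ 2 *ᶻ (c *ᶻ r) +ᶻ (q +ᶻ + 2 *ᶻ t))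
                       ≡ c *ᶻ v +ᶻ q +ᶻ + 2 *ᶻ (t′ *ᶻ v +ᶻ c *ᶻ r +ᶻ t)
  collect = ℤ-ring

-- The group ring element with coefficients x₀, ..., xₙ₋₁. Thus `op (tab k x) d` is multiplication
-- by ψ(x) for the map ψ : T ↦ T^d, and a vector x becomes an operator.
tab : ℕ → Seq → Poly
tab zero    x = []
tab (suc n) x = (x n , n) ∷ tab n x

tab-cong : ∀ n {x y} → x ≗ y → ∀ d s i → op (tab n x) d s i ≡ op (tab n y) d s i
tab-cong zero    e d s i = refl
tab-cong (suc n) e d s i = cong₂ (λ u v → u *ᶻ s (i + n * d) +ᶻ v) (e n) (tab-cong n e d s i)

tab-linear : ∀ n c x y d s i →
  op (tab n (λ j → c *ᶻ x j +ᶻ y j)) d s i ≡ c *ᶻ op (tab n x) d s i +ᶻ op (tab n y) d s i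
tab-linear zero    c x y d s i = ring c
  where
  ring : ∀ c → 0ℤ ≡ c *ᶻ 0ℤ +ᶻ 0ℤ
  ring = ℤ-ring
tab-linear (suc n) c x y d s i =
  trans (cong ((c *ᶻ x n +ᶻ y n) *ᶻ s (i + n * d) +ᶻ_) (tab-linear n c x y d s i))
        (ring c (x n) (y n) (s (i + n * d)) (op (tab n x) d s i) (op (tab n y) d s i))
  where
  ring : ∀ c u v w p q → (c *ᶻ u +ᶻ v) *ᶻ w +ᶻ (c *ᶻ p +ᶻ q) ≡ c *ᶻ (u *ᶻ w +ᶻ p) +ᶻ (v *ᶻ w +ᶻ q)
  ring = ℤ-ring

tab-0 : ∀ n d s i → op (tab n (λ _ → 0ℤ)) d s i ≡ 0ℤ
tab-0 zero    d s i = refl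
tab-0 (suc n) d s i = cong₂ _+ᶻ_ (ℤₚ.*-zeroˡ (s (i + n * d))) (tab-0 n d s i)

tab-scale : ∀ n c x d s i → op (tab n (λ j → c *ᶻ x j)) d s i ≡ c *ᶻ op (tab n x) d s i
tab-scale n c x d s i = begin
  op (tab n (λ j → c *ᶻ x j)) d s i       ≡⟨ tab-cong n (λ j → sym (ℤₚ.+-identityʳ _)) d s i ⟩
  op (tab n (λ j → c *ᶻ x j +ᶻ 0ℤ)) d s i ≡⟨ tab-linear n c x (λ _ → 0ℤ) d s i ⟩
  c *ᶻ op (tab n x) d s i +ᶻ op (tab n (λ _ → 0ℤ)) d s i ≡⟨ cong (c *ᶻ op (tab n x) d s i +ᶻ_) (tab-0 n d s i) ⟩
  c *ᶻ op (tab n x) d s i +ᶻ 0ℤ           ≡⟨ ℤₚ.+-identityʳ _ ⟩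
  c *ᶻ op (tab n x) d s i                 ∎

Σ< : ℕ → Seq → ℤ
Σ< zero    f = 0ℤ
Σ< (suc n) f = f n +ᶻ Σ< n f

Σ<-cong : ∀ n {f g} → f ≗ g → Σ< n f ≡ Σ< n g
Σ<-cong zero    e = refl
Σ<-cong (suc n) e = cong₂ _+ᶻ_ (e n) (Σ<-cong n e)

Σ<-head : ∀ n f → Σ< (suc n) f ≡ Σ< n (λ j → f (suc j)) +ᶻ f 0
Σ<-head zero    f = ℤₚ.+-comm (f 0) 0ℤ
Σ<-head (suc n) f = trans (cong (f (suc n) +ᶻ_) (Σ<-head n f)) (sym (ℤₚ.+-assoc (f (suc n)) _ (f 0)))

Σ<-rotate : ∀ k f → Period k f → ∀ n → Σ< k (λ j → f (j + n)) ≡ Σ< k f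
Σ<-rotate k f p zero    = Σ<-cong k (λ j → cong f (ℕₚ.+-identityʳ j))
Σ<-rotate k f p (suc n) = begin
  Σ< k (λ j → f (j + suc n)) ≡⟨ Σ<-cong k (λ j → cong f (ℕₚ.+-suc j n)) ⟩
  Σ< k (λ j → f (suc j + n)) ≡⟨ cancelʳ ℤₚ.+-0-abelianGroup (f n) _ _ step ⟩
  Σ< k (λ j → f (j + n))     ≡⟨ Σ<-rotate k f p n ⟩
  Σ< k f                     ∎
  where
  step : Σ< k (λ j → f (suc j + n)) +ᶻ f n ≡ Σ< k (λ j → f (j + n)) +ᶻ f n
  step = begin
    Σ< k (λ j → f (suc j + n)) +ᶻ f n ≡⟨ sym (Σ<-head k (λ j → f (j + n))) ⟩
    f (k + n) +ᶻ Σ< k (λ j → f (j + n)) ≡⟨ cong (_+ᶻ Σ< k (λ j → f (j + n))) (trans (cong f (ℕₚ.+-comm k n)) (p n)) ⟩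
    f n +ᶻ Σ< k (λ j → f (j + n)) ≡⟨ ℤₚ.+-comm (f n) _ ⟩
    Σ< k (λ j → f (j + n)) +ᶻ f n ∎

tab-Σ< : ∀ n x d s i → op (tab n x) d s i ≡ Σ< n (λ j → x j *ᶻ s (i + j * d))
tab-Σ< zero    x d s i = refl
tab-Σ< (suc n) x d s i = cong (x n *ᶻ s (i + n * d) +ᶻ_) (tab-Σ< n x d s i)

-- Shifting the coefficients by l multiplies the element by T^(-l); l′ stands for -l modulo k.
tab-shift : ∀ k x s → Period k x → Period k s → ∀ l l′ q → l + l′ ≡ q * k → ∀ d i →
  op (tab k (λ j → x (j + l))) d s i ≡ op (tab k x) d s (i + l′ * d)
tab-shift k x s px ps l l′ q l+l′ d i = begin
  op (tab k (λ j → x (j + l))) d s i                  ≡⟨ tab-Σ< k (λ j → x (j + l)) d s i ⟩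
  Σ< k (λ j → x (j + l) *ᶻ s (i + j * d))             ≡⟨ Σ<-cong k (λ j → cong (x (j + l) *ᶻ_) (sym (wrap j))) ⟩
  Σ< k (λ j → h (j + l))                              ≡⟨ Σ<-rotate k h ph l ⟩
  Σ< k h                                              ≡⟨ sym (tab-Σ< k x d s (i + l′ * d)) ⟩
  op (tab k x) d s (i + l′ * d)                       ∎
  where
  h : Seq
  h j = x j *ᶻ s (i + l′ * d + j * d)
  ring₁ : ∀ i d j k → i + (j + k) * d ≡ i + j * d + d * k
  ring₁ = ℕ-ring
  ph : Period k h
  ph j = cong₂ _*ᶻ_ (px j) (trans (cong s (ring₁ (i + l′ * d) d j k)) (period-* {k} {s} ps d _))
  ring₂ : ∀ i l l′ d j → i + l′ * d + (j + l) * d ≡ i + j * d + d * (l + l′)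
  ring₂ = ℕ-ring
  wrap : ∀ j → s (i + l′ * d + (j + l) * d) ≡ s (i + j * d)
  wrap j = begin
    s (i + l′ * d + (j + l) * d) ≡⟨ cong s (ring₂ i l l′ d j) ⟩
    s (i + j * d + d * (l + l′)) ≡⟨ cong (λ n → s (i + j * d + d * n)) l+l′ ⟩
    s (i + j * d + d * (q * k))  ≡⟨ cong (λ n → s (i + j * d + n)) (sym (ℕₚ.*-assoc d q k)) ⟩
    s (i + j * d + d * q * k)    ≡⟨ period-* {k} {s} ps (d * q) _ ⟩
    s (i + j * d)                ∎

-- k ∸ 1 plays the role of the exponent -1.
tab-op : ∀ k .{{_ : NonZero k}} x s → Period k x → Period k s → ∀ L e d →
  op (tab k (op L e x)) d s ≗ op (tab k x) d (op L (e * (k ∸ 1) * d) s)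
tab-op k x s px ps []            e d i = trans (tab-0 k d s i) (sym (op-0 (tab k x) d i))
tab-op k x s px ps ((c , l) ∷ L) e d i = begin
  op (tab k (λ j → c *ᶻ x (j + l * e) +ᶻ op L e x j)) d s i
    ≡⟨ tab-linear k c (λ j → x (j + l * e)) (op L e x) d s i ⟩
  c *ᶻ op (tab k (λ j → x (j + l * e))) d s i +ᶻ op (tab k (op L e x)) d s i
    ≡⟨ cong₂ (λ u v → c *ᶻ u +ᶻ v)
         (tab-shift k x s px ps (l * e) (l * e * (k ∸ 1)) (l * e) exponent d i)
         (tab-op k x s px ps L e d i) ⟩
  c *ᶻ op (tab k x) d s (i + l * e * (k ∸ 1) * d) +ᶻ op (tab k x) d (op L E s) i
    ≡⟨ cong (λ n → c *ᶻ op (tab k x) d s (i + n) +ᶻ op (tab k x) d (op L E s) i) (ring l e (k ∸ 1) d) ⟩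
  c *ᶻ op (tab k x) d s (i + l * E) +ᶻ op (tab k x) d (op L E s) i
    ≡⟨ cong (λ u → c *ᶻ u +ᶻ op (tab k x) d (op L E s) i) (sym (op-shift (tab k x) d s (l * E) i)) ⟩
  c *ᶻ op (tab k x) d (λ j → s (j + l * E)) i +ᶻ op (tab k x) d (op L E s) i
    ≡⟨ sym (op-linear (tab k x) d c (λ j → s (j + l * E)) (op L E s) i) ⟩
  op (tab k x) d (op ((c , l) ∷ L) E s) i ∎
  where
  E = e * (k ∸ 1) * d
  exponent : l * e + l * e * (k ∸ 1) ≡ l * e * k
  exponent = trans (sym (ℕₚ.*-suc (l * e) (k ∸ 1))) (cong (l * e *_) (ℕₚ.suc-pred k))
  ring : ∀ l e p d → l * e * p * d ≡ l * (e * p * d)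
  ring = ℕ-ring

-- The unit of the group ring. Products in ℤ[ℤ/k] are expressed by letting operators act on it,
-- which loses nothing by `tab-δ`.
δ : ℕ → Seq
δ k i with k ∣? i
... | yes _ = 1ℤ
... | no  _ = 0ℤ

δ-∣ : ∀ {k i} → k ∣ i → δ k i ≡ 1ℤ
δ-∣ {k} {i} k∣i with k ∣? i
... | yes _   = refl
... | no  k∤i = ⊥-elim (k∤i k∣i)

δ-∤ : ∀ {k i} → ¬ k ∣ i → δ k i ≡ 0ℤ
δ-∤ {k} {i} k∤i with k ∣? i
... | yes k∣i = ⊥-elim (k∤i k∣i)
... | no  _   = refl

δ-cong : ∀ k {i j} → (k ∣ i → k ∣ j) → (k ∣ j → k ∣ i) → δ k i ≡ δ k j
δ-cong k {i} {j} f g with k ∣? i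
... | yes k∣i = sym (δ-∣ (f k∣i))
... | no  k∤i = sym (δ-∤ (λ k∣j → k∤i (g k∣j)))

δ-period : ∀ k → Period k (δ k)
δ-period k i = δ-cong k
  (λ k∣i+k → ∣m+n∣m⇒∣n (subst (k ∣_) (ℕₚ.+-comm i k) k∣i+k) ∣-refl)
  (λ k∣i → ∣m∣n⇒∣m+n k∣i ∣-refl)


∤-between : ∀ {k i} → 0 < i → i < k → ¬ k ∣ i
∤-between {i = suc _} _ i<k k∣i = ℕₚ.<⇒≱ i<k (∣⇒≤ k∣i)

-- k - r + n lies strictly between 0 and 2k, so k is the only multiple it could equal. The factor 1
-- is the step `d` in `op`.
δ-miss : ∀ {k r n} → r < k → n < k → n ≢ r → δ k (k ∸ r + n * 1) ≡ 0ℤ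
δ-miss {k} {r} {n} r<k n<k n≢r = δ-∤ (λ h → missed (subst (λ n → k ∣ k ∸ r + n) (ℕₚ.*-identityʳ n) h))
  where
  missed : ¬ k ∣ k ∸ r + n
  missed h with ℕₚ.<-cmp n r
  ... | tri< n<r _ _ = ∤-between (ℕₚ.<-≤-trans (ℕₚ.m<n⇒0<n∸m r<k) (ℕₚ.m≤m+n _ n))
                         (subst (k ∸ r + n <_) (ℕₚ.m∸n+n≡m (ℕₚ.<⇒≤ r<k)) (ℕₚ.+-monoʳ-< (k ∸ r) n<r)) h
  ... | tri≈ _ n≡r _ = n≢r n≡r
  ... | tri> _ _ r<n = ∤-between (ℕₚ.m<n⇒0<n∸m r<n) (ℕₚ.≤-<-trans (ℕₚ.m∸n≤m n r) n<k)
                         (∣m+n∣m⇒∣n (subst (k ∣_) split h) ∣-refl)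
    where
    split : k ∸ r + n ≡ k + (n ∸ r)
    split = begin
      k ∸ r + n             ≡⟨ cong (λ e → k ∸ r + e) (sym (ℕₚ.m+[n∸m]≡n (ℕₚ.<⇒≤ r<n))) ⟩
      k ∸ r + (r + (n ∸ r)) ≡⟨ sym (ℕₚ.+-assoc (k ∸ r) r (n ∸ r)) ⟩
      k ∸ r + r + (n ∸ r)   ≡⟨ cong (_+ (n ∸ r)) (ℕₚ.m∸n+n≡m (ℕₚ.<⇒≤ r<k)) ⟩
      k + (n ∸ r)           ∎

tab-δ≡0 : ∀ {k r} x n → r < k → n ≤ r → op (tab n x) 1 (δ k) (k ∸ r) ≡ 0ℤ
tab-δ≡0 x zero    r<k n≤r = refl
tab-δ≡0 x (suc n) r<k n<r = cong₂ _+ᶻ_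
  (trans (cong (x n *ᶻ_) (δ-miss r<k (ℕₚ.<-trans n<r r<k) (ℕₚ.<⇒≢ n<r))) (ℤₚ.*-zeroʳ (x n)))
  (tab-δ≡0 x n r<k (ℕₚ.<⇒≤ n<r))

-- T moves indices backwards, so the coefficient of T^r is read off at -r, represented by k - r.
tab-δ : ∀ {k r} x n → r < n → n ≤ k → op (tab n x) 1 (δ k) (k ∸ r) ≡ x r
tab-δ {k} {r} x (suc n) r<1+n n<k with n ℕₚ.≟ r
... | yes refl = begin
  x n *ᶻ δ k (k ∸ n + n * 1) +ᶻ op (tab n x) 1 (δ k) (k ∸ n)
    ≡⟨ cong₂ (λ u v → x n *ᶻ u +ᶻ v) (δ-∣ (subst (k ∣_) (sym hit) ∣-refl)) (tab-δ≡0 x n n<k ℕₚ.≤-refl) ⟩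
  x n *ᶻ 1ℤ +ᶻ 0ℤ ≡⟨ ℤₚ.+-identityʳ _ ⟩
  x n *ᶻ 1ℤ       ≡⟨ ℤₚ.*-identityʳ (x n) ⟩
  x n             ∎
  where
  hit : k ∸ n + n * 1 ≡ k
  hit = trans (cong (λ e → k ∸ n + e) (ℕₚ.*-identityʳ n)) (ℕₚ.m∸n+n≡m (ℕₚ.<⇒≤ n<k))
... | no n≢r = begin
  x n *ᶻ δ k (k ∸ r + n * 1) +ᶻ op (tab n x) 1 (δ k) (k ∸ r)
    ≡⟨ cong₂ (λ u v → x n *ᶻ u +ᶻ v) (δ-miss (ℕₚ.<-trans r<n n<k) n<k n≢r) (tab-δ x n r<n (ℕₚ.<⇒≤ n<k)) ⟩
  x n *ᶻ 0ℤ +ᶻ x r ≡⟨ cong (_+ᶻ x r) (ℤₚ.*-zeroʳ (x n)) ⟩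
  0ℤ +ᶻ x r        ≡⟨ ℤₚ.+-identityˡ (x r) ⟩
  x r              ∎
  where
  r<n : r < n
  r<n = ℕₚ.≤∧≢⇒< (ℕₚ.≤-pred r<1+n) (λ r≡n → n≢r (sym r≡n))

-- Descent modulo 2 in the group ring

period-% : ∀ {k} .{{_ : NonZero k}} {s} → Period k s → ∀ i → s i ≡ s (i % k)
period-% {k} {s} p i = trans (cong s (m≡m%n+[m/n]*n i k)) (period-* {k} {s} p (i / k) (i % k))

≡₂-sym : ∀ {x y} → x ≡₂ y → y ≡₂ x
≡₂-sym {x} {y} (t , e) = -ᶻ t , trans (ring y t) (cong (_+ᶻ + 2 *ᶻ (-ᶻ t)) (sym e))
  where
  ring : ∀ y t → y ≡ y +ᶻ + 2 *ᶻ t +ᶻ + 2 *ᶻ (-ᶻ t)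
  ring = ℤ-ring

≡₂-trans : ∀ {x y z} → x ≡₂ y → y ≡₂ z → x ≡₂ z
≡₂-trans {z = z} (t , e) (u , f) = u +ᶻ t , trans e (trans (cong (_+ᶻ + 2 *ᶻ t) f) (ring z t u))
  where
  ring : ∀ z t u → z +ᶻ + 2 *ᶻ u +ᶻ + 2 *ᶻ t ≡ z +ᶻ + 2 *ᶻ (u +ᶻ t)
  ring = ℤ-ring

Odd : ℕ → Set
Odd k = ∃ λ h → k ≡ suc (2 * h)

odd-coprime : ∀ {k} → Odd k → Coprime k 2
odd-coprime {k} (h , refl) {d} (d∣k , d∣2) =
  ∣1⇒≡1 (∣m+n∣m⇒∣n (subst (d ∣_) (ℕₚ.+-comm 1 (2 * h)) d∣k) (∣m⇒∣m*n h d∣2))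

odd-cancel-2 : ∀ {k i} → Odd k → k ∣ 2 * i → k ∣ i
odd-cancel-2 odd = coprime-divisor (odd-coprime odd)

SelfAnnihilating : ℕ → Seq → Set
SelfAnnihilating k y = ∀ i → op (tab k y) 1 (op (tab k y) 2 (δ k)) i ≡ 0ℤ

-- If y ψ(y) = 0, where ψ : T ↦ T², then ψ²(y) ≡ ψ(y)² ≡ y² ψ(y) = 0 modulo 2;
-- as ψ permutes the powers of T for odd k, all coefficients of y are even.
even : ∀ {k} → .{{_ : NonZero k}} → Odd k → ∀ {y} → Period k y → SelfAnnihilating k y → ∀ r → y r ≡₂ 0ℤ
even {k} odd {y} py y·ψy r = subst (_≡₂ 0ℤ) (sym (period-% {k} {y} py r))
  (subst (_≡₂ 0ℤ) (tab-δ y k (m%n<n r k) ℕₚ.≤-refl) (subst (_≡₂ 0ℤ) (unstretch (k ∸ r % k)) (ψψy (4 * (k ∸ r % k)))))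
  where
  Y = tab k y
  ψy² : ∀ i → op Y 2 (op Y 2 (δ k)) i ≡₂ 0ℤ
  ψy² i = ≡₂-trans (≡₂-sym (frobenius Y 1 (op Y 2 (δ k)) i))
            (subst (_≡₂ 0ℤ) (sym (trans (op-cong Y 1 y·ψy i) (op-0 Y 1 i))) (0ℤ , refl))
  ψψy : ∀ i → op Y 4 (δ k) i ≡₂ 0ℤ
  ψψy i = ≡₂-trans (≡₂-sym (frobenius Y 2 (δ k) i)) (ψy² i)
  -- 4 is invertible modulo the odd k, so reading ψ²(y) at multiples of 4 recovers the coefficients
  -- of y.
  unstretch : ∀ i → op Y 4 (δ k) (4 * i) ≡ op Y 1 (δ k) i
  unstretch i = trans (op-stretch Y 1 4 (δ k) i) (op-cong Y 1 (λ j → δ-cong k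
    (λ h → odd-cancel-2 odd (odd-cancel-2 odd (subst (k ∣_) (ℕₚ.*-assoc 2 2 j) h))) (∣n⇒∣m*n 4)) i)

halve : ∀ {k} .{{_ : NonZero k}} → Odd k → ∀ {y} → Period k y → SelfAnnihilating k y →
  ∃ λ y′ → Period k y′ × SelfAnnihilating k y′ × (∀ r → y r ≡ + 2 *ᶻ y′ r)
halve {k} odd {y} py y·ψy = y′ , py′ , self , y≡
  where
  y′ : Seq
  y′ r = quotient (even odd {y} py y·ψy r)
  y≡ : ∀ r → y r ≡ + 2 *ᶻ y′ r
  y≡ r = trans (equality (even odd {y} py y·ψy r)) (ℤₚ.+-identityˡ _)
  py′ : Period k y′
  py′ i = ℤₚ.*-cancelˡ-≡ (+ 2) _ _ (trans (sym (y≡ (i + k))) (trans (py i) (y≡ i)))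
  pull : ∀ d s i → op (tab k y) d s i ≡ + 2 *ᶻ op (tab k y′) d s i
  pull d s i = trans (tab-cong k y≡ d s i) (tab-scale k (+ 2) y′ d s i)
  -- The relation is quadratic in y, so a factor 4 splits off and is cancelled.
  self : SelfAnnihilating k y′
  self i = ℤₚ.*-cancelˡ-≡ (+ 2) _ _ (ℤₚ.*-cancelˡ-≡ (+ 2) _ _ (begin
    + 2 *ᶻ (+ 2 *ᶻ op (tab k y′) 1 (op (tab k y′) 2 (δ k)) i)
      ≡⟨ cong (+ 2 *ᶻ_) (sym (op-scale (tab k y′) 1 (+ 2) (op (tab k y′) 2 (δ k)) i)) ⟩
    + 2 *ᶻ op (tab k y′) 1 (λ j → + 2 *ᶻ op (tab k y′) 2 (δ k) j) i
      ≡⟨ cong (+ 2 *ᶻ_) (op-cong (tab k y′) 1 (λ j → sym (pull 2 (δ k) j)) i) ⟩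
    + 2 *ᶻ op (tab k y′) 1 (op (tab k y) 2 (δ k)) i
      ≡⟨ sym (pull 1 (op (tab k y) 2 (δ k)) i) ⟩
    op (tab k y) 1 (op (tab k y) 2 (δ k)) i
      ≡⟨ y·ψy i ⟩
    + 2 *ᶻ (+ 2 *ᶻ 0ℤ) ∎))

-- The whole sequence is halved, but only the entry at `r` is measured: `n` bounds its absolute
-- value and drops with every halving.
self-annihilating⇒0 : ∀ {k} .{{_ : NonZero k}} → Odd k → ∀ {y} → Period k y → SelfAnnihilating k y → ∀ r → y r ≡ 0ℤ
self-annihilating⇒0 {k} odd {y} py y·ψy r = descend (abs (y r)) {y} py y·ψy ℕₚ.≤-refl
  where
  descend : ∀ n {y} → Period k y → SelfAnnihilating k y → abs (y r) ≤ n → y r ≡ 0ℤ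
  descend zero    py y·ψy y≤n = ℤₚ.∣i∣≡0⇒i≡0 (ℕₚ.n≤0⇒n≡0 y≤n)
  descend (suc n) {y} py y·ψy y≤n =
    let (y′ , py′ , self , y≡) = halve odd {y} py y·ψy
    in trans (y≡ r) (cong (+ 2 *ᶻ_) (descend n {y′} py′ self (half (abs (y′ r))
         (subst (_≤ suc n) (trans (cong abs (y≡ r)) (ℤₚ.abs-* (+ 2) (y′ r))) y≤n))))
    where
    half : ∀ t → 2 * t ≤ suc n → t ≤ n
    half zero    _ = z≤n
    half (suc t) (s≤s h) = ℕₚ.≤-trans (ℕₚ.≤-trans (s≤s (ℕₚ.m≤m+n t 0)) (ℕₚ.m≤n+m _ t)) h

-- The annihilator of x in the group ring ℤ[ℤ/k] is stable under ψ : T ↦ T².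
annihilator-ψ : ∀ {k} .{{_ : NonZero k}} → Odd k → ∀ {x} → Period k x → ∀ L →
  (∀ i → op L 1 x i ≡ 0ℤ) → ∀ i → op L 2 x i ≡ 0ℤ
annihilator-ψ {k} odd {x} px L Lx i = self-annihilating⇒0 odd {op L 2 x} (op-period L 2 px) self i
  where
  X = tab k x
  -- `tab-op` moves `L` off the coefficients at the price of inverting T, so `e₁` and `e₂` stand for
  -- -2 and -4. The step -2 arises twice, from ψ applied to the product D x and from the factor ψ(D)
  -- of y; this coincidence makes y ψ(y) vanish.
  e₁ = 1 * (k ∸ 1) * 2
  e₂ = 2 * (k ∸ 1) * 2
  ring : ∀ p → 2 * p * 1 ≡ 1 * p * 2
  ring = ℕ-ring
  ψD·ψx : ∀ i → op X 2 (op L e₁ (δ k)) i ≡ 0ℤ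
  ψD·ψx i = trans (sym (tab-op k x (δ k) px (δ-period k) L 1 2 i)) (trans (tab-cong k Lx 2 (δ k) i) (tab-0 k 2 (δ k) i))
  self : SelfAnnihilating k (op L 2 x)
  self i = begin
    op (tab k (op L 2 x)) 1 (op (tab k (op L 2 x)) 2 (δ k)) i
      ≡⟨ op-cong (tab k (op L 2 x)) 1 (tab-op k x (δ k) px (δ-period k) L 2 2) i ⟩
    op (tab k (op L 2 x)) 1 s i
      ≡⟨ tab-op k x s px (op-period X 2 (op-period L e₂ (δ-period k))) L 2 1 i ⟩
    op X 1 (op L (2 * (k ∸ 1) * 1) s) i
      ≡⟨ cong (λ e → op X 1 (op L e s) i) (ring (k ∸ 1)) ⟩
    op X 1 (op L e₁ s) i
      ≡⟨ op-cong X 1 (λ j → trans (op-comm L e₁ X 2 (op L e₂ (δ k)) j) 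
           (trans (op-cong X 2 (op-comm L e₁ L e₂ (δ k)) j) (op-comm X 2 L e₂ (op L e₁ (δ k)) j))) i ⟩
    op X 1 (op L e₂ (op X 2 (op L e₁ (δ k)))) i
      ≡⟨ op-cong X 1 (λ j → trans (op-cong L e₂ ψD·ψx j) (op-0 L e₂ j)) i ⟩
    op X 1 (λ _ → 0ℤ) i
      ≡⟨ op-0 X 1 i ⟩
    0ℤ ∎
    where
    s : Seq
    s = op X 2 (op L e₂ (δ k))

-- Integer linear algebra along arithmetic progressions

scaled-difference : ∀ c {x y} → x ≡ y → c *ᶻ (x -ᶻ y) ≡ 0ℤ
scaled-difference c {x} refl = trans (cong (c *ᶻ_) (ℤₚ.+-inverseʳ x)) (ℤₚ.*-zeroʳ c)

-- The last argument of linearₙ is a ring identity, so it is left to the ring solver.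
linear₁ : ∀ {l r l₁ r₁} c₁ → l₁ ≡ r₁ → l -ᶻ r ≡ c₁ *ᶻ (l₁ -ᶻ r₁) → l ≡ r
linear₁ c₁ e₁ h = ℤₚ.i-j≡0⇒i≡j _ _ (trans h (scaled-difference c₁ e₁))

linear₂ : ∀ {l r l₁ r₁ l₂ r₂} c₁ c₂ → l₁ ≡ r₁ → l₂ ≡ r₂ →
  l -ᶻ r ≡ c₁ *ᶻ (l₁ -ᶻ r₁) +ᶻ c₂ *ᶻ (l₂ -ᶻ r₂) → l ≡ r
linear₂ c₁ c₂ e₁ e₂ h =
  ℤₚ.i-j≡0⇒i≡j _ _ (trans h (cong₂ _+ᶻ_ (scaled-difference c₁ e₁) (scaled-difference c₂ e₂)))

linear₃ : ∀ {l r l₁ r₁ l₂ r₂ l₃ r₃} c₁ c₂ c₃ → l₁ ≡ r₁ → l₂ ≡ r₂ → l₃ ≡ r₃ →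
  l -ᶻ r ≡ c₁ *ᶻ (l₁ -ᶻ r₁) +ᶻ c₂ *ᶻ (l₂ -ᶻ r₂) +ᶻ c₃ *ᶻ (l₃ -ᶻ r₃) → l ≡ r
linear₃ c₁ c₂ c₃ e₁ e₂ e₃ h = ℤₚ.i-j≡0⇒i≡j _ _ (trans h (cong₂ _+ᶻ_
  (cong₂ _+ᶻ_ (scaled-difference c₁ e₁) (scaled-difference c₂ e₂)) (scaled-difference c₃ e₃)))

advance : ∀ {s : Seq} {a} (c : Seq) → (∀ i → s (i + a) ≡ s i +ᶻ c i) → (∀ i → c (i + a) ≡ c i) →
  ∀ n i → s (i + n * a) ≡ s i +ᶻ + n *ᶻ c i
advance {s} {a} c step const zero    i = trans (cong s (ℕₚ.+-identityʳ i)) (sym (ℤₚ.+-identityʳ (s i)))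
advance {s} {a} c step const (suc n) i = begin
  s (i + (a + n * a))           ≡⟨ cong s (sym (ℕₚ.+-assoc i a (n * a))) ⟩
  s (i + a + n * a)             ≡⟨ advance {s} {a} c step const n (i + a) ⟩
  s (i + a) +ᶻ + n *ᶻ c (i + a) ≡⟨ cong₂ (λ u v → u +ᶻ + n *ᶻ v) (step i) (const i) ⟩
  s i +ᶻ c i +ᶻ + n *ᶻ c i      ≡⟨ ring (s i) (c i) (+ n) ⟩
  s i +ᶻ (+ 1 +ᶻ + n) *ᶻ c i    ∎
  where
  ring : ∀ u c n → u +ᶻ c +ᶻ n *ᶻ c ≡ u +ᶻ (+ 1 +ᶻ n) *ᶻ c
  ring = ℤ-ring

Δ : ℕ → Seq → Seq
Δ a s i = s (i + a) -ᶻ s i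

-- Along steps of length a the sequence is an arithmetic progression with difference Δ. After k
-- steps it is back at its start, so k Δ = 0. This replaces the semisimplicity of T.
Δ²≡0⇒Δ≡0 : ∀ {k} .{{_ : NonZero k}} a {s} → Period k s → (∀ i → Δ a (Δ a s) i ≡ 0ℤ) → ∀ i → Δ a s i ≡ 0ℤ
Δ²≡0⇒Δ≡0 {k} a {s} p ΔΔ i = ℤₚ.*-cancelˡ-≡ (+ k) _ _ kΔ≡0
  where
  step : ∀ i → s (i + a) ≡ s i +ᶻ Δ a s i
  step i = ring (s (i + a)) (s i)
    where
    ring : ∀ u v → u ≡ v +ᶻ (u +ᶻ -ᶻ v)
    ring = ℤ-ring
  kΔ≡0 : + k *ᶻ Δ a s i ≡ + k *ᶻ 0ℤ
  kΔ≡0 = linear₂ -1ℤ 1ℤ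
    (trans (cong s (cong (λ n → i + n) (ℕₚ.*-comm a k))) (advance {s} {a} (Δ a s) step (λ j → ℤₚ.i-j≡0⇒i≡j _ _ (ΔΔ j)) k i))
    (period-* {k} {s} p a i)
    (ring (+ k *ᶻ Δ a s i) (+ k) (s (i + a * k)) (s i))
    where
    ring : ∀ d k u v → d +ᶻ -ᶻ (k *ᶻ + 0) ≡ -1ℤ *ᶻ (u +ᶻ -ᶻ (v +ᶻ d)) +ᶻ 1ℤ *ᶻ (u +ᶻ -ᶻ v)
    ring = ℤ-ring

-- After k steps of length c the sign has changed an odd number of times, yet the shift by c k is
-- the identity; hence 2 s = 0.
negate⇒0 : ∀ {k} → Odd k → ∀ c {s} → Period k s → (∀ i → s (i + c) ≡ -ᶻ s i) → ∀ i → s i ≡ 0ℤ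
negate⇒0 {k} (h , refl) c {s} p neg i = ℤₚ.*-cancelˡ-≡ (+ 2) _ _ (linear₃ 1ℤ 1ℤ -1ℤ
    (neg i) (advance {λ j → s (j + c)} {c + c} (λ _ → 0ℤ) twice (λ _ → refl) h i)
    (trans (cong s (ring₁ h c i)) (period-* {suc (2 * h)} {s} p c i))
    (ring (s i) (s (i + c)) (s (i + h * (c + c) + c)) (+ h)))
  where
  ring₁ : ∀ h c i → i + h * (c + c) + c ≡ i + c * suc (2 * h)
  ring₁ = ℕ-ring
  twice : ∀ j → s (j + (c + c) + c) ≡ s (j + c) +ᶻ 0ℤ
  twice j = begin
    s (j + (c + c) + c)  ≡⟨ cong s (ring₂ j c) ⟩
    s (j + c + c + c)    ≡⟨ neg (j + c + c) ⟩
    -ᶻ s (j + c + c)     ≡⟨ cong -ᶻ_ (neg (j + c)) ⟩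
    -ᶻ (-ᶻ s (j + c))    ≡⟨ ℤₚ.neg-involutive (s (j + c)) ⟩
    s (j + c)            ≡⟨ sym (ℤₚ.+-identityʳ (s (j + c))) ⟩
    s (j + c) +ᶻ 0ℤ      ∎
    where
    ring₂ : ∀ j c → j + (c + c) + c ≡ j + c + c + c
    ring₂ = ℕ-ring
  ring : ∀ u v w h → + 2 *ᶻ u +ᶻ -ᶻ (+ 2 *ᶻ + 0) ≡
    1ℤ *ᶻ (v +ᶻ -ᶻ (-ᶻ u)) +ᶻ 1ℤ *ᶻ (w +ᶻ -ᶻ (v +ᶻ h *ᶻ + 0)) +ᶻ -1ℤ *ᶻ (w +ᶻ -ᶻ u)
  ring = ℤ-ring

-- Periods, and recurrences for T^a + T^(-a)

period-∣ : ∀ {k} s → Period k s → ∀ {n} → k ∣ n → Period n s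
period-∣ {k} s p (divides q refl) = period-* {k} {s} p q

period-cancel : ∀ s m n → Period (m + n) s → Period n s → Period m s
period-cancel s m n p q i = trans (sym (q (i + m))) (trans (cong s (ℕₚ.+-assoc i m n)) (p i))

period-gcd : ∀ s m n → Period m s → Period n s → Period (gcd m n) s
period-gcd s m n p q with Bézout.identity (gcd-GCD m n)
... | Bézout.+- x y eq = period-cancel s (gcd m n) (y * n)
        (subst (λ l → Period l s) (sym eq) (period-* {m} {s} p x)) (period-* {n} {s} q y)
... | Bézout.-+ x y eq = period-cancel s (gcd m n) (x * m)
        (subst (λ l → Period l s) (sym eq) (period-* {n} {s} q y)) (period-* {m} {s} p x)

-- T^a + T^(-a), where a⁻ stands for -a: a + a⁻ is a multiple of the period.
-- Opaque, so that the sequence s can be inferred from op (cosPoly a a⁻) d s.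
opaque
  cosPoly : ℕ → ℕ → Poly
  cosPoly a a⁻ = (1ℤ , a) ∷ (1ℤ , a⁻) ∷ []

  cos-≡ : ∀ a a⁻ d s i → op (cosPoly a a⁻) d s i ≡ s (i + a * d) +ᶻ s (i + a⁻ * d)
  cos-≡ a a⁻ d s i = ring (s (i + a * d)) (s (i + a⁻ * d))
    where
    ring : ∀ u v → 1ℤ *ᶻ u +ᶻ (1ℤ *ᶻ v +ᶻ + 0) ≡ u +ᶻ v
    ring = ℤ-ring

cos : ℕ → ℕ → Seq → Seq
cos a a⁻ s = op (cosPoly a a⁻) 1 s

cos₁-≡ : ∀ a a⁻ s i → cos a a⁻ s i ≡ s (i + a) +ᶻ s (i + a⁻)
cos₁-≡ a a⁻ s i = trans (cos-≡ a a⁻ 1 s i)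
  (cong₂ (λ u v → s (i + u) +ᶻ s (i + v)) (ℕₚ.*-identityʳ a) (ℕₚ.*-identityʳ a⁻))

cos₁-+a : ∀ {k} a a⁻ s → Period k s → k ∣ a + a⁻ → ∀ i → cos a a⁻ s (i + a) ≡ s (i + a + a) +ᶻ s i
cos₁-+a a a⁻ s p e i = trans (cos₁-≡ a a⁻ s (i + a)) (cong (s (i + a + a) +ᶻ_)
  (trans (cong s (ℕₚ.+-assoc i a a⁻)) (period-∣ s p e i)))

module _ {k a a⁻} (a+a⁻ : k ∣ a + a⁻) where

  private
    X = cos a a⁻

  cos-doubling : ∀ s → Period k s → ∀ i → op (cosPoly a a⁻) 2 s i ≡ X (X s) i -ᶻ + 2 *ᶻ s i
  cos-doubling s p i = begin
    op (cosPoly a a⁻) 2 s i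
      ≡⟨ trans (cos-≡ a a⁻ 2 s i) (cong₂ (λ u v → s u +ᶻ s v) (twice i a) (twice i a⁻)) ⟩
    s (i + a + a) +ᶻ s (i + a⁻ + a⁻)
      ≡⟨ ring (s (i + a + a)) (s (i + a⁻ + a⁻)) (s i) ⟩
    s (i + a + a) +ᶻ s i +ᶻ (s i +ᶻ s (i + a⁻ + a⁻)) -ᶻ + 2 *ᶻ s i
      ≡⟨ cong (_-ᶻ + 2 *ᶻ s i) (sym XX) ⟩
    X (X s) i -ᶻ + 2 *ᶻ s i ∎
    where
    twice : ∀ i a → i + a * 2 ≡ i + a + a
    twice = ℕ-ring
    ring : ∀ u v w → u +ᶻ v ≡ u +ᶻ w +ᶻ (w +ᶻ v) +ᶻ -ᶻ (+ 2 *ᶻ w)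
    ring = ℤ-ring
    wrap : ∀ i → i + a⁻ + a ≡ i + (a + a⁻)
    wrap i = trans (ℕₚ.+-assoc i a⁻ a) (cong (λ n → i + n) (ℕₚ.+-comm a⁻ a))
    XX : X (X s) i ≡ s (i + a + a) +ᶻ s i +ᶻ (s i +ᶻ s (i + a⁻ + a⁻))
    XX = trans (cos₁-≡ a a⁻ (X s) i) (cong₂ _+ᶻ_ (cos₁-+a a a⁻ s p a+a⁻ i)
      (trans (cos₁-≡ a a⁻ s (i + a⁻)) (cong (_+ᶻ s (i + a⁻ + a⁻)) (trans (cong s (wrap i)) (period-∣ s p a+a⁻ i)))))

  private
    -- Multiplication by T^(2a) clears the negative powers in X and X²: in terms of s only shifts by
    -- multiples of a remain, and `a⁻` disappears.
    X⟨2a⟩ : ∀ s → Period k s → ∀ i → X s (i + a + a) ≡ s (i + a + a + a) +ᶻ s (i + a)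
    X⟨2a⟩ s p i = cos₁-+a a a⁻ s p a+a⁻ (i + a)

    X²⟨2a⟩ : ∀ s → Period k s → ∀ i →
      X (X s) (i + a + a) ≡ s (i + a + a + a + a) +ᶻ s (i + a + a) +ᶻ (s (i + a + a) +ᶻ s i)
    X²⟨2a⟩ s p i = trans (cos₁-+a a a⁻ (X s) (op-period (cosPoly a a⁻) 1 p) a+a⁻ (i + a))
      (cong₂ _+ᶻ_ (cos₁-+a a a⁻ s p a+a⁻ (i + a + a)) (cos₁-+a a a⁻ s p a+a⁻ i))

  -- T^(2a) X² = (T^(2a) + 1)². Each factor T^(2a) + 1 is injective by `negate⇒0`, applied to u =
  -- (T^(2a) + 1) s and then to s.
  cos²≡0⇒0 : Odd k → ∀ s → Period k s → (∀ i → X (X s) i ≡ 0ℤ) → ∀ i → s i ≡ 0ℤ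
  cos²≡0⇒0 odd s p XX = negate⇒0 odd (a + a) {s} p (λ i → linear₁ 1ℤ (u≡0 i) (ring′ (s (i + (a + a))) (s i)))
    where
    u : Seq
    u i = s (i + (a + a)) +ᶻ s i
    ring : ∀ v w t e → v +ᶻ w +ᶻ -ᶻ (-ᶻ (w +ᶻ t)) ≡ 1ℤ *ᶻ (e +ᶻ -ᶻ + 0) +ᶻ -1ℤ *ᶻ (e +ᶻ -ᶻ (v +ᶻ w +ᶻ (w +ᶻ t)))
    ring = ℤ-ring
    ring′ : ∀ v w → v +ᶻ -ᶻ (-ᶻ w) ≡ 1ℤ *ᶻ (v +ᶻ w +ᶻ -ᶻ + 0)
    ring′ = ℤ-ring
    u≡0 : ∀ i → u i ≡ 0ℤ
    u≡0 = negate⇒0 odd (a + a) {u}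
      (λ i → cong₂ _+ᶻ_ (trans (sym (cong s (swap i k (a + a)))) (p (i + (a + a)))) (p i))
      (λ i → trans
        (cong₂ _+ᶻ_ (cong s (four i a)) (cong s (sym (ℕₚ.+-assoc i a a))))
        (trans (linear₂ 1ℤ -1ℤ (XX (i + a + a)) (X²⟨2a⟩ s p i)
                 (ring (s (i + a + a + a + a)) (s (i + a + a)) (s i) (X (X s) (i + a + a))))
               (cong (λ n → -ᶻ (s n +ᶻ s i)) (ℕₚ.+-assoc i a a))))
      where
      swap : ∀ i k c → i + c + k ≡ i + k + c
      swap = ℕ-ring
      four : ∀ i a → i + (a + a) + (a + a) ≡ i + a + a + a + a
      four = ℕ-ring

  Δ-period : ∀ s → Period k s → Period k (Δ a s)
  Δ-period s p i = cong₂ _-ᶻ_ (trans (cong s (swap i k a)) (p (i + a))) (p i)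
    where
    swap : ∀ i k c → i + k + c ≡ i + c + k
    swap = ℕ-ring

  -- The hypothesis is (X - 2)² s = 0, and X - 2 = T^(-a) (T^a - 1)². So (T^a - 1)⁴ s = 0, and the
  -- exponent is lowered one at a time by `Δ²≡0⇒Δ≡0`.
  unipotent : .{{_ : NonZero k}} → ∀ s → Period k s →
    (∀ i → X (X s) i ≡ + 4 *ᶻ X s i -ᶻ + 4 *ᶻ s i) → Period a s
  unipotent s p XX i = ℤₚ.i-j≡0⇒i≡j _ _ (Δ²≡0⇒Δ≡0 a {s} p Δ²≡0 i)
    where
    ring : ∀ s₀ s₁ s₂ s₃ s₄ e₁ e₂ →
      (s₄ +ᶻ -ᶻ s₃ +ᶻ -ᶻ (s₃ +ᶻ -ᶻ s₂) +ᶻ -ᶻ (s₃ +ᶻ -ᶻ s₂ +ᶻ -ᶻ (s₂ +ᶻ -ᶻ s₁)) +ᶻ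
       -ᶻ (s₃ +ᶻ -ᶻ s₂ +ᶻ -ᶻ (s₂ +ᶻ -ᶻ s₁) +ᶻ -ᶻ (s₂ +ᶻ -ᶻ s₁ +ᶻ -ᶻ (s₁ +ᶻ -ᶻ s₀)))) +ᶻ -ᶻ + 0
      ≡ 1ℤ *ᶻ (e₂ +ᶻ -ᶻ (+ 4 *ᶻ e₁ +ᶻ -ᶻ (+ 4 *ᶻ s₂))) +ᶻ -1ℤ *ᶻ (e₂ +ᶻ -ᶻ (s₄ +ᶻ s₂ +ᶻ (s₂ +ᶻ s₀)))
        +ᶻ + 4 *ᶻ (e₁ +ᶻ -ᶻ (s₃ +ᶻ s₁))
    ring = ℤ-ring
    p¹ = Δ-period s p
    p² = Δ-period (Δ a s) p¹
    Δ⁴≡0 : ∀ i → Δ a (Δ a (Δ a (Δ a s))) i ≡ 0ℤ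
    Δ⁴≡0 i = linear₃ 1ℤ -1ℤ (+ 4) (XX (i + a + a)) (X²⟨2a⟩ s p i) (X⟨2a⟩ s p i)
      (ring (s i) (s (i + a)) (s (i + a + a)) (s (i + a + a + a)) (s (i + a + a + a + a))
            (X s (i + a + a)) (X (X s) (i + a + a)))
    Δ³≡0 : ∀ i → Δ a (Δ a (Δ a s)) i ≡ 0ℤ
    Δ³≡0 = Δ²≡0⇒Δ≡0 a {Δ a (Δ a s)} p² Δ⁴≡0
    Δ²≡0 : ∀ i → Δ a (Δ a s) i ≡ 0ℤ
    Δ²≡0 = Δ²≡0⇒Δ≡0 a {Δ a s} p¹ Δ³≡0

  module _ (s : Seq) (p : Period k s) (XX : ∀ i → X (X s) i ≡ s i -ᶻ X s i) where

    -- T^(2a) (X² + X - 1) is the fifth cyclotomic polynomial in T^a.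
    fifth-sum : ∀ i → s (i + a + a + a + a) +ᶻ s (i + a + a + a) +ᶻ s (i + a + a) +ᶻ s (i + a) +ᶻ s i ≡ 0ℤ
    fifth-sum i = linear₃ 1ℤ -1ℤ -1ℤ (XX (i + a + a)) (X²⟨2a⟩ s p i) (X⟨2a⟩ s p i)
      (ring (s i) (s (i + a)) (s (i + a + a)) (s (i + a + a + a)) (s (i + a + a + a + a))
            (X s (i + a + a)) (X (X s) (i + a + a)))
      where
      ring : ∀ s₀ s₁ s₂ s₃ s₄ e₁ e₂ → (s₄ +ᶻ s₃ +ᶻ s₂ +ᶻ s₁ +ᶻ s₀) +ᶻ -ᶻ + 0
        ≡ 1ℤ *ᶻ (e₂ +ᶻ -ᶻ (s₂ +ᶻ -ᶻ e₁)) +ᶻ -1ℤ *ᶻ (e₂ +ᶻ -ᶻ (s₄ +ᶻ s₂ +ᶻ (s₂ +ᶻ s₀)))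
          +ᶻ -1ℤ *ᶻ (e₁ +ᶻ -ᶻ (s₃ +ᶻ s₁))
      ring = ℤ-ring

    fifth-root : Period (5 * a) s
    fifth-root i = trans (cong s (five i a)) (linear₂ 1ℤ -1ℤ (fifth-sum (i + a)) (fifth-sum i)
      (ring (s i) (s (i + a)) (s (i + a + a)) (s (i + a + a + a)) (s (i + a + a + a + a)) (s (i + a + a + a + a + a))))
      where
      five : ∀ i a → i + 5 * a ≡ i + a + a + a + a + a
      five = ℕ-ring
      ring : ∀ s₀ s₁ s₂ s₃ s₄ s₅ → s₅ +ᶻ -ᶻ s₀
        ≡ 1ℤ *ᶻ ((s₅ +ᶻ s₄ +ᶻ s₃ +ᶻ s₂ +ᶻ s₁) +ᶻ -ᶻ + 0) +ᶻ -1ℤ *ᶻ ((s₄ +ᶻ s₃ +ᶻ s₂ +ᶻ s₁ +ᶻ s₀) +ᶻ -ᶻ + 0)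
      ring = ℤ-ring

    fixed⇒0 : Period a s → ∀ i → s i ≡ 0ℤ
    fixed⇒0 f i = ℤₚ.*-cancelˡ-≡ (+ 5) _ _ (trans (ring (s i)) (trans (sym
      (cong₂ _+ᶻ_ (cong₂ _+ᶻ_ (cong₂ _+ᶻ_ (cong₂ _+ᶻ_ s₄ s₃) s₂) s₁) refl)) (fifth-sum i)))
      where
      s₁ = f i
      s₂ = trans (f (i + a)) s₁
      s₃ = trans (f (i + a + a)) s₂
      s₄ = trans (f (i + a + a + a)) s₃
      ring : ∀ u → + 5 *ᶻ u ≡ u +ᶻ u +ᶻ u +ᶻ u +ᶻ u
      ring = ℤ-ring

op-linear₂ : ∀ L d c e s t i → op L d (λ j → c *ᶻ s j +ᶻ e *ᶻ t j) i ≡ c *ᶻ op L d s i +ᶻ e *ᶻ op L d t i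
op-linear₂ L d c e s t i = trans (op-linear L d c s (λ j → e *ᶻ t j) i)
  (cong (c *ᶻ op L d s i +ᶻ_) (op-scale L d e t i))

op-++ : ∀ L M d s i → op (L ++ M) d s i ≡ op L d s i +ᶻ op M d s i
op-++ []            M d s i = sym (ℤₚ.+-identityˡ _)
op-++ ((c , l) ∷ L) M d s i = trans (cong (c *ᶻ s (i + l * d) +ᶻ_) (op-++ L M d s i))
  (sym (ℤₚ.+-assoc (c *ᶻ s (i + l * d)) (op L d s i) (op M d s i)))

-- The equation m + p = n + q expresses the congruence of m and n modulo known periods without
-- subtraction; p or q may be 0.
period-agree : ∀ s {p q m n} → Period p s → Period q s → m + p ≡ n + q → ∀ i → s (i + m) ≡ s (i + n)
period-agree s {p} {q} {m} {n} pp pq e i = begin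
  s (i + m)     ≡⟨ sym (pp (i + m)) ⟩
  s (i + m + p) ≡⟨ cong s (trans (ℕₚ.+-assoc i m p) (trans (cong (λ n → i + n) e) (sym (ℕₚ.+-assoc i n q)))) ⟩
  s (i + n + q) ≡⟨ pq (i + n) ⟩
  s (i + n)     ∎

period-+ : ∀ s {m n} → Period m s → Period n s → Period (m + n) s
period-+ s {m} {n} p q i = trans (cong s (sym (ℕₚ.+-assoc i m n))) (trans (q (i + m)) (p i))

∤⇒gcd[5,k]≡1 : ∀ k → ¬ 5 ∣ k → gcd 5 k ≡ 1
∤⇒gcd[5,k]≡1 k 5∤k with prime⇒irreducible (from-yes (prime? 5)) (gcd[m,n]∣m 5 k)
... | inj₁ g≡1 = g≡1
... | inj₂ g≡5 = ⊥-elim (5∤k (subst (_∣ k) g≡5 (gcd[m,n]∣n 5 k)))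

-- Solving D x = 0 for ε = 1 and for ε = -1

module Circulant {k : ℕ} .{{_ : NonZero k}} (odd : Odd k) {a a⁻ b b⁻ : ℕ}
  (a+a⁻ : k ∣ a + a⁻) (b+b⁻ : k ∣ b + b⁻) where

  A = cosPoly a a⁻
  B = cosPoly b b⁻
  X Y : Seq → Seq
  X = op A 1
  Y = op B 1

  -- (X + ε) (Y + ε) - ε²
  D : ℤ → Poly
  D ε = (1ℤ , a + b) ∷ (1ℤ , a + b⁻) ∷ (1ℤ , a⁻ + b) ∷ (1ℤ , a⁻ + b⁻)
      ∷ (ε , a) ∷ (ε , a⁻) ∷ (ε , b) ∷ (ε , b⁻) ∷ []

  D-≡ : ∀ ε d s i → op (D ε) d s i ≡ op A d (op B d s) i +ᶻ ε *ᶻ op A d s i +ᶻ ε *ᶻ op B d s i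
  D-≡ ε d s i = begin
    op (D ε) d s i
      ≡⟨ cong₂ _+ᶻ_ (e a b) (cong₂ _+ᶻ_ (e a b⁻) (cong₂ _+ᶻ_ (e a⁻ b) (cong₂ _+ᶻ_ (e a⁻ b⁻) refl))) ⟩
    1ℤ *ᶻ at (i + a * d) b +ᶻ (1ℤ *ᶻ at (i + a * d) b⁻ +ᶻ (1ℤ *ᶻ at (i + a⁻ * d) b +ᶻ (1ℤ *ᶻ at (i + a⁻ * d) b⁻ +ᶻ
      (ε *ᶻ at i a +ᶻ (ε *ᶻ at i a⁻ +ᶻ (ε *ᶻ at i b +ᶻ (ε *ᶻ at i b⁻ +ᶻ 0ℤ)))))))
      ≡⟨ ring ε (at (i + a * d) b) (at (i + a * d) b⁻) (at (i + a⁻ * d) b) (at (i + a⁻ * d) b⁻)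
          (at i a) (at i a⁻) (at i b) (at i b⁻) ⟩
    at (i + a * d) b +ᶻ at (i + a * d) b⁻ +ᶻ (at (i + a⁻ * d) b +ᶻ at (i + a⁻ * d) b⁻)
      +ᶻ ε *ᶻ (at i a +ᶻ at i a⁻) +ᶻ ε *ᶻ (at i b +ᶻ at i b⁻)
      ≡⟨ sym (cong₂ _+ᶻ_ (cong₂ (λ u v → u +ᶻ ε *ᶻ v)
          (trans (cos-≡ a a⁻ d (op B d s) i) (cong₂ _+ᶻ_ (cos-≡ b b⁻ d s (i + a * d)) (cos-≡ b b⁻ d s (i + a⁻ * d))))
          (cos-≡ a a⁻ d s i)) (cong (ε *ᶻ_) (cos-≡ b b⁻ d s i))) ⟩
    op A d (op B d s) i +ᶻ ε *ᶻ op A d s i +ᶻ ε *ᶻ op B d s i ∎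
    where
    at : ℕ → ℕ → ℤ
    at j c = s (j + c * d)
    dist : ∀ i a b d → i + (a + b) * d ≡ i + a * d + b * d
    dist = ℕ-ring
    e : ∀ a b → 1ℤ *ᶻ s (i + (a + b) * d) ≡ 1ℤ *ᶻ s (i + a * d + b * d)
    e a b = cong (λ n → 1ℤ *ᶻ s n) (dist i a b d)
    ring : ∀ ε s₁ s₂ s₃ s₄ t₁ t₂ u₁ u₂ →
      1ℤ *ᶻ s₁ +ᶻ (1ℤ *ᶻ s₂ +ᶻ (1ℤ *ᶻ s₃ +ᶻ (1ℤ *ᶻ s₄ +ᶻ (ε *ᶻ t₁ +ᶻ (ε *ᶻ t₂ +ᶻ (ε *ᶻ u₁ +ᶻ (ε *ᶻ u₂ +ᶻ + 0)))))))
      ≡ s₁ +ᶻ s₂ +ᶻ (s₃ +ᶻ s₄) +ᶻ ε *ᶻ (t₁ +ᶻ t₂) +ᶻ ε *ᶻ (u₁ +ᶻ u₂)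
    ring = ℤ-ring

  -- Since ε² = 1, the hypothesis on x reads ((X + ε) (Y + ε) - 1) x = 0.
  module Annihilated (ε : ℤ) (ε² : ε *ᶻ ε ≡ 1ℤ) (x : Seq) (p : Period k x)
    (killed : ∀ i → X (Y x) i +ᶻ ε *ᶻ X x i +ᶻ ε *ᶻ Y x i ≡ 0ℤ) where

    M : Seq
    M = X (Y x)

    M-≡ : ∀ i → M i ≡ (-ᶻ ε) *ᶻ X x i +ᶻ (-ᶻ ε) *ᶻ Y x i
    M-≡ i = linear₁ 1ℤ (killed i) (ring ε (M i) (X x i) (Y x i))
      where
      ring : ∀ ε m u v → m +ᶻ -ᶻ ((-ᶻ ε) *ᶻ u +ᶻ (-ᶻ ε) *ᶻ v) ≡ 1ℤ *ᶻ (m +ᶻ ε *ᶻ u +ᶻ ε *ᶻ v +ᶻ -ᶻ + 0)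
      ring = ℤ-ring

    XM : ∀ i → X M i ≡ (-ᶻ ε) *ᶻ X (X x) i +ᶻ (-ᶻ ε) *ᶻ M i
    XM i = trans (op-cong A 1 M-≡ i) (op-linear₂ A 1 (-ᶻ ε) (-ᶻ ε) (X x) (Y x) i)

    YM : ∀ i → Y M i ≡ (-ᶻ ε) *ᶻ M i +ᶻ (-ᶻ ε) *ᶻ Y (Y x) i
    YM i = trans (op-cong B 1 M-≡ i) (trans (op-linear₂ B 1 (-ᶻ ε) (-ᶻ ε) (X x) (Y x) i)
      (cong (λ u → (-ᶻ ε) *ᶻ u +ᶻ (-ᶻ ε) *ᶻ Y (Y x) i) (op-comm B 1 A 1 x i)))

    -- The square of X Y = -ε (X + Y). Substituting `M-≡` for X Y one factor at a time keeps every
    -- operator applied to x.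
    X²Y² : ∀ i → X (X (Y (Y x))) i ≡ X (X x) i +ᶻ + 2 *ᶻ M i +ᶻ Y (Y x) i
    X²Y² i = begin
      X (X (Y (Y x))) i   ≡⟨ op-cong A 1 (op-comm A 1 B 1 (Y x)) i ⟩
      X (Y M) i           ≡⟨ op-cong A 1 YM i ⟩
      X (λ j → (-ᶻ ε) *ᶻ M j +ᶻ (-ᶻ ε) *ᶻ Y (Y x) j) i ≡⟨ op-linear₂ A 1 (-ᶻ ε) (-ᶻ ε) M (Y (Y x)) i ⟩
      (-ᶻ ε) *ᶻ X M i +ᶻ (-ᶻ ε) *ᶻ X (Y (Y x)) i
        ≡⟨ cong (λ u → (-ᶻ ε) *ᶻ X M i +ᶻ (-ᶻ ε) *ᶻ u) (op-comm A 1 B 1 (Y x) i) ⟩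
      (-ᶻ ε) *ᶻ X M i +ᶻ (-ᶻ ε) *ᶻ Y M i
        ≡⟨ cong₂ (λ u v → (-ᶻ ε) *ᶻ u +ᶻ (-ᶻ ε) *ᶻ v) (XM i) (YM i) ⟩
      (-ᶻ ε) *ᶻ ((-ᶻ ε) *ᶻ X (X x) i +ᶻ (-ᶻ ε) *ᶻ M i) +ᶻ (-ᶻ ε) *ᶻ ((-ᶻ ε) *ᶻ M i +ᶻ (-ᶻ ε) *ᶻ Y (Y x) i)
        ≡⟨ ring ε (X (X x) i) (M i) (Y (Y x) i) ⟩
      ε *ᶻ ε *ᶻ (X (X x) i +ᶻ + 2 *ᶻ M i +ᶻ Y (Y x) i)
        ≡⟨ trans (cong (_*ᶻ (X (X x) i +ᶻ + 2 *ᶻ M i +ᶻ Y (Y x) i)) ε²) (ℤₚ.*-identityˡ _) ⟩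
      X (X x) i +ᶻ + 2 *ᶻ M i +ᶻ Y (Y x) i ∎
      where
      ring : ∀ ε u w v → (-ᶻ ε) *ᶻ ((-ᶻ ε) *ᶻ u +ᶻ (-ᶻ ε) *ᶻ w) +ᶻ (-ᶻ ε) *ᶻ ((-ᶻ ε) *ᶻ w +ᶻ (-ᶻ ε) *ᶻ v)
        ≡ ε *ᶻ ε *ᶻ (u +ᶻ + 2 *ᶻ w +ᶻ v)
      ring = ℤ-ring

    doubled : ∀ i → op A 2 (op B 2 x) i +ᶻ ε *ᶻ op A 2 x i +ᶻ ε *ᶻ op B 2 x i ≡ 0ℤ
    doubled i = trans (sym (D-≡ ε 2 x i))
      (annihilator-ψ odd {x} p (D ε) (λ j → trans (D-≡ ε 1 x j) (killed j)) i)

    B₂ : ∀ i → op B 2 x i ≡ 1ℤ *ᶻ Y (Y x) i +ᶻ (-ᶻ + 2) *ᶻ x i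
    B₂ i = trans (cos-doubling b+b⁻ x p i) (ring (Y (Y x) i) (x i))
      where
      ring : ∀ u v → u +ᶻ -ᶻ (+ 2 *ᶻ v) ≡ 1ℤ *ᶻ u +ᶻ (-ᶻ + 2) *ᶻ v
      ring = ℤ-ring

    X²B₂ : ∀ i → X (X (op B 2 x)) i ≡ 1ℤ *ᶻ X (X (Y (Y x))) i +ᶻ (-ᶻ + 2) *ᶻ X (X x) i
    X²B₂ i = trans
      (op-cong A 1 (λ j → trans (op-cong A 1 B₂ j) (op-linear₂ A 1 1ℤ (-ᶻ + 2) (Y (Y x)) x j)) i)
      (op-linear₂ A 1 1ℤ (-ᶻ + 2) (X (Y (Y x))) (X x) i)

    -- ψ(D) = (X² - 2) (Y² - 2) + ε (X² - 2) + ε (Y² - 2) with X² Y² eliminated. For ε = 1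
    -- everything but 2 X Y cancels; for ε = -1 the terms double to 2 (X Y + 4 - X² - Y²).
    doubled-≡ : ∀ i → + 2 *ᶻ M i +ᶻ + 4 *ᶻ x i -ᶻ X (X x) i -ᶻ Y (Y x) i
                      +ᶻ ε *ᶻ (X (X x) i +ᶻ Y (Y x) i -ᶻ + 4 *ᶻ x i) ≡ 0ℤ
    doubled-≡ i = trans
      (ring ε (X (X x) i) (Y (Y x) i) (M i) (x i))
      (trans (sym (cong₂ _+ᶻ_ (cong₂ (λ u v → u +ᶻ ε *ᶻ v) A₂B₂ (cos-doubling a+a⁻ x p i))
        (cong (ε *ᶻ_) (B₂ i)))) (doubled i))
      where
      A₂B₂ : op A 2 (op B 2 x) i ≡ 1ℤ *ᶻ (X (X x) i +ᶻ + 2 *ᶻ M i +ᶻ Y (Y x) i) +ᶻ (-ᶻ + 2) *ᶻ X (X x) i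
               -ᶻ + 2 *ᶻ (1ℤ *ᶻ Y (Y x) i +ᶻ (-ᶻ + 2) *ᶻ x i)
      A₂B₂ = trans (cos-doubling a+a⁻ (op B 2 x) (op-period B 2 p) i)
        (cong₂ (λ u v → u -ᶻ + 2 *ᶻ v)
          (trans (X²B₂ i) (cong (λ u → 1ℤ *ᶻ u +ᶻ (-ᶻ + 2) *ᶻ X (X x) i) (X²Y² i))) (B₂ i))
      ring : ∀ ε u v w x →
        + 2 *ᶻ w +ᶻ + 4 *ᶻ x +ᶻ -ᶻ u +ᶻ -ᶻ v +ᶻ ε *ᶻ (u +ᶻ v +ᶻ -ᶻ (+ 4 *ᶻ x))
        ≡ 1ℤ *ᶻ (u +ᶻ + 2 *ᶻ w +ᶻ v) +ᶻ (-ᶻ + 2) *ᶻ u +ᶻ -ᶻ (+ 2 *ᶻ (1ℤ *ᶻ v +ᶻ (-ᶻ + 2) *ᶻ x))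
          +ᶻ ε *ᶻ (u +ᶻ -ᶻ (+ 2 *ᶻ x)) +ᶻ ε *ᶻ (1ℤ *ᶻ v +ᶻ (-ᶻ + 2) *ᶻ x)
      ring = ℤ-ring

  -- Here X and Y act on w as the two roots of t² + t - 1, that is as ζ + ζ⁻¹ and ζ² + ζ⁻² with ζ⁵ = 1.
  golden-pair⇒0 : (w : Seq) → Period k w →
    (∀ i → X w i +ᶻ Y w i ≡ -ᶻ w i) → (∀ i → X (Y w) i ≡ -ᶻ w i) → a ≤ b →
    gcd (gcd k a) b ≡ 1 → (5 ∣ k → 5 ∣ a ⊎ 5 ∣ b ⊎ 5 ∣ (b ∸ a) ⊎ 5 ∣ (a + b)) → ∀ i → w i ≡ 0ℤ
  golden-pair⇒0 w p X+Y XY a≤b gcd≡1 mod5 = result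
    where
    unit : ∀ u v → 1ℤ *ᶻ u +ᶻ 1ℤ *ᶻ v ≡ u +ᶻ v
    unit = ℤ-ring
    neg : ∀ u → -ᶻ u ≡ -1ℤ *ᶻ u
    neg = ℤ-ring
    A-root : ∀ i → X (X w) i ≡ w i -ᶻ X w i
    A-root i = linear₂ 1ℤ -1ℤ
      (trans (sym (op-linear₂ A 1 1ℤ 1ℤ (X w) (Y w) i))
        (trans (op-cong A 1 (λ j → trans (unit (X w j) (Y w j)) (trans (X+Y j) (neg (w j)))) i) (op-scale A 1 -1ℤ w i)))
      (XY i) (ring (X (X w) i) (X (Y w) i) (X w i) (w i))
      where
      ring : ∀ u m v w → u +ᶻ -ᶻ (w +ᶻ -ᶻ v)
        ≡ 1ℤ *ᶻ (1ℤ *ᶻ u +ᶻ 1ℤ *ᶻ m +ᶻ -ᶻ (-1ℤ *ᶻ v)) +ᶻ -1ℤ *ᶻ (m +ᶻ -ᶻ (-ᶻ w))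
      ring = ℤ-ring
    B-root : ∀ i → Y (Y w) i ≡ w i -ᶻ Y w i
    B-root i = linear₂ 1ℤ -1ℤ
      (trans (sym (op-linear₂ B 1 1ℤ 1ℤ (X w) (Y w) i))
        (trans (op-cong B 1 (λ j → trans (unit (X w j) (Y w j)) (trans (X+Y j) (neg (w j)))) i) (op-scale B 1 -1ℤ w i)))
      (trans (op-comm B 1 A 1 w i) (XY i)) (ring (Y (X w) i) (Y (Y w) i) (Y w i) (w i))
      where
      ring : ∀ m u v w → u +ᶻ -ᶻ (w +ᶻ -ᶻ v)
        ≡ 1ℤ *ᶻ (1ℤ *ᶻ m +ᶻ 1ℤ *ᶻ u +ᶻ -ᶻ (-1ℤ *ᶻ v)) +ᶻ -1ℤ *ᶻ (m +ᶻ -ᶻ (-ᶻ w))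
      ring = ℤ-ring
    a-fixed : Period a w → ∀ i → w i ≡ 0ℤ
    a-fixed = fixed⇒0 a+a⁻ w p A-root
    b-fixed : Period b w → ∀ i → w i ≡ 0ℤ
    b-fixed = fixed⇒0 b+b⁻ w p B-root
    -- If X = Y on w, then X² w = X Y w = -w and X² w = w - X w give X w = 2 w, whereas X w + Y w =
    -- -w; hence 5 w = 0.
    X≡Y⇒0 : (∀ i → X w i ≡ Y w i) → ∀ i → w i ≡ 0ℤ
    X≡Y⇒0 e i = ℤₚ.*-cancelˡ-≡ (+ 5) _ _ (linear₃ (-ᶻ + 2) (+ 2) 1ℤ
      (trans (A-root i) (cong (λ u → w i -ᶻ u) (e i)))
      (trans (op-cong A 1 e i) (XY i))
      (trans (cong (_+ᶻ Y w i) (sym (e i))) (X+Y i))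
      (ring (X (X w) i) (Y w i) (w i)))
      where
      ring : ∀ xx y w → + 5 *ᶻ w +ᶻ -ᶻ (+ 5 *ᶻ + 0)
        ≡ (-ᶻ + 2) *ᶻ (xx +ᶻ -ᶻ (w +ᶻ -ᶻ y)) +ᶻ + 2 *ᶻ (xx +ᶻ -ᶻ (-ᶻ w)) +ᶻ 1ℤ *ᶻ (y +ᶻ y +ᶻ -ᶻ (-ᶻ w))
      ring = ℤ-ring
    -- 5a and 5b are periods by `fifth-root`; k is weakened to 5k so that the factor 5 can be taken
    -- out of the gcd.
    period-5 : Period 5 w
    period-5 = subst (λ n → Period n w) (begin
      gcd (gcd (5 * k) (5 * a)) (5 * b) ≡⟨ cong (λ g → gcd g (5 * b)) (sym (c*gcd[m,n]≡gcd[cm,cn] 5 k a)) ⟩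
      gcd (5 * gcd k a) (5 * b)         ≡⟨ sym (c*gcd[m,n]≡gcd[cm,cn] 5 (gcd k a) b) ⟩
      5 * gcd (gcd k a) b               ≡⟨ cong (5 *_) gcd≡1 ⟩
      5                                 ∎)
      (period-gcd w (gcd (5 * k) (5 * a)) (5 * b)
        (period-gcd w (5 * k) (5 * a) (period-* {k} {w} p 5) (fifth-root a+a⁻ w p A-root))
        (fifth-root b+b⁻ w p B-root))
    p5 : ∀ {n} → 5 ∣ n → Period n w
    p5 = period-∣ w period-5
    pk : ∀ {n} → k ∣ n → Period n w
    pk = period-∣ w p
    result : ∀ i → w i ≡ 0ℤ
    result with 5 ∣? k
    -- The coprime periods 5 and k make w constant, in particular invariant under T^a.
    ... | no 5∤k = a-fixed (subst (λ n → Period n w) (ℕₚ.*-identityʳ a) (period-* {1} {w}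
            (subst (λ n → Period n w) (∤⇒gcd[5,k]≡1 k 5∤k) (period-gcd w 5 k period-5 p)) a))
    ... | yes 5∣k with mod5 5∣k
    ... | inj₁ 5∣a = a-fixed (p5 5∣a)
    ... | inj₂ (inj₁ 5∣b) = b-fixed (p5 5∣b)
    -- For a ≡ b modulo 5, and likewise for a ≡ -b below, X and Y coincide on sequences of period 5.
    ... | inj₂ (inj₂ (inj₁ 5∣b-a)) = X≡Y⇒0 (λ i → begin
        X w i                   ≡⟨ cos₁-≡ a a⁻ w i ⟩
        w (i + a) +ᶻ w (i + a⁻) ≡⟨ cong₂ _+ᶻ_
          (period-agree w (p5 5∣b-a) (p5 (5 ∣0)) (trans (ℕₚ.m+[n∸m]≡n a≤b) (sym (ℕₚ.+-identityʳ b))) i)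
          (period-agree w (pk b+b⁻) (period-+ w (pk a+a⁻) (p5 5∣b-a))
            (trans (cong (λ n → a⁻ + (n + b⁻)) (sym (ℕₚ.m+[n∸m]≡n a≤b))) (ring a a⁻ b⁻ (b ∸ a))) i) ⟩
        w (i + b) +ᶻ w (i + b⁻) ≡⟨ sym (cos₁-≡ b b⁻ w i) ⟩
        Y w i                   ∎)
      where
      ring : ∀ a a⁻ b⁻ t → a⁻ + (a + t + b⁻) ≡ b⁻ + (a + a⁻ + t)
      ring = ℕ-ring
    ... | inj₂ (inj₂ (inj₂ 5∣a+b)) = X≡Y⇒0 (λ i → begin
        X w i                   ≡⟨ cos₁-≡ a a⁻ w i ⟩
        w (i + a) +ᶻ w (i + a⁻) ≡⟨ cong₂ _+ᶻ_
          (period-agree w (pk b+b⁻) (p5 5∣a+b) (ring₁ a b b⁻) i)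
          (period-agree w (p5 5∣a+b) (pk a+a⁻) (ring₂ a a⁻ b) i) ⟩
        w (i + b⁻) +ᶻ w (i + b) ≡⟨ ℤₚ.+-comm (w (i + b⁻)) (w (i + b)) ⟩
        w (i + b) +ᶻ w (i + b⁻) ≡⟨ sym (cos₁-≡ b b⁻ w i) ⟩
        Y w i                   ∎)
      where
      ring₁ : ∀ a b b⁻ → a + (b + b⁻) ≡ b⁻ + (a + b)
      ring₁ = ℕ-ring
      ring₂ : ∀ a a⁻ b → a⁻ + (a + b) ≡ b + (a + a⁻)
      ring₂ = ℕ-ring

  -- For ε = 1 `doubled-≡` leaves 2 X Y x = 0. Applying X to X Y = -(X + Y) then gives X² x = 0.
  plus⇒0 : ∀ x → Period k x → (∀ i → X (Y x) i +ᶻ 1ℤ *ᶻ X x i +ᶻ 1ℤ *ᶻ Y x i ≡ 0ℤ) → ∀ i → x i ≡ 0ℤ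
  plus⇒0 x p killed = cos²≡0⇒0 a+a⁻ odd x p X²≡0
    where
    open Annihilated 1ℤ refl x p killed
    M≡0 : ∀ i → M i ≡ 0ℤ
    M≡0 i = ℤₚ.*-cancelˡ-≡ (+ 2) _ _ (trans (ring (X (X x) i) (Y (Y x) i) (X (Y x) i) (x i))
        (doubled-≡ i))
      where
      ring : ∀ u v w x → + 2 *ᶻ w
        ≡ + 2 *ᶻ w +ᶻ + 4 *ᶻ x +ᶻ -ᶻ u +ᶻ -ᶻ v +ᶻ 1ℤ *ᶻ (u +ᶻ v +ᶻ -ᶻ (+ 4 *ᶻ x))
      ring = ℤ-ring
    X²≡0 : ∀ i → X (X x) i ≡ 0ℤ
    X²≡0 i = linear₃ 1ℤ -1ℤ -1ℤ (XM i) (M≡0 i)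
      (trans (op-cong A 1 M≡0 i) (op-0 A 1 i)) (ring (X (X x) i) (M i) (X M i))
      where
      ring : ∀ u m xm → u +ᶻ -ᶻ + 0 ≡
        1ℤ *ᶻ (xm +ᶻ -ᶻ (-1ℤ *ᶻ u +ᶻ -1ℤ *ᶻ m)) +ᶻ -1ℤ *ᶻ (m +ᶻ -ᶻ + 0) +ᶻ -1ℤ *ᶻ (xm +ᶻ -ᶻ + 0)
      ring = ℤ-ring

  -- (X + Y - 4) (X + Y + 1) x = 0, so z = (X + Y + 1) x and w = 5 x - z lie in the two eigenspaces.
  minus⇒constant : ∀ x → Period k x → (∀ i → X (Y x) i +ᶻ -1ℤ *ᶻ X x i +ᶻ -1ℤ *ᶻ Y x i ≡ 0ℤ) → a ≤ b →
    gcd (gcd k a) b ≡ 1 → (5 ∣ k → 5 ∣ a ⊎ 5 ∣ b ⊎ 5 ∣ (b ∸ a) ⊎ 5 ∣ (a + b)) → ∀ i → x i ≡ x 0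
  minus⇒constant x p killed a≤b gcd≡1 mod5 i = ℤₚ.*-cancelˡ-≡ (+ 5) _ _ (begin
    + 5 *ᶻ x i ≡⟨ 5x≡z i ⟩
    z i        ≡⟨ z-constant i ⟩
    z 0        ≡⟨ sym (5x≡z 0) ⟩
    + 5 *ᶻ x 0 ∎)
    where
    open Annihilated -1ℤ refl x p killed
    -- X + Y + 1 as a single polynomial, so that `op-comm` moves it past X and Y.
    S : Poly
    S = A ++ B ++ (1ℤ , 0) ∷ []
    S-≡ : ∀ t i → op S 1 t i ≡ X t i +ᶻ Y t i +ᶻ t i
    S-≡ t i = begin
      op S 1 t i                                     ≡⟨ op-++ A _ 1 t i ⟩
      X t i +ᶻ op (B ++ (1ℤ , 0) ∷ []) 1 t i         ≡⟨ cong (X t i +ᶻ_) (op-++ B _ 1 t i) ⟩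
      X t i +ᶻ (Y t i +ᶻ (1ℤ *ᶻ t (i + 0) +ᶻ 0ℤ))    ≡⟨ cong (λ n → X t i +ᶻ (Y t i +ᶻ (1ℤ *ᶻ t n +ᶻ 0ℤ))) (ℕₚ.+-identityʳ i) ⟩
      X t i +ᶻ (Y t i +ᶻ (1ℤ *ᶻ t i +ᶻ 0ℤ))          ≡⟨ ring (X t i) (Y t i) (t i) ⟩
      X t i +ᶻ Y t i +ᶻ t i                          ∎
      where
      ring : ∀ u v w → u +ᶻ (v +ᶻ (1ℤ *ᶻ w +ᶻ + 0)) ≡ u +ᶻ v +ᶻ w
      ring = ℤ-ring
    z : Seq
    z = op S 1 x
    z-period : Period k z
    z-period = op-period S 1 p
    M-sum : ∀ i → M i ≡ X x i +ᶻ Y x i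
    M-sum i = trans (M-≡ i) (cong₂ _+ᶻ_ (ℤₚ.*-identityˡ (X x i)) (ℤₚ.*-identityˡ (Y x i)))
    squares : ∀ i → X (X x) i +ᶻ Y (Y x) i ≡ M i +ᶻ + 4 *ᶻ x i
    squares i = ℤₚ.*-cancelˡ-≡ (+ 2) _ _ (linear₁ -1ℤ (doubled-≡ i) (ring (X (X x) i) (Y (Y x) i) (M i) (x i)))
      where
      ring : ∀ u v w x → + 2 *ᶻ (u +ᶻ v) +ᶻ -ᶻ (+ 2 *ᶻ (w +ᶻ + 4 *ᶻ x)) ≡ -1ℤ *ᶻ (
        + 2 *ᶻ w +ᶻ + 4 *ᶻ x +ᶻ -ᶻ u +ᶻ -ᶻ v +ᶻ -1ℤ *ᶻ (u +ᶻ v +ᶻ -ᶻ (+ 4 *ᶻ x)) +ᶻ -ᶻ + 0)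
      ring = ℤ-ring
    z-≡ : ∀ i → z i ≡ M i +ᶻ x i
    z-≡ i = trans (S-≡ x i) (cong (_+ᶻ x i) (sym (M-sum i)))
    Xz : ∀ i → X z i ≡ X (X x) i +ᶻ M i +ᶻ X x i
    Xz i = trans (op-comm A 1 S 1 x i) (trans (S-≡ (X x) i)
      (cong (λ u → X (X x) i +ᶻ u +ᶻ X x i) (op-comm B 1 A 1 x i)))
    Yz : ∀ i → Y z i ≡ M i +ᶻ Y (Y x) i +ᶻ Y x i
    Yz i = trans (op-comm B 1 S 1 x i) (S-≡ (Y x) i)
    X+Yz : ∀ i → X z i +ᶻ Y z i ≡ + 4 *ᶻ z i
    X+Yz i = trans (cong₂ _+ᶻ_ (Xz i) (Yz i)) (trans
      (linear₂ 1ℤ -1ℤ (squares i) (M-sum i) (ring (X (X x) i) (Y (Y x) i) (M i) (X x i) (Y x i) (x i)))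
      (cong (+ 4 *ᶻ_) (sym (z-≡ i))))
      where
      ring : ∀ u v w s t x → u +ᶻ w +ᶻ s +ᶻ (w +ᶻ v +ᶻ t) +ᶻ -ᶻ (+ 4 *ᶻ (w +ᶻ x))
        ≡ 1ℤ *ᶻ (u +ᶻ v +ᶻ -ᶻ (w +ᶻ + 4 *ᶻ x)) +ᶻ -1ℤ *ᶻ (w +ᶻ -ᶻ (s +ᶻ t))
      ring = ℤ-ring
    XYz : ∀ i → X (Y z) i ≡ + 4 *ᶻ z i
    XYz i = begin
      X (Y z) i               ≡⟨ trans (op-cong A 1 (op-comm B 1 S 1 x) i) (op-comm A 1 S 1 (Y x) i) ⟩
      op S 1 M i              ≡⟨ S-≡ M i ⟩
      X M i +ᶻ Y M i +ᶻ M i   ≡⟨ cong₂ (λ u v → u +ᶻ v +ᶻ M i) (XM i) (YM i) ⟩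
      1ℤ *ᶻ X (X x) i +ᶻ 1ℤ *ᶻ M i +ᶻ (1ℤ *ᶻ M i +ᶻ 1ℤ *ᶻ Y (Y x) i) +ᶻ M i
        ≡⟨ linear₁ 1ℤ (squares i) (ring (X (X x) i) (Y (Y x) i) (M i) (x i)) ⟩
      + 4 *ᶻ (M i +ᶻ x i)     ≡⟨ cong (+ 4 *ᶻ_) (sym (z-≡ i)) ⟩
      + 4 *ᶻ z i              ∎
      where
      ring : ∀ u v w x → 1ℤ *ᶻ u +ᶻ 1ℤ *ᶻ w +ᶻ (1ℤ *ᶻ w +ᶻ 1ℤ *ᶻ v) +ᶻ w +ᶻ -ᶻ (+ 4 *ᶻ (w +ᶻ x))
        ≡ 1ℤ *ᶻ (u +ᶻ v +ᶻ -ᶻ (w +ᶻ + 4 *ᶻ x))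
      ring = ℤ-ring
    -- On z the operators X and Y have sum 4 and product 4, so both satisfy (t - 2)² = 0.
    X²z : ∀ i → X (X z) i ≡ + 4 *ᶻ X z i -ᶻ + 4 *ᶻ z i
    X²z i = begin
      X (X z) i                              ≡⟨ op-cong A 1 (λ j → linear₁ 1ℤ (X+Yz j) (ring (X z j) (Y z j) (z j))) i ⟩
      X (λ j → + 4 *ᶻ z j +ᶻ -1ℤ *ᶻ Y z j) i ≡⟨ op-linear₂ A 1 (+ 4) -1ℤ z (Y z) i ⟩
      + 4 *ᶻ X z i +ᶻ -1ℤ *ᶻ X (Y z) i       ≡⟨ cong (λ u → + 4 *ᶻ X z i +ᶻ -1ℤ *ᶻ u) (XYz i) ⟩
      + 4 *ᶻ X z i +ᶻ -1ℤ *ᶻ (+ 4 *ᶻ z i)    ≡⟨ cong (+ 4 *ᶻ X z i +ᶻ_) (ℤₚ.-1*i≡-i (+ 4 *ᶻ z i)) ⟩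
      + 4 *ᶻ X z i -ᶻ + 4 *ᶻ z i             ∎
      where
      ring : ∀ u v z → u +ᶻ -ᶻ (+ 4 *ᶻ z +ᶻ -1ℤ *ᶻ v) ≡ 1ℤ *ᶻ (u +ᶻ v +ᶻ -ᶻ (+ 4 *ᶻ z))
      ring = ℤ-ring
    Y²z : ∀ i → Y (Y z) i ≡ + 4 *ᶻ Y z i -ᶻ + 4 *ᶻ z i
    Y²z i = begin
      Y (Y z) i                              ≡⟨ op-cong B 1 (λ j → linear₁ 1ℤ (X+Yz j) (ring (X z j) (Y z j) (z j))) i ⟩
      Y (λ j → + 4 *ᶻ z j +ᶻ -1ℤ *ᶻ X z j) i ≡⟨ op-linear₂ B 1 (+ 4) -1ℤ z (X z) i ⟩
      + 4 *ᶻ Y z i +ᶻ -1ℤ *ᶻ Y (X z) i       ≡⟨ cong (λ u → + 4 *ᶻ Y z i +ᶻ -1ℤ *ᶻ u) (trans (op-comm B 1 A 1 z i) (XYz i)) ⟩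
      + 4 *ᶻ Y z i +ᶻ -1ℤ *ᶻ (+ 4 *ᶻ z i)    ≡⟨ cong (+ 4 *ᶻ Y z i +ᶻ_) (ℤₚ.-1*i≡-i (+ 4 *ᶻ z i)) ⟩
      + 4 *ᶻ Y z i -ᶻ + 4 *ᶻ z i             ∎
      where
      ring : ∀ u v z → v +ᶻ -ᶻ (+ 4 *ᶻ z +ᶻ -1ℤ *ᶻ u) ≡ 1ℤ *ᶻ (u +ᶻ v +ᶻ -ᶻ (+ 4 *ᶻ z))
      ring = ℤ-ring
    z-constant : ∀ i → z i ≡ z 0
    z-constant i = trans (cong z (sym (ℕₚ.*-identityʳ i))) (period-* {1} {z} z-period-1 i 0)
      where
      z-period-1 : Period 1 z
      z-period-1 = subst (λ n → Period n z) gcd≡1 (period-gcd z (gcd k a) b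
        (period-gcd z k a z-period (unipotent a+a⁻ z z-period X²z)) (unipotent b+b⁻ z z-period Y²z))
    -- w = (4 - X - Y) x; the factor 5 is the difference of the eigenvalues 4 and -1 of X + Y.
    w : Seq
    w i = + 5 *ᶻ x i +ᶻ -1ℤ *ᶻ z i
    w-period : Period k w
    w-period i = cong₂ (λ u v → + 5 *ᶻ u +ᶻ -1ℤ *ᶻ v) (p i) (z-period i)
    X+Yw : ∀ i → X w i +ᶻ Y w i ≡ -ᶻ w i
    X+Yw i = trans (cong₂ _+ᶻ_ (op-linear₂ A 1 (+ 5) -1ℤ x z i) (op-linear₂ B 1 (+ 5) -1ℤ x z i))
      (linear₂ (-ᶻ + 5) -1ℤ (S-≡ x i) (X+Yz i) (ring (X x i) (Y x i) (x i) (X z i) (Y z i) (z i)))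
      where
      ring : ∀ u v x s t z → + 5 *ᶻ u +ᶻ -1ℤ *ᶻ s +ᶻ (+ 5 *ᶻ v +ᶻ -1ℤ *ᶻ t) +ᶻ -ᶻ (-ᶻ (+ 5 *ᶻ x +ᶻ -1ℤ *ᶻ z))
        ≡ (-ᶻ + 5) *ᶻ (z +ᶻ -ᶻ (u +ᶻ v +ᶻ x)) +ᶻ -1ℤ *ᶻ (s +ᶻ t +ᶻ -ᶻ (+ 4 *ᶻ z))
      ring = ℤ-ring
    XYw : ∀ i → X (Y w) i ≡ -ᶻ w i
    XYw i = trans (trans (op-cong A 1 (op-linear₂ B 1 (+ 5) -1ℤ x z) i) (op-linear₂ A 1 (+ 5) -1ℤ (Y x) (Y z) i))
      (linear₂ -1ℤ (-ᶻ + 5) (XYz i) (z-≡ i) (ring (M i) (X (Y z) i) (x i) (z i)))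
      where
      ring : ∀ m n x z → + 5 *ᶻ m +ᶻ -1ℤ *ᶻ n +ᶻ -ᶻ (-ᶻ (+ 5 *ᶻ x +ᶻ -1ℤ *ᶻ z))
        ≡ -1ℤ *ᶻ (n +ᶻ -ᶻ (+ 4 *ᶻ z)) +ᶻ (-ᶻ + 5) *ᶻ (z +ᶻ -ᶻ (m +ᶻ x))
      ring = ℤ-ring
    5x≡z : ∀ i → + 5 *ᶻ x i ≡ z i
    5x≡z i = linear₁ 1ℤ (golden-pair⇒0 w w-period X+Yw XYw a≤b gcd≡1 mod5 i) (ring (x i) (z i))
      where
      ring : ∀ x z → + 5 *ᶻ x +ᶻ -ᶻ z ≡ 1ℤ *ᶻ (+ 5 *ᶻ x +ᶻ -1ℤ *ᶻ z +ᶻ -ᶻ + 0)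
      ring = ℤ-ring

-- The kernel as a space of pairs of sequences

record Kernel (m k a b : ℕ) (x y : Seq) : Set where
  field
    x-period : Period m x
    y-period : Period m y
    x-row    : ∀ i → x (i + a) +ᶻ x (i + (m ∸ a)) +ᶻ x (i + k) +ᶻ y i ≡ 0ℤ
    y-row    : ∀ i → y (i + b) +ᶻ y (i + (m ∸ b)) +ᶻ y (i + k) +ᶻ x i ≡ 0ℤ

Kernel-swap : ∀ {m k a b x y} → Kernel m k a b x y → Kernel m k b a y x
Kernel-swap K = record { x-period = y-period ; y-period = x-period ; x-row = y-row ; y-row = x-row }
  where open Kernel K

Kernel-combine : ∀ {m k a b x y x′ y′} c → Kernel m k a b x y → Kernel m k a b x′ y′ →
  Kernel m k a b (λ i → c *ᶻ x i +ᶻ x′ i) (λ i → c *ᶻ y i +ᶻ y′ i)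
Kernel-combine {x = x} {y} {x′} {y′} c K K′ = record
  { x-period = λ i → cong₂ (λ u v → c *ᶻ u +ᶻ v) (x-period K i) (x-period K′ i)
  ; y-period = λ i → cong₂ (λ u v → c *ᶻ u +ᶻ v) (y-period K i) (y-period K′ i)
  ; x-row    = λ i → combine (x _) (x _) (x _) (y i) (x′ _) (x′ _) (x′ _) (y′ i) (x-row K i) (x-row K′ i)
  ; y-row    = λ i → combine (y _) (y _) (y _) (x i) (y′ _) (y′ _) (y′ _) (x′ i) (y-row K i) (y-row K′ i)
  }
  where
  open Kernel
  combine : ∀ x₁ x₂ x₃ x₄ z₁ z₂ z₃ z₄ → x₁ +ᶻ x₂ +ᶻ x₃ +ᶻ x₄ ≡ 0ℤ → z₁ +ᶻ z₂ +ᶻ z₃ +ᶻ z₄ ≡ 0ℤ →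
    (c *ᶻ x₁ +ᶻ z₁) +ᶻ (c *ᶻ x₂ +ᶻ z₂) +ᶻ (c *ᶻ x₃ +ᶻ z₃) +ᶻ (c *ᶻ x₄ +ᶻ z₄) ≡ 0ℤ
  combine x₁ x₂ x₃ x₄ z₁ z₂ z₃ z₄ e f = linear₂ c 1ℤ e f (ring c x₁ x₂ x₃ x₄ z₁ z₂ z₃ z₄)
    where
    ring : ∀ c x₁ x₂ x₃ x₄ z₁ z₂ z₃ z₄ →
      (c *ᶻ x₁ +ᶻ z₁) +ᶻ (c *ᶻ x₂ +ᶻ z₂) +ᶻ (c *ᶻ x₃ +ᶻ z₃) +ᶻ (c *ᶻ x₄ +ᶻ z₄) +ᶻ -ᶻ + 0
      ≡ c *ᶻ (x₁ +ᶻ x₂ +ᶻ x₃ +ᶻ x₄ +ᶻ -ᶻ + 0) +ᶻ 1ℤ *ᶻ (z₁ +ᶻ z₂ +ᶻ z₃ +ᶻ z₄ +ᶻ -ᶻ + 0)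
    ring = ℤ-ring

-- A form of "the kernel has dimension at most one" that needs no scalars: the entry x₀ determines a
-- kernel vector.
Rigid : (m k a b : ℕ) → Set
Rigid m k a b = ∀ x y → Kernel m k a b x y → x 0 ≡ 0ℤ → ∀ i → x i ≡ 0ℤ × y i ≡ 0ℤ

-- Signs and the eigenspaces of the shift by k

sign : Seq
sign zero    = 1ℤ
sign (suc n) = -ᶻ sign n

sign-+ : ∀ i j → sign (i + j) ≡ sign i *ᶻ sign j
sign-+ zero    j = sym (ℤₚ.*-identityˡ (sign j))
sign-+ (suc i) j = trans (cong -ᶻ_ (sign-+ i j)) (ℤₚ.neg-distribˡ-* (sign i) (sign j))

sign² : ∀ i → sign i *ᶻ sign i ≡ 1ℤ
sign² zero    = refl
sign² (suc i) = trans (ring (sign i)) (sign² i)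
  where
  ring : ∀ u → (-ᶻ u) *ᶻ (-ᶻ u) ≡ u *ᶻ u
  ring = ℤ-ring

sign-even : ∀ {n} → 2 ∣ n → sign n ≡ 1ℤ
sign-even (divides q refl) = trans (cong sign (double q)) (trans (sign-+ q q) (sign² q))
  where
  double : ∀ q → q * 2 ≡ q + q
  double = ℕ-ring

sign-odd : ∀ {n} → Odd n → sign n ≡ -1ℤ
sign-odd (h , refl) = cong -ᶻ_ (sign-even (m∣m*n h))

∣-∸ : ∀ {d m n} → d ∣ m → d ∣ n → d ∣ m ∸ n
∣-∸ {d} {m} {n} d∣m d∣n with ℕₚ.≤-total n m
... | inj₁ n≤m = ∣m+n∣m⇒∣n (subst (d ∣_) (sym (ℕₚ.m+[n∸m]≡n n≤m)) d∣m) d∣n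
... | inj₂ m≤n = subst (d ∣_) (sym (ℕₚ.m≤n⇒m∸n≡0 m≤n)) (d ∣0)

module Eigenspace {m k a b} {x y : Seq} (K : Kernel m k a b x y) (m≡2k : m ≡ 2 * k)
  (ε : ℤ) (ε² : ε *ᶻ ε ≡ 1ℤ) (σ : Seq) (σ-k : ∀ i → σ (i + k) ≡ ε *ᶻ σ i)
  (σ-a : Period a σ) (σ-a⁻ : Period (m ∸ a) σ) where

  open Kernel K

  -- 1 + ε T^k is twice the projection onto T^k = ε, left undivided to stay integral. The weight σ
  -- also picks up ε under T^k, so the product has period k.
  component : Seq → Seq
  component s i = σ i *ᶻ (s i +ᶻ ε *ᶻ s (i + k))

  k+k : ∀ s → Period m s → ∀ i → s (i + k + k) ≡ s i
  k+k s p i = trans (cong s (trans (ring i k) (cong (λ n → i + n) (sym m≡2k)))) (p i)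
    where
    ring : ∀ i k → i + k + k ≡ i + 2 * k
    ring = ℕ-ring

  component-period : ∀ s → Period m s → Period k (component s)
  component-period s p i = begin
    σ (i + k) *ᶻ (s (i + k) +ᶻ ε *ᶻ s (i + k + k)) ≡⟨ cong₂ (λ u v → u *ᶻ (s (i + k) +ᶻ ε *ᶻ v)) (σ-k i) (k+k s p i) ⟩
    ε *ᶻ σ i *ᶻ (s (i + k) +ᶻ ε *ᶻ s i)            ≡⟨ ring ε (σ i) (s (i + k)) (s i) ⟩
    σ i *ᶻ (ε *ᶻ ε *ᶻ s i +ᶻ ε *ᶻ s (i + k))       ≡⟨ cong (λ u → σ i *ᶻ (u *ᶻ s i +ᶻ ε *ᶻ s (i + k))) ε² ⟩
    σ i *ᶻ (1ℤ *ᶻ s i +ᶻ ε *ᶻ s (i + k))           ≡⟨ cong (λ u → σ i *ᶻ (u +ᶻ ε *ᶻ s (i + k))) (ℤₚ.*-identityˡ (s i)) ⟩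
    σ i *ᶻ (s i +ᶻ ε *ᶻ s (i + k))                 ∎
    where
    ring : ∀ ε σ u v → ε *ᶻ σ *ᶻ (u +ᶻ ε *ᶻ v) ≡ σ *ᶻ (ε *ᶻ ε *ᶻ v +ᶻ ε *ᶻ u)
    ring = ℤ-ring

  component-row : ∀ i → cos a (m ∸ a) (component x) i +ᶻ ε *ᶻ component x i +ᶻ component y i ≡ 0ℤ
  component-row i = begin
    cos a a⁻ (component x) i +ᶻ ε *ᶻ component x i +ᶻ component y i
      ≡⟨ cong (λ u → u +ᶻ ε *ᶻ component x i +ᶻ component y i)
           (trans (cos₁-≡ a a⁻ (component x) i) (cong₂ _+ᶻ_ (shifted a (σ-a i)) (shifted a⁻ (σ-a⁻ i)))) ⟩
    σ i *ᶻ (x (i + a) +ᶻ ε *ᶻ x (i + k + a)) +ᶻ σ i *ᶻ (x (i + a⁻) +ᶻ ε *ᶻ x (i + k + a⁻))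
      +ᶻ ε *ᶻ component x i +ᶻ component y i
      ≡⟨ ring ε (σ i) (x (i + a)) (x (i + k + a)) (x (i + a⁻)) (x (i + k + a⁻)) (x i) (x (i + k)) (y i) (y (i + k)) ⟩
    σ i *ᶻ (x (i + a) +ᶻ x (i + a⁻) +ᶻ ε *ᶻ ε *ᶻ x (i + k) +ᶻ y i +ᶻ
      ε *ᶻ (x (i + k + a) +ᶻ x (i + k + a⁻) +ᶻ x i +ᶻ y (i + k)))
      ≡⟨ cong₂ (λ u v → σ i *ᶻ (x (i + a) +ᶻ x (i + a⁻) +ᶻ u +ᶻ y i +ᶻ
           ε *ᶻ (x (i + k + a) +ᶻ x (i + k + a⁻) +ᶻ v +ᶻ y (i + k))))
           (trans (cong (_*ᶻ x (i + k)) ε²) (ℤₚ.*-identityˡ (x (i + k)))) (sym (k+k x x-period i)) ⟩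
    σ i *ᶻ (x (i + a) +ᶻ x (i + a⁻) +ᶻ x (i + k) +ᶻ y i +ᶻ
      ε *ᶻ (x (i + k + a) +ᶻ x (i + k + a⁻) +ᶻ x (i + k + k) +ᶻ y (i + k)))
      ≡⟨ cong₂ (λ u v → σ i *ᶻ (u +ᶻ ε *ᶻ v)) (x-row i) (x-row (i + k)) ⟩
    σ i *ᶻ (0ℤ +ᶻ ε *ᶻ 0ℤ)
      ≡⟨ ring₀ (σ i) ε ⟩
    0ℤ ∎
    where
    a⁻ = m ∸ a
    swap : ∀ i c k → i + c + k ≡ i + k + c
    swap = ℕ-ring
    shifted : ∀ c → σ (i + c) ≡ σ i → component x (i + c) ≡ σ i *ᶻ (x (i + c) +ᶻ ε *ᶻ x (i + k + c))
    shifted c e = cong₂ (λ u v → u *ᶻ (x (i + c) +ᶻ ε *ᶻ x v)) e (swap i c k)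
    ring₀ : ∀ u v → u *ᶻ (+ 0 +ᶻ v *ᶻ + 0) ≡ + 0
    ring₀ = ℤ-ring
    ring : ∀ ε σ a a′ b b′ x x′ y y′ →
      σ *ᶻ (a +ᶻ ε *ᶻ a′) +ᶻ σ *ᶻ (b +ᶻ ε *ᶻ b′) +ᶻ ε *ᶻ (σ *ᶻ (x +ᶻ ε *ᶻ x′)) +ᶻ σ *ᶻ (y +ᶻ ε *ᶻ y′)
      ≡ σ *ᶻ (a +ᶻ b +ᶻ ε *ᶻ ε *ᶻ x′ +ᶻ y +ᶻ ε *ᶻ (a′ +ᶻ b′ +ᶻ x +ᶻ y′))
    ring = ℤ-ring

-- Substituting y = -(X + ε) x into (Y + ε) y + x = 0 gives (X + ε) (Y + ε) x = x, and ε² = 1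
-- cancels x.
eliminate : ∀ a a⁻ b b⁻ ε → ε *ᶻ ε ≡ 1ℤ → ∀ x y →
  (∀ i → cos a a⁻ x i +ᶻ ε *ᶻ x i +ᶻ y i ≡ 0ℤ) → (∀ i → cos b b⁻ y i +ᶻ ε *ᶻ y i +ᶻ x i ≡ 0ℤ) →
  ∀ i → cos a a⁻ (cos b b⁻ x) i +ᶻ ε *ᶻ cos a a⁻ x i +ᶻ ε *ᶻ cos b b⁻ x i ≡ 0ℤ
eliminate a a⁻ b b⁻ ε ε² x y x-row y-row i = begin
  X (Y x) i +ᶻ ε *ᶻ X x i +ᶻ ε *ᶻ Y x i
    ≡⟨ cong (λ u → u +ᶻ ε *ᶻ X x i +ᶻ ε *ᶻ Y x i) (op-comm A 1 B 1 x i) ⟩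
  Y (X x) i +ᶻ ε *ᶻ X x i +ᶻ ε *ᶻ Y x i
    ≡⟨ linear₃ 1ℤ ε -1ℤ Yy (y-≡ i) (y-row i) (ring ε (Y (X x) i) (X x i) (Y x i) (x i) (Y y i) (y i)) ⟩
  x i -ᶻ ε *ᶻ ε *ᶻ x i
    ≡⟨ trans (cong (λ u → x i -ᶻ u *ᶻ x i) ε²) (ring₁ (x i)) ⟩
  0ℤ ∎
  where
  A = cosPoly a a⁻
  B = cosPoly b b⁻
  X Y : Seq → Seq
  X = op A 1
  Y = op B 1
  y-≡ : ∀ j → y j ≡ -1ℤ *ᶻ X x j +ᶻ (-ᶻ ε) *ᶻ x j
  y-≡ j = linear₁ 1ℤ (x-row j) (ring₀ ε (X x j) (x j) (y j))
    where
    ring₀ : ∀ ε u v w → w +ᶻ -ᶻ (-1ℤ *ᶻ u +ᶻ (-ᶻ ε) *ᶻ v) ≡ 1ℤ *ᶻ (u +ᶻ ε *ᶻ v +ᶻ w +ᶻ -ᶻ + 0)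
    ring₀ = ℤ-ring
  Yy : Y y i ≡ -1ℤ *ᶻ Y (X x) i +ᶻ (-ᶻ ε) *ᶻ Y x i
  Yy = trans (op-cong B 1 y-≡ i) (op-linear₂ B 1 -1ℤ (-ᶻ ε) (X x) x i)
  ring₁ : ∀ u → u +ᶻ -ᶻ (1ℤ *ᶻ u) ≡ + 0
  ring₁ = ℤ-ring
  ring : ∀ ε yx x′ y′ x yy y → yx +ᶻ ε *ᶻ x′ +ᶻ ε *ᶻ y′ +ᶻ -ᶻ (x +ᶻ -ᶻ (ε *ᶻ ε *ᶻ x))
    ≡ 1ℤ *ᶻ (yy +ᶻ -ᶻ (-1ℤ *ᶻ yx +ᶻ (-ᶻ ε) *ᶻ y′)) +ᶻ ε *ᶻ (y +ᶻ -ᶻ (-1ℤ *ᶻ x′ +ᶻ (-ᶻ ε) *ᶻ x))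
      +ᶻ -1ℤ *ᶻ (yy +ᶻ ε *ᶻ y +ᶻ x +ᶻ -ᶻ + 0)
  ring = ℤ-ring

module _ {m k a b} .{{_ : NonZero k}} (m≡2k : m ≡ 2 * k) (a≤m : a ≤ m) (b≤m : b ≤ m) (odd : Odd k)
  (2∣a : 2 ∣ a) (2∣b : 2 ∣ b) where

  private
    2∣m : 2 ∣ m
    2∣m = subst (2 ∣_) (sym m≡2k) (m∣m*n k)
    k∣ : ∀ {c} → c ≤ m → k ∣ c + (m ∸ c)
    k∣ c≤m = subst (k ∣_) (sym (trans (ℕₚ.m+[n∸m]≡n c≤m) m≡2k)) (n∣m*n 2)

  conditions⇒rigid : a ≤ b → gcd (gcd k a) b ≡ 1 → (5 ∣ k → 5 ∣ a ⊎ 5 ∣ b ⊎ 5 ∣ (b ∸ a) ⊎ 5 ∣ (a + b)) → Rigid m k a b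
  conditions⇒rigid a≤b gcd≡1 mod5 x y K x0≡0 i = x≡0 i , y≡0
    where
    open Kernel K
    open Circulant odd {a} {m ∸ a} {b} {m ∸ b} (k∣ a≤m) (k∣ b≤m)
    1ˢ : Seq
    1ˢ _ = 1ℤ
    1-k : ∀ i → 1ˢ (i + k) ≡ 1ℤ *ᶻ 1ˢ i
    1-k i = refl
    sign-k : ∀ i → sign (i + k) ≡ -1ℤ *ᶻ sign i
    sign-k i = trans (sign-+ i k) (trans (cong (sign i *ᶻ_) (sign-odd odd)) (ℤₚ.*-comm (sign i) -1ℤ))
    sign-period : ∀ {n} → 2 ∣ n → Period n sign
    sign-period {n} 2∣n i = trans (sign-+ i n) (trans (cong (sign i *ᶻ_) (sign-even 2∣n)) (ℤₚ.*-identityʳ (sign i)))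
    module P  = Eigenspace K m≡2k 1ℤ refl 1ˢ 1-k (λ _ → refl) (λ _ → refl)
    module P′ = Eigenspace (Kernel-swap K) m≡2k 1ℤ refl 1ˢ 1-k (λ _ → refl) (λ _ → refl)
    module N  = Eigenspace K m≡2k -1ℤ refl sign sign-k (sign-period 2∣a) (sign-period (∣-∸ 2∣m 2∣a))
    module N′ = Eigenspace (Kernel-swap K) m≡2k -1ℤ refl sign sign-k (sign-period 2∣b) (sign-period (∣-∸ 2∣m 2∣b))
    plus≡0 : ∀ i → P.component x i ≡ 0ℤ
    plus≡0 = plus⇒0 (P.component x) (P.component-period x x-period)
      (eliminate a (m ∸ a) b (m ∸ b) 1ℤ refl (P.component x) (P.component y) P.component-row P′.component-row)
    minus-constant : ∀ i → N.component x i ≡ N.component x 0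
    minus-constant = minus⇒constant (N.component x) (N.component-period x x-period)
      (eliminate a (m ∸ a) b (m ∸ b) -1ℤ refl (N.component x) (N.component y) N.component-row N′.component-row)
      a≤b gcd≡1 mod5
    -- The minus component is constantly x₀ - x_k. The plus component at 0 transfers x₀ = 0 to x_k,
    -- so both components vanish, and they determine 2 x.
    xk≡0 : x k ≡ 0ℤ
    xk≡0 = linear₂ 1ℤ -1ℤ (plus≡0 0) x0≡0 (ring (x 0) (x k))
      where
      ring : ∀ u v → v +ᶻ -ᶻ + 0 ≡ 1ℤ *ᶻ (1ℤ *ᶻ (u +ᶻ 1ℤ *ᶻ v) +ᶻ -ᶻ + 0) +ᶻ -1ℤ *ᶻ (u +ᶻ -ᶻ + 0)
      ring = ℤ-ring
    minus≡0 : ∀ i → N.component x i ≡ 0ℤ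
    minus≡0 i = trans (minus-constant i) (cong₂ (λ u v → 1ℤ *ᶻ (u +ᶻ -1ℤ *ᶻ v)) x0≡0 xk≡0)
    x≡0 : ∀ i → x i ≡ 0ℤ
    x≡0 i = ℤₚ.*-cancelˡ-≡ (+ 2) _ _ (linear₂ 1ℤ 1ℤ (plus≡0 i) difference (ring (x i) (x (i + k))))
      where
      difference : x i -ᶻ x (i + k) ≡ 0ℤ
      difference = begin
        x i -ᶻ x (i + k)                                ≡⟨ sym (ℤₚ.*-identityˡ _) ⟩
        1ℤ *ᶻ (x i -ᶻ x (i + k))                        ≡⟨ cong (_*ᶻ (x i -ᶻ x (i + k))) (sym (sign² i)) ⟩
        sign i *ᶻ sign i *ᶻ (x i -ᶻ x (i + k))          ≡⟨ ring₁ (sign i) (x i) (x (i + k)) ⟩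
        sign i *ᶻ N.component x i                       ≡⟨ cong (sign i *ᶻ_) (minus≡0 i) ⟩
        sign i *ᶻ 0ℤ                                    ≡⟨ ℤₚ.*-zeroʳ (sign i) ⟩
        0ℤ                                              ∎
        where
        ring₁ : ∀ s u v → s *ᶻ s *ᶻ (u +ᶻ -ᶻ v) ≡ s *ᶻ (s *ᶻ (u +ᶻ -1ℤ *ᶻ v))
        ring₁ = ℤ-ring
      ring : ∀ u v → + 2 *ᶻ u +ᶻ -ᶻ (+ 2 *ᶻ + 0) ≡
        1ℤ *ᶻ (1ℤ *ᶻ (u +ᶻ 1ℤ *ᶻ v) +ᶻ -ᶻ + 0) +ᶻ 1ℤ *ᶻ (u +ᶻ -ᶻ v +ᶻ -ᶻ + 0)
      ring = ℤ-ring
    y≡0 : y i ≡ 0ℤ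
    y≡0 = trans (trans (sym (ℤₚ.+-identityˡ (y i))) (cong (_+ᶻ y i) (sym
      (cong₂ _+ᶻ_ (cong₂ _+ᶻ_ (x≡0 (i + a)) (x≡0 (i + (m ∸ a)))) (x≡0 (i + k)))))) (x-row i)

  -- Multiplying by (-1)ⁱ changes the sign of the shift by k and of no other one.
  twisted-kernel : ∀ f g → Period k f → Period k g →
    (∀ i → f (i + a) +ᶻ f (i + (m ∸ a)) -ᶻ f i +ᶻ g i ≡ 0ℤ) →
    (∀ i → g (i + b) +ᶻ g (i + (m ∸ b)) -ᶻ g i +ᶻ f i ≡ 0ℤ) →
    Kernel m k a b (λ i → sign i *ᶻ f i) (λ i → sign i *ᶻ g i)
  twisted-kernel f g pf pg f-row g-row = record
    { x-period = λ i → cong₂ _*ᶻ_ (sign-even-+ i 2∣m) (m-period pf i)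
    ; y-period = λ i → cong₂ _*ᶻ_ (sign-even-+ i 2∣m) (m-period pg i)
    ; x-row    = twisted-row f g pf 2∣a (∣-∸ 2∣m 2∣a) f-row
    ; y-row    = twisted-row g f pg 2∣b (∣-∸ 2∣m 2∣b) g-row
    }
    where
    m-period : ∀ {f} → Period k f → Period m f
    m-period {f} p = period-∣ f p (subst (k ∣_) (sym m≡2k) (n∣m*n 2))
    sign-even-+ : ∀ i {n} → 2 ∣ n → sign (i + n) ≡ sign i
    sign-even-+ i {n} 2∣n = trans (sign-+ i n) (trans (cong (sign i *ᶻ_) (sign-even 2∣n)) (ℤₚ.*-identityʳ (sign i)))
    twisted-row : ∀ f g → Period k f → ∀ {c d} → 2 ∣ c → 2 ∣ d →
      (∀ i → f (i + c) +ᶻ f (i + d) -ᶻ f i +ᶻ g i ≡ 0ℤ) →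
      ∀ i → sign (i + c) *ᶻ f (i + c) +ᶻ sign (i + d) *ᶻ f (i + d) +ᶻ sign (i + k) *ᶻ f (i + k) +ᶻ sign i *ᶻ g i ≡ 0ℤ
    twisted-row f g pf {c} {d} 2∣c 2∣d row i = begin
      sign (i + c) *ᶻ f (i + c) +ᶻ sign (i + d) *ᶻ f (i + d) +ᶻ sign (i + k) *ᶻ f (i + k) +ᶻ sign i *ᶻ g i
        ≡⟨ cong (_+ᶻ sign i *ᶻ g i) (cong₂ _+ᶻ_
             (cong₂ _+ᶻ_ (cong (_*ᶻ f (i + c)) (sign-even-+ i 2∣c)) (cong (_*ᶻ f (i + d)) (sign-even-+ i 2∣d)))
             (cong₂ _*ᶻ_ (trans (sign-+ i k) (cong (sign i *ᶻ_) (sign-odd odd))) (pf i))) ⟩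
      sign i *ᶻ f (i + c) +ᶻ sign i *ᶻ f (i + d) +ᶻ sign i *ᶻ -1ℤ *ᶻ f i +ᶻ sign i *ᶻ g i
        ≡⟨ ring (sign i) (f (i + c)) (f (i + d)) (f i) (g i) ⟩
      sign i *ᶻ (f (i + c) +ᶻ f (i + d) -ᶻ f i +ᶻ g i)
        ≡⟨ trans (cong (sign i *ᶻ_) (row i)) (ℤₚ.*-zeroʳ (sign i)) ⟩
      0ℤ ∎
      where
      ring : ∀ s u v f g → s *ᶻ u +ᶻ s *ᶻ v +ᶻ s *ᶻ -1ℤ *ᶻ f +ᶻ s *ᶻ g ≡ s *ᶻ (u +ᶻ v +ᶻ -ᶻ f +ᶻ g)
      ring = ℤ-ring

-- From rational vectors on the graph to integer sequences

sumℚ-cong : ∀ n {f g : Fin n → ℚ} → f ≗ g → sumℚ n f ≡ sumℚ n g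
sumℚ-cong zero    e = refl
sumℚ-cong (suc n) e = cong₂ _+ℚ_ (e Fin.zero) (sumℚ-cong n (λ i → e (Fin.suc i)))

sumℚ-0 : ∀ n → sumℚ n (λ _ → 0ℚ) ≡ 0ℚ
sumℚ-0 zero    = refl
sumℚ-0 (suc n) = trans (ℚₚ.+-identityˡ _) (sumℚ-0 n)

+ℚ-exchange : ∀ a b c d → (a +ℚ b) +ℚ (c +ℚ d) ≡ (a +ℚ c) +ℚ (b +ℚ d)
+ℚ-exchange a b c d = begin
  (a +ℚ b) +ℚ (c +ℚ d) ≡⟨ ℚₚ.+-assoc a b (c +ℚ d) ⟩
  a +ℚ (b +ℚ (c +ℚ d)) ≡⟨ cong (a +ℚ_) (trans (sym (ℚₚ.+-assoc b c d)) (trans (cong (_+ℚ d) (ℚₚ.+-comm b c)) (ℚₚ.+-assoc c b d))) ⟩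
  a +ℚ (c +ℚ (b +ℚ d)) ≡⟨ sym (ℚₚ.+-assoc a c (b +ℚ d)) ⟩
  (a +ℚ c) +ℚ (b +ℚ d) ∎

sumℚ-+ : ∀ n (f g : Fin n → ℚ) → sumℚ n (λ i → f i +ℚ g i) ≡ sumℚ n f +ℚ sumℚ n g
sumℚ-+ zero    f g = refl
sumℚ-+ (suc n) f g = trans (cong (f Fin.zero +ℚ g Fin.zero +ℚ_) (sumℚ-+ n _ _)) (+ℚ-exchange (f Fin.zero) (g Fin.zero) _ _)

sumℚ-split : ∀ p q (f : Fin (p + q) → ℚ) → sumℚ (p + q) f ≡ sumℚ p (λ i → f (i ↑ˡ q)) +ℚ sumℚ q (λ i → f (p ↑ʳ i))
sumℚ-split zero    q f = sym (ℚₚ.+-identityˡ _)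
sumℚ-split (suc p) q f = trans (cong (f Fin.zero +ℚ_) (sumℚ-split p q (λ i → f (Fin.suc i))))
  (sym (ℚₚ.+-assoc (f Fin.zero) _ _))

indicator : Bool → ℚ
indicator p = if p then 1ℚ else 0ℚ

sumℚ-indicator : ∀ n (i : Fin n) (f : Fin n → ℚ) → sumℚ n (λ j → indicator (toℕ i ≡ᵇ toℕ j) *ℚ f j) ≡ f i
sumℚ-indicator (suc n) Fin.zero f = begin
  1ℚ *ℚ f Fin.zero +ℚ sumℚ n (λ j → 0ℚ *ℚ f (Fin.suc j))
    ≡⟨ cong₂ _+ℚ_ (ℚₚ.*-identityˡ (f Fin.zero)) (trans (sumℚ-cong n (λ j → ℚₚ.*-zeroˡ (f (Fin.suc j)))) (sumℚ-0 n)) ⟩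
  f Fin.zero +ℚ 0ℚ ≡⟨ ℚₚ.+-identityʳ _ ⟩
  f Fin.zero       ∎
sumℚ-indicator (suc n) (Fin.suc i) f = trans
  (cong₂ _+ℚ_ (ℚₚ.*-zeroˡ (f Fin.zero)) (sumℚ-indicator n i (λ j → f (Fin.suc j)))) (ℚₚ.+-identityˡ _)

-- Adjacency is a disjunction while a kernel row is a sum over neighbours; the two agree only if no
-- neighbour is listed twice.
indicator-∨ : ∀ p q r → (T p → T q → ⊥) → (T p → T r → ⊥) → (T q → T r → ⊥) → ∀ z →
  indicator (p ∨ q ∨ r) *ℚ z ≡ indicator p *ℚ z +ℚ indicator q *ℚ z +ℚ indicator r *ℚ z
indicator-∨ true  true  r     pq pr qr z = ⊥-elim (pq _ _)
indicator-∨ true  false true  pq pr qr z = ⊥-elim (pr _ _)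
indicator-∨ false true  true  pq pr qr z = ⊥-elim (qr _ _)
indicator-∨ true  false false pq pr qr z = sym (trans (cong₂ (λ u v → 1ℚ *ℚ z +ℚ u +ℚ v) (ℚₚ.*-zeroˡ z) (ℚₚ.*-zeroˡ z))
  (trans (ℚₚ.+-identityʳ _) (ℚₚ.+-identityʳ _)))
indicator-∨ false true  false pq pr qr z = sym (trans (cong₂ (λ u v → u +ℚ 1ℚ *ℚ z +ℚ v) (ℚₚ.*-zeroˡ z) (ℚₚ.*-zeroˡ z))
  (trans (ℚₚ.+-identityʳ _) (ℚₚ.+-identityˡ _)))
indicator-∨ false false true  pq pr qr z = sym (trans (cong (λ u → u +ℚ u +ℚ 1ℚ *ℚ z) (ℚₚ.*-zeroˡ z)) (ℚₚ.+-identityˡ _))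
indicator-∨ false false false pq pr qr z = sym (trans (cong (λ u → u +ℚ u +ℚ u) (ℚₚ.*-zeroˡ z)) (sym (ℚₚ.*-zeroˡ z)))

%-cancelˡ-< : ∀ m .{{_ : NonZero m}} i {c d} → c < d → d < m → (i + c) % m ≢ (i + d) % m
%-cancelˡ-< m i {c} {d} c<d d<m e = ∤-between (ℕₚ.m<n⇒0<n∸m c<d) (ℕₚ.≤-<-trans (ℕₚ.m∸n≤m d c) d<m)
  (∣m+n∣m⇒∣n (subst (m ∣_) (sym quotients) (n∣m*n ((i + d) / m))) (n∣m*n ((i + c) / m)))
  where
  swap : ∀ r q t → q + t + r ≡ r + q + t
  swap = ℕ-ring
  quotients : (i + c) / m * m + (d ∸ c) ≡ (i + d) / m * m
  quotients = ℕₚ.+-cancelʳ-≡ ((i + d) % m) _ _ (begin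
    (i + c) / m * m + (d ∸ c) + (i + d) % m ≡⟨ cong (λ r → (i + c) / m * m + (d ∸ c) + r) (sym e) ⟩
    (i + c) / m * m + (d ∸ c) + (i + c) % m ≡⟨ swap ((i + c) % m) ((i + c) / m * m) (d ∸ c) ⟩
    (i + c) % m + (i + c) / m * m + (d ∸ c) ≡⟨ cong (λ n → n + (d ∸ c)) (sym (m≡m%n+[m/n]*n (i + c) m)) ⟩
    i + c + (d ∸ c)                         ≡⟨ ℕₚ.+-assoc i c (d ∸ c) ⟩
    i + (c + (d ∸ c))                       ≡⟨ cong (λ n → i + n) (ℕₚ.m+[n∸m]≡n (ℕₚ.<⇒≤ c<d)) ⟩
    i + d                                   ≡⟨ m≡m%n+[m/n]*n (i + d) m ⟩
    (i + d) % m + (i + d) / m * m           ≡⟨ ℕₚ.+-comm ((i + d) % m) _ ⟩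
    (i + d) / m * m + (i + d) % m           ∎)

ι : ℤ → ℚ
ι z = fromℚᵘ (mkℚᵘ z 0)

ι-injective : ∀ {y z} → ι y ≡ ι z → y ≡ z
ι-injective {y} {z} e with ℚₚ.fromℚᵘ-injective {mkℚᵘ y 0} {mkℚᵘ z 0} e
... | *≡* y*1≡z*1 = trans (sym (ℤₚ.*-identityʳ y)) (trans y*1≡z*1 (ℤₚ.*-identityʳ z))

ι-+ : ∀ y z → ι (y +ᶻ z) ≡ ι y +ℚ ι z
ι-+ y z = ℚₚ.toℚᵘ-injective (begin-equality
  toℚᵘ (ι (y +ᶻ z))            ≃⟨ ℚₚ.toℚᵘ-fromℚᵘ (mkℚᵘ (y +ᶻ z) 0) ⟩
  mkℚᵘ (y +ᶻ z) 0              ≃⟨ *≡* (ring y z) ⟩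
  mkℚᵘ y 0 +ᵘ mkℚᵘ z 0         ≃⟨ ℚᵘₚ.≃-sym (ℚᵘₚ.+-cong (ℚₚ.toℚᵘ-fromℚᵘ (mkℚᵘ y 0)) (ℚₚ.toℚᵘ-fromℚᵘ (mkℚᵘ z 0))) ⟩
  toℚᵘ (ι y) +ᵘ toℚᵘ (ι z)     ≃⟨ ℚᵘₚ.≃-sym (ℚₚ.toℚᵘ-homo-+ (ι y) (ι z)) ⟩
  toℚᵘ (ι y +ℚ ι z)            ∎ᵘ)
  where
  open ℚᵘₚ.≤-Reasoning using (begin-equality_; step-≃-⟩) renaming (_∎ to _∎ᵘ)
  ring : ∀ y z → (y +ᶻ z) *ᶻ + 1 ≡ (y *ᶻ + 1 +ᶻ z *ᶻ + 1) *ᶻ + 1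
  ring = ℤ-ring

ι-* : ∀ y z → ι (y *ᶻ z) ≡ ι y *ℚ ι z
ι-* y z = ℚₚ.toℚᵘ-injective (begin-equality
  toℚᵘ (ι (y *ᶻ z))            ≃⟨ ℚₚ.toℚᵘ-fromℚᵘ (mkℚᵘ (y *ᶻ z) 0) ⟩
  mkℚᵘ y 0 *ᵘ mkℚᵘ z 0         ≃⟨ ℚᵘₚ.≃-sym (ℚᵘₚ.*-cong (ℚₚ.toℚᵘ-fromℚᵘ (mkℚᵘ y 0)) (ℚₚ.toℚᵘ-fromℚᵘ (mkℚᵘ z 0))) ⟩
  toℚᵘ (ι y) *ᵘ toℚᵘ (ι z)     ≃⟨ ℚᵘₚ.≃-sym (ℚₚ.toℚᵘ-homo-* (ι y) (ι z)) ⟩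
  toℚᵘ (ι y *ℚ ι z)            ∎ᵘ)
  where
  open ℚᵘₚ.≤-Reasoning using (begin-equality_; step-≃-⟩) renaming (_∎ to _∎ᵘ)

ι-↧* : ∀ q → ι (↧ q) *ℚ q ≡ ι (↥ q)
ι-↧* q@record{} = ℚₚ.toℚᵘ-injective (begin-equality
  toℚᵘ (ι (↧ q) *ℚ q)          ≃⟨ ℚₚ.toℚᵘ-homo-* (ι (↧ q)) q ⟩
  toℚᵘ (ι (↧ q)) *ᵘ toℚᵘ q     ≃⟨ ℚᵘₚ.*-cong (ℚₚ.toℚᵘ-fromℚᵘ (mkℚᵘ (↧ q) 0)) (ℚᵘₚ.≃-refl {toℚᵘ q}) ⟩
  mkℚᵘ (↧ q) 0 *ᵘ toℚᵘ q       ≃⟨ *≡* (trans (ring (↧ q) (↥ q)) (cong (↥ q *ᶻ_) (sym (cong +_ (ℕₚ.+-identityʳ _))))) ⟩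
  mkℚᵘ (↥ q) 0                 ≃⟨ ℚᵘₚ.≃-sym (ℚₚ.toℚᵘ-fromℚᵘ (mkℚᵘ (↥ q) 0)) ⟩
  toℚᵘ (ι (↥ q))               ∎ᵘ)
  where
  open ℚᵘₚ.≤-Reasoning using (begin-equality_; step-≃-⟩) renaming (_∎ to _∎ᵘ)
  ring : ∀ d n → d *ᶻ n *ᶻ + 1 ≡ n *ᶻ d
  ring = ℤ-ring

*ℚ-cancelˡ : ∀ {r} → r ≢ 0ℚ → ∀ {p q} → r *ℚ p ≡ r *ℚ q → p ≡ q
*ℚ-cancelˡ {r} r≢0 {p} {q} e = trans (sym (undo p)) (trans (cong (r⁻¹ *ℚ_) e) (undo q))
  where
  r⁻¹ : ℚ
  r⁻¹ = (1/ r) {{≢-nonZero r≢0}}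
  undo : ∀ p → r⁻¹ *ℚ (r *ℚ p) ≡ p
  undo p = trans (sym (ℚₚ.*-assoc r⁻¹ r p)) (trans (cong (_*ℚ p) (ℚₚ.*-inverseˡ r {{≢-nonZero r≢0}})) (ℚₚ.*-identityˡ p))

ι≢0 : ∀ {z} → z ≢ 0ℤ → ι z ≢ 0ℚ
ι≢0 z≢0 e = z≢0 (ι-injective e)

common-denominator : ∀ n (f : Fin n → ℚ) → ∃ λ N → N ≢ 0ℤ × Σ (Fin n → ℤ) λ z → ∀ i → ι N *ℚ f i ≡ ι (z i)
common-denominator zero    f = 1ℤ , (λ ()) , (λ ()) , (λ ())
common-denominator (suc n) f with common-denominator n (λ i → f (Fin.suc i))
... | N , N≢0 , z , scaled = ↧ q *ᶻ N , d*N≢0 , z′ , scaled′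
  where
  q = f Fin.zero
  d*N≢0 : ↧ q *ᶻ N ≢ 0ℤ
  d*N≢0 e with ℤₚ.i*j≡0⇒i≡0∨j≡0 (↧ q) e
  ... | inj₂ N≡0 = N≢0 N≡0
  z′ : Fin (suc n) → ℤ
  z′ Fin.zero    = N *ᶻ ↥ q
  z′ (Fin.suc i) = ↧ q *ᶻ z i
  scaled′ : ∀ i → ι (↧ q *ᶻ N) *ℚ f i ≡ ι (z′ i)
  scaled′ Fin.zero = begin
    ι (↧ q *ᶻ N) *ℚ q      ≡⟨ cong (λ d → ι d *ℚ q) (ℤₚ.*-comm (↧ q) N) ⟩
    ι (N *ᶻ ↧ q) *ℚ q      ≡⟨ cong (_*ℚ q) (ι-* N (↧ q)) ⟩
    ι N *ℚ ι (↧ q) *ℚ q    ≡⟨ ℚₚ.*-assoc (ι N) (ι (↧ q)) q ⟩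
    ι N *ℚ (ι (↧ q) *ℚ q)  ≡⟨ cong (ι N *ℚ_) (ι-↧* q) ⟩
    ι N *ℚ ι (↥ q)         ≡⟨ sym (ι-* N (↥ q)) ⟩
    ι (N *ᶻ ↥ q)           ∎
  scaled′ (Fin.suc i) = begin
    ι (↧ q *ᶻ N) *ℚ f (Fin.suc i)    ≡⟨ cong (_*ℚ f (Fin.suc i)) (ι-* (↧ q) N) ⟩
    ι (↧ q) *ℚ ι N *ℚ f (Fin.suc i)  ≡⟨ ℚₚ.*-assoc (ι (↧ q)) (ι N) _ ⟩
    ι (↧ q) *ℚ (ι N *ℚ f (Fin.suc i)) ≡⟨ cong (ι (↧ q) *ℚ_) (scaled i) ⟩
    ι (↧ q) *ℚ ι (z i)               ≡⟨ sym (ι-* (↧ q) (z i)) ⟩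
    ι (↧ q *ᶻ z i)                   ∎

-- Rows of the adjacency matrix as recurrences

module Vertices {m : ℕ} .{{_ : NonZero m}} where

  _mod : ℕ → Fin m
  j mod = fromℕ< (m%n<n j m)

  mod-≡ : ∀ {i j} → i % m ≡ j % m → i mod ≡ j mod
  mod-≡ {i} {j} e = Finₚ.fromℕ<-cong (i % m) (j % m) e (m%n<n i m) (m%n<n j m)

  mod-toℕ : ∀ i → toℕ i mod ≡ i
  mod-toℕ i = Finₚ.toℕ-injective (trans (Finₚ.toℕ-fromℕ< _) (m<n⇒m%n≡m (Finₚ.toℕ<n i)))

  toℕ-mod : ∀ j → toℕ (j mod) ≡ j % m
  toℕ-mod j = Finₚ.toℕ-fromℕ< _

  xs ys : ∀ {A : Set} → (Fin (m + m) → A) → ℕ → A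
  xs w j = w (j mod ↑ˡ m)
  ys w j = w (m ↑ʳ (j mod))

  vector : (ℕ → ℤ) → (ℕ → ℤ) → Fin (m + m) → ℤ
  vector x y u with splitAt m u
  ... | inj₁ i = x (toℕ i)
  ... | inj₂ i = y (toℕ i)

  vector-x : ∀ x y i → vector x y (i ↑ˡ m) ≡ x (toℕ i)
  vector-x x y i rewrite Finₚ.splitAt-↑ˡ m i m = refl

  vector-y : ∀ x y i → vector x y (m ↑ʳ i) ≡ y (toℕ i)
  vector-y x y i rewrite Finₚ.splitAt-↑ʳ m m i = refl

  each-vertex : ∀ {P : Fin (m + m) → Set} → (∀ i → P (i ↑ˡ m)) → (∀ i → P (m ↑ʳ i)) → ∀ u → P u
  each-vertex {P} f g u = subst P (Finₚ.join-splitAt m m u) (by-side (splitAt m u))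
    where
    by-side : ∀ v → P (join m m v)
    by-side (inj₁ i) = f i
    by-side (inj₂ i) = g i

module Graph {m k a b : ℕ} .{{_ : NonZero m}} (m/2≡k : m / 2 ≡ k) (m≡2k : m ≡ 2 * k)
  (0<a : 0 < a) (a<k : a < k) (0<b : 0 < b) (b<k : b < k) where

  open Vertices {m}

  private
    k<m∸ : ∀ {c} → c < k → k < m ∸ c
    k<m∸ {c} c<k = subst (_< m ∸ c) (trans (cong (_∸ k) (trans m≡2k (cong (λ n → k + n) (ℕₚ.+-identityʳ k)))) (ℕₚ.m+n∸n≡m k k))
      (ℕₚ.∸-monoʳ-< c<k (subst (k ≤_) (sym m≡2k) (ℕₚ.m≤m+n k _)))
    m∸<m : ∀ {c} → 0 < c → c < k → m ∸ c < m
    m∸<m {c} 0<c c<k = ℕₚ.∸-monoʳ-< {m} 0<c (ℕₚ.<⇒≤ (ℕₚ.<-≤-trans c<k (subst (k ≤_) (sym m≡2k) (ℕₚ.m≤m+n k _))))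

  pick : ∀ c i (f : Fin m → ℚ) → sumℚ m (λ j → indicator (circ m c i j) *ℚ f j) ≡ f ((toℕ i + c) mod)
  pick c i f = trans
    (sumℚ-cong m (λ j → cong (λ n → indicator (n ≡ᵇ toℕ j) *ℚ f j) (sym (toℕ-mod (toℕ i + c)))))
    (sumℚ-indicator m ((toℕ i + c) mod) f)

  rim-row : ∀ {c} → 0 < c → c < k → ∀ i (f : Fin m → ℚ) →
    sumℚ m (λ j → indicator (rimAdj m c i j) *ℚ f j)
      ≡ f ((toℕ i + c) mod) +ℚ f ((toℕ i + (m ∸ c)) mod) +ℚ f ((toℕ i + k) mod)
  rim-row {c} 0<c c<k i f = begin
    sumℚ m (λ j → indicator (rimAdj m c i j) *ℚ f j)
      ≡⟨ sumℚ-cong m (λ j → indicator-∨ (circ m c i j) (circ m (m ∸ c) i j) (circ m (m / 2) i j)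
           -- The chain c < m/2 < m - c < m makes the three rim neighbours distinct.
           (λ p q → %-cancelˡ-< m (toℕ i) (ℕₚ.<-trans c<k (k<m∸ c<k)) (m∸<m 0<c c<k) (meet j p q))
           (λ p r → %-cancelˡ-< m (toℕ i) c<m/2 (ℕₚ.<-trans m/2<m∸c (m∸<m 0<c c<k)) (meet j p r))
           (λ q r → %-cancelˡ-< m (toℕ i) m/2<m∸c (m∸<m 0<c c<k) (meet j r q))
           (f j)) ⟩
    sumℚ m (λ j → at c j +ℚ at (m ∸ c) j +ℚ at (m / 2) j)
      ≡⟨ trans (sumℚ-+ m _ _) (cong (_+ℚ sumℚ m (at (m / 2))) (sumℚ-+ m _ _)) ⟩
    sumℚ m (at c) +ℚ sumℚ m (at (m ∸ c)) +ℚ sumℚ m (at (m / 2))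
      ≡⟨ cong₂ _+ℚ_ (cong₂ _+ℚ_ (pick c i f) (pick (m ∸ c) i f))
           (trans (pick (m / 2) i f) (cong (λ n → f ((toℕ i + n) mod)) m/2≡k)) ⟩
    f ((toℕ i + c) mod) +ℚ f ((toℕ i + (m ∸ c)) mod) +ℚ f ((toℕ i + k) mod) ∎
    where
    at : ℕ → Fin m → ℚ
    at d j = indicator (circ m d i j) *ℚ f j
    c<m/2 : c < m / 2
    c<m/2 = subst (c <_) (sym m/2≡k) c<k
    m/2<m∸c : m / 2 < m ∸ c
    m/2<m∸c = subst (_< m ∸ c) (sym m/2≡k) (k<m∸ c<k)
    meet : ∀ {d e} j → T (circ m d i j) → T (circ m e i j) → (toℕ i + d) % m ≡ (toℕ i + e) % m
    meet j p q = trans (ℕₚ.≡ᵇ⇒≡ _ _ p) (sym (ℕₚ.≡ᵇ⇒≡ _ _ q))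

  G : Fin (m + m) → Fin (m + m) → Bool
  G = B₁ m a b

  row : (Fin (m + m) → ℚ) → Fin (m + m) → ℚ
  row w u = sumℚ (m + m) (λ v → adjMatrix G u v *ℚ w v)

  x-row-≡ : ∀ w i → row w (i ↑ˡ m) ≡
    xs w (toℕ i + a) +ℚ xs w (toℕ i + (m ∸ a)) +ℚ xs w (toℕ i + k) +ℚ ys w (toℕ i)
  x-row-≡ w i = trans (sumℚ-split m m _) (cong₂ _+ℚ_
    (trans (sumℚ-cong m (λ j → cong (λ p → indicator p *ℚ w (j ↑ˡ m)) (xx j))) (rim-row 0<a a<k i (λ j → w (j ↑ˡ m))))
    (trans (sumℚ-cong m (λ j → cong (λ p → indicator p *ℚ w (m ↑ʳ j)) (xy j)))
      (trans (sumℚ-indicator m i (λ j → w (m ↑ʳ j))) (cong (λ i → w (m ↑ʳ i)) (sym (mod-toℕ i))))))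
    where
    xx : ∀ j → G (i ↑ˡ m) (j ↑ˡ m) ≡ rimAdj m a i j
    xx j rewrite Finₚ.splitAt-↑ˡ m i m | Finₚ.splitAt-↑ˡ m j m = refl
    xy : ∀ j → G (i ↑ˡ m) (m ↑ʳ j) ≡ (toℕ i ≡ᵇ toℕ j)
    xy j rewrite Finₚ.splitAt-↑ˡ m i m | Finₚ.splitAt-↑ʳ m m j = refl

  y-row-≡ : ∀ w i → row w (m ↑ʳ i) ≡
    ys w (toℕ i + b) +ℚ ys w (toℕ i + (m ∸ b)) +ℚ ys w (toℕ i + k) +ℚ xs w (toℕ i)
  y-row-≡ w i = trans (sumℚ-split m m _) (trans (cong₂ _+ℚ_
    (trans (sumℚ-cong m (λ j → cong (λ p → indicator p *ℚ w (j ↑ˡ m)) (yx j)))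
      (trans (sumℚ-indicator m i (λ j → w (j ↑ˡ m))) (cong (λ i → w (i ↑ˡ m)) (sym (mod-toℕ i)))))
    (trans (sumℚ-cong m (λ j → cong (λ p → indicator p *ℚ w (m ↑ʳ j)) (yy j))) (rim-row 0<b b<k i (λ j → w (m ↑ʳ j)))))
    (ℚₚ.+-comm (xs w (toℕ i)) (ys w (toℕ i + b) +ℚ ys w (toℕ i + (m ∸ b)) +ℚ ys w (toℕ i + k))))
    where
    yy : ∀ j → G (m ↑ʳ i) (m ↑ʳ j) ≡ rimAdj m b i j
    yy j rewrite Finₚ.splitAt-↑ʳ m m i | Finₚ.splitAt-↑ʳ m m j = refl
    yx : ∀ j → G (m ↑ʳ i) (j ↑ˡ m) ≡ (toℕ i ≡ᵇ toℕ j)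
    yx j rewrite Finₚ.splitAt-↑ʳ m m i | Finₚ.splitAt-↑ˡ m j m = refl

  ι-sum₄ : ∀ p q r s → ι (p +ᶻ q +ᶻ r +ᶻ s) ≡ ι p +ℚ ι q +ℚ ι r +ℚ ι s
  ι-sum₄ p q r s = trans (ι-+ (p +ᶻ q +ᶻ r) s) (cong (_+ℚ ι s)
    (trans (ι-+ (p +ᶻ q) r) (cong (_+ℚ ι r) (ι-+ p q))))

  *ℚ-sum₄ : ∀ t p q r s → t *ℚ (p +ℚ q +ℚ r +ℚ s) ≡ t *ℚ p +ℚ t *ℚ q +ℚ t *ℚ r +ℚ t *ℚ s
  *ℚ-sum₄ t p q r s = trans (ℚₚ.*-distribˡ-+ t (p +ℚ q +ℚ r) s) (cong (_+ℚ t *ℚ s)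
    (trans (ℚₚ.*-distribˡ-+ t (p +ℚ q) r) (cong (_+ℚ t *ℚ r) (ℚₚ.*-distribˡ-+ t p q))))

  scaled-kernel : ∀ {w N z} → InKernel (m + m) G w → (∀ u → ι N *ℚ w u ≡ ι (z u)) → Kernel m k a b (xs z) (ys z)
  scaled-kernel {w} {N} {z} ker scaled = record
    { x-period = λ i → cong (λ v → z (v ↑ˡ m)) (mod-≡ ([m+n]%n≡m%n i m))
    ; y-period = λ i → cong (λ v → z (m ↑ʳ v)) (mod-≡ ([m+n]%n≡m%n i m))
    ; x-row    = λ i → descend (λ i → i mod ↑ˡ m) (λ i → m ↑ʳ (i mod)) i a (m ∸ a) k
        (cong (λ v → v ↑ˡ m)) (cong (λ v → m ↑ʳ v)) (trans (sym (x-row-≡ w (i mod))) (ker _))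
    ; y-row    = λ i → descend (λ i → m ↑ʳ (i mod)) (λ i → i mod ↑ˡ m) i b (m ∸ b) k
        (cong (λ v → m ↑ʳ v)) (cong (λ v → v ↑ˡ m)) (trans (sym (y-row-≡ w (i mod))) (ker _))
    }
    where
    descend : ∀ (p q : ℕ → Fin (m + m)) i c d e →
      (∀ {i j} → i mod ≡ j mod → p i ≡ p j) → (∀ {i j} → i mod ≡ j mod → q i ≡ q j) →
      w (p (toℕ (i mod) + c)) +ℚ w (p (toℕ (i mod) + d)) +ℚ w (p (toℕ (i mod) + e)) +ℚ w (q (toℕ (i mod))) ≡ 0ℚ →
      z (p (i + c)) +ᶻ z (p (i + d)) +ᶻ z (p (i + e)) +ᶻ z (q i) ≡ 0ℤ
    descend p q i c d e p-cong q-cong sum≡0 = ι-injective (begin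
      ι (z (p (i + c)) +ᶻ z (p (i + d)) +ᶻ z (p (i + e)) +ᶻ z (q i))
        ≡⟨ ι-sum₄ (z (p (i + c))) (z (p (i + d))) (z (p (i + e))) (z (q i)) ⟩
      ι (z (p (i + c))) +ℚ ι (z (p (i + d))) +ℚ ι (z (p (i + e))) +ℚ ι (z (q i))
        ≡⟨ cong₂ _+ℚ_ (cong₂ _+ℚ_ (cong₂ _+ℚ_ (term c) (term d)) (term e))
             (trans (sym (scaled (q i))) (cong (λ u → ι N *ℚ w u) (q-cong (sym (mod-toℕ (i mod)))))) ⟩
      ι N *ℚ w (p (i′ + c)) +ℚ ι N *ℚ w (p (i′ + d)) +ℚ ι N *ℚ w (p (i′ + e)) +ℚ ι N *ℚ w (q i′)
        ≡⟨ sym (*ℚ-sum₄ (ι N) (w (p (i′ + c))) (w (p (i′ + d))) (w (p (i′ + e))) (w (q i′))) ⟩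
      ι N *ℚ (w (p (i′ + c)) +ℚ w (p (i′ + d)) +ℚ w (p (i′ + e)) +ℚ w (q i′))
        ≡⟨ trans (cong (ι N *ℚ_) sum≡0) (ℚₚ.*-zeroʳ (ι N)) ⟩
      0ℚ ∎)
      where
      i′ = toℕ (i mod)
      i%m+ : ∀ c → (i + c) mod ≡ (i′ + c) mod
      i%m+ c = mod-≡ (trans (%-distribˡ-+ i c m) (trans (cong (λ r → (r + c % m) % m)
        (trans (sym (m%n%n≡m%n i m)) (cong (_% m) (sym (toℕ-mod i))))) (sym (%-distribˡ-+ i′ c m))))
      term : ∀ c → ι (z (p (i + c))) ≡ ι N *ℚ w (p (i′ + c))
      term c = trans (sym (scaled (p (i + c)))) (cong (λ u → ι N *ℚ w u) (p-cong (i%m+ c)))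

  kernel-vector : ∀ {x y} → Kernel m k a b x y → InKernel (m + m) G (λ u → ι (vector x y u))
  kernel-vector {x} {y} K = each-vertex
    (λ i → trans (x-row-≡ v i) (trans (cong₂ _+ℚ_ (cong₂ _+ℚ_ (cong₂ _+ℚ_ (x-at _) (x-at _)) (x-at _)) (y-at (toℕ i)))
      (trans (sym (ι-sum₄ (x (toℕ i + a)) (x (toℕ i + (m ∸ a))) (x (toℕ i + k)) (y (toℕ i)))) (cong ι (x-row (toℕ i))))))
    (λ i → trans (y-row-≡ v i) (trans (cong₂ _+ℚ_ (cong₂ _+ℚ_ (cong₂ _+ℚ_ (y-at _) (y-at _)) (y-at _)) (x-at (toℕ i)))
      (trans (sym (ι-sum₄ (y (toℕ i + b)) (y (toℕ i + (m ∸ b))) (y (toℕ i + k)) (x (toℕ i)))) (cong ι (y-row (toℕ i))))))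
    where
    open Kernel K
    v : Fin (m + m) → ℚ
    v u = ι (vector x y u)
    x-at : ∀ j → xs v j ≡ ι (x j)
    x-at j = cong ι (trans (vector-x x y (j mod)) (trans (cong x (toℕ-mod j)) (sym (period-% {m} {x} x-period j))))
    y-at : ∀ j → ys v j ≡ ι (y j)
    y-at j = cong ι (trans (vector-y x y (j mod)) (trans (cong y (toℕ-mod j)) (sym (period-% {m} {y} y-period j))))

  nut⇒rigid : IsNutGraph (m + m) G → Rigid m k a b × ∃ λ x → ∃ λ y → Kernel m k a b x y × x 0 ≢ 0ℤ
  nut⇒rigid (v , ker , v≢0 , span) with common-denominator (m + m) v
  ... | N , N≢0 , z , scaled = rigid , xs z , ys z , scaled-kernel {v} {N} {z} ker scaled , x0≢0
    where
    o : Fin (m + m)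
    o = 0 mod ↑ˡ m
    x0≢0 : z o ≢ 0ℤ
    x0≢0 z≡0 = v≢0 o (*ℚ-cancelˡ (ι≢0 N≢0) (trans (scaled o) (trans (cong ι z≡0) (sym (ℚₚ.*-zeroʳ (ι N))))))
    rigid : Rigid m k a b
    rigid x y K x0≡0 i with span _ (kernel-vector K)
    ... | c , multiple = x≡0 , y≡0
      where
      open Kernel K
      c≡0 : c ≡ 0ℚ
      c≡0 = *ℚ-cancelˡ (v≢0 o) (begin
        v o *ℚ c           ≡⟨ ℚₚ.*-comm (v o) c ⟩
        c *ℚ v o           ≡⟨ sym (multiple o) ⟩
        ι (vector x y o)   ≡⟨ cong ι (trans (vector-x x y (0 mod))
                                (trans (cong x (toℕ-mod 0)) (trans (sym (period-% {m} {x} x-period 0)) x0≡0))) ⟩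
        0ℚ                 ≡⟨ sym (ℚₚ.*-zeroʳ (v o)) ⟩
        v o *ℚ 0ℚ          ∎)
      vector≡0 : ∀ u → vector x y u ≡ 0ℤ
      vector≡0 u = ι-injective (trans (multiple u) (trans (cong (_*ℚ v u) c≡0) (ℚₚ.*-zeroˡ (v u))))
      x≡0 : x i ≡ 0ℤ
      x≡0 = trans (period-% {m} {x} x-period i) (trans (cong x (sym (toℕ-mod i))) (trans (sym (vector-x x y (i mod))) (vector≡0 _)))
      y≡0 : y i ≡ 0ℤ
      y≡0 = trans (period-% {m} {y} y-period i) (trans (cong y (sym (toℕ-mod i))) (trans (sym (vector-y x y (i mod))) (vector≡0 _)))

  -- Since x₀ = 1, the scalar for w is its own entry at `o`: after clearing denominators to z, the
  -- kernel vector z - z_o v vanishes at `o`, hence everywhere.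
  rigid⇒nut : Rigid m k a b → ∀ {x y} → Kernel m k a b x y → x 0 ≡ 1ℤ →
    (∀ i → x i ≢ 0ℤ) → (∀ i → y i ≢ 0ℤ) → IsNutGraph (m + m) G
  rigid⇒nut rigid {x} {y} K x0≡1 x≢0 y≢0 = v , kernel-vector K , v≢0 , span
    where
    v : Fin (m + m) → ℚ
    v u = ι (vector x y u)
    v≢0 : ∀ u → v u ≢ 0ℚ
    v≢0 = each-vertex (λ i e → x≢0 (toℕ i) (trans (sym (vector-x x y i)) (ι-injective e)))
                      (λ i e → y≢0 (toℕ i) (trans (sym (vector-y x y i)) (ι-injective e)))
    o : Fin (m + m)
    o = 0 mod ↑ˡ m
    span : ∀ w → InKernel (m + m) G w → Σ ℚ λ c → ∀ u → w u ≡ c *ℚ v u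
    span w ker with common-denominator (m + m) w
    ... | N , N≢0 , z , scaled = w o , λ u → *ℚ-cancelˡ (ι≢0 N≢0) (begin
      ι N *ℚ w u               ≡⟨ scaled u ⟩
      ι (z u)                  ≡⟨ cong ι (multiple u) ⟩
      ι (z o *ᶻ vector x y u)  ≡⟨ ι-* (z o) (vector x y u) ⟩
      ι (z o) *ℚ v u           ≡⟨ cong (_*ℚ v u) (sym (scaled o)) ⟩
      ι N *ℚ w o *ℚ v u        ≡⟨ ℚₚ.*-assoc (ι N) (w o) (v u) ⟩
      ι N *ℚ (w o *ℚ v u)      ∎)
      where
      c : ℤ
      c = -ᶻ z o
      vanishes : ∀ i → c *ᶻ x i +ᶻ xs z i ≡ 0ℤ × c *ᶻ y i +ᶻ ys z i ≡ 0ℤ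
      vanishes = rigid _ _ (Kernel-combine c K (scaled-kernel {w} {N} {z} ker scaled))
        (trans (cong (λ u → c *ᶻ u +ᶻ z o) x0≡1) (ring (z o)))
        where
        ring : ∀ u → (-ᶻ u) *ᶻ 1ℤ +ᶻ u ≡ + 0
        ring = ℤ-ring
      solve : ∀ s t r → (-ᶻ s) *ᶻ t +ᶻ r ≡ 0ℤ → r ≡ s *ᶻ t
      solve s t r e = trans (ring s t r) (trans (cong (_+ᶻ s *ᶻ t) e) (ℤₚ.+-identityˡ (s *ᶻ t)))
        where
        ring : ∀ s t r → r ≡ (-ᶻ s) *ᶻ t +ᶻ r +ᶻ s *ᶻ t
        ring = ℤ-ring
      multiple : ∀ u → z u ≡ z o *ᶻ vector x y u
      multiple = each-vertex
        (λ i → trans (cong (λ i → z (i ↑ˡ m)) (sym (mod-toℕ i)))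
          (trans (solve (z o) (x (toℕ i)) _ (proj₁ (vanishes (toℕ i)))) (cong (z o *ᶻ_) (sym (vector-x x y i)))))
        (λ i → trans (cong (λ i → z (m ↑ʳ i)) (sym (mod-toℕ i)))
          (trans (solve (z o) (y (toℕ i)) _ (proj₂ (vanishes (toℕ i)))) (cong (z o *ᶻ_) (sym (vector-y x y i)))))

-- Necessity of the conditions

1≢0 : 1ℤ ≢ 0ℤ
1≢0 ()

parity : ∀ n → 2 ∣ n ⊎ Odd n
parity zero    = inj₁ (2 ∣0)
parity (suc n) with parity n
... | inj₁ (divides q refl) = inj₂ (q , cong suc (ℕₚ.*-comm q 2))
... | inj₂ (h , refl)       = inj₁ (divides (suc h) (cong (λ n → suc (suc n)) (ℕₚ.*-comm 2 h)))

Kernel-shift : ∀ {m k a b x y} n → Kernel m k a b x y → Kernel m k a b (λ i → x (i + n)) (λ i → y (i + n))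
Kernel-shift {x = x} {y} n K = record
  { x-period = λ i → trans (cong x (swap i _)) (x-period (i + n))
  ; y-period = λ i → trans (cong y (swap i _)) (y-period (i + n))
  ; x-row    = λ i → trans (cong (_+ᶻ y (i + n))
      (cong₂ _+ᶻ_ (cong₂ _+ᶻ_ (cong x (swap i _)) (cong x (swap i _))) (cong x (swap i _)))) (x-row (i + n))
  ; y-row    = λ i → trans (cong (_+ᶻ x (i + n))
      (cong₂ _+ᶻ_ (cong₂ _+ᶻ_ (cong y (swap i _)) (cong y (swap i _))) (cong y (swap i _)))) (y-row (i + n))
  }
  where
  open Kernel K
  swap : ∀ i c → i + c + n ≡ i + n + c
  swap i c = trans (ℕₚ.+-assoc i c n) (trans (cong (λ e → i + e) (ℕₚ.+-comm c n)) (sym (ℕₚ.+-assoc i n c)))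

-- i ↦ -i modulo m.
Kernel-reflect : ∀ {m k a b x y} .{{_ : NonZero m}} → m ≡ 2 * k → a ≤ m → b ≤ m →
  Kernel m k a b x y → Kernel m k a b (λ i → x ((m ∸ 1) * i)) (λ i → y ((m ∸ 1) * i))
Kernel-reflect {m} {k} {a} {b} {x} {y} m≡2k a≤m b≤m K = record
  { x-period = λ i → trans (cong x (ℕₚ.*-distribˡ-+ r i m)) (period-* {m} {x} x-period r (r * i))
  ; y-period = λ i → trans (cong y (ℕₚ.*-distribˡ-+ r i m)) (period-* {m} {y} y-period r (r * i))
  ; x-row    = reflected-row x y x-period a≤m
      (λ i → trans (cong (λ u → u +ᶻ x (i + k) +ᶻ y i) (ℤₚ.+-comm (x (i + (m ∸ a))) (x (i + a)))) (x-row i))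
  ; y-row    = reflected-row y x y-period b≤m
      (λ i → trans (cong (λ u → u +ᶻ y (i + k) +ᶻ x i) (ℤₚ.+-comm (y (i + (m ∸ b))) (y (i + b)))) (y-row i))
  }
  where
  open Kernel K
  r = m ∸ 1
  1+r≡m : suc r ≡ m
  1+r≡m = ℕₚ.suc-pred m
  reflect : ∀ s → Period m s → ∀ {c d} → c + d ≡ m → ∀ i → s (r * (i + c)) ≡ s (r * i + d)
  reflect s p {c} {d} c+d≡m i = trans (cong s (ℕₚ.*-distribˡ-+ r i c))
    (period-agree s p (period-* {m} {s} p c)
      (trans (cong (λ n → r * c + n) (sym c+d≡m)) (trans (ring r c d) (cong (λ n → d + c * n) 1+r≡m))) (r * i))
    where
    ring : ∀ r c d → r * c + (c + d) ≡ d + c * suc r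
    ring = ℕ-ring
  reflected-row : ∀ s t → Period m s → ∀ {c} → c ≤ m →
    (∀ i → s (i + (m ∸ c)) +ᶻ s (i + c) +ᶻ s (i + k) +ᶻ t i ≡ 0ℤ) →
    ∀ i → s (r * (i + c)) +ᶻ s (r * (i + (m ∸ c))) +ᶻ s (r * (i + k)) +ᶻ t (r * i) ≡ 0ℤ
  reflected-row s t p c≤m row i = trans (cong (_+ᶻ t (r * i)) (cong₂ _+ᶻ_ (cong₂ _+ᶻ_
      (reflect s p (ℕₚ.m+[n∸m]≡n c≤m) i) (reflect s p (ℕₚ.m∸n+n≡m c≤m) i))
      (reflect s p (trans (cong (λ n → k + n) (sym (ℕₚ.+-identityʳ k))) (sym m≡2k)) i))) (row (r * i))

-- Conditions forced by rigidity

module Necessity {m k a b : ℕ} .{{_ : NonZero m}} (m≡2k : m ≡ 2 * k)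
  (a≤m : a ≤ m) (b≤m : b ≤ m) (rigid : Rigid m k a b) where

  symmetric : ∀ {x y} → Kernel m k a b x y → ∀ i → x ((m ∸ 1) * i) ≡ x i × y ((m ∸ 1) * i) ≡ y i
  symmetric {x} {y} K i = agree x (proj₁ (difference i)) , agree y (proj₂ (difference i))
    where
    cancel : ∀ u → -1ℤ *ᶻ u +ᶻ u ≡ + 0
    cancel = ℤ-ring
    difference = rigid _ _ (Kernel-combine -1ℤ K (Kernel-reflect m≡2k a≤m b≤m K))
      (trans (cong (λ n → -1ℤ *ᶻ x 0 +ᶻ x n) (ℕₚ.*-zeroʳ (m ∸ 1))) (cancel (x 0)))
    agree : ∀ s → -1ℤ *ᶻ s i +ᶻ s ((m ∸ 1) * i) ≡ 0ℤ → s ((m ∸ 1) * i) ≡ s i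
    agree s e = linear₁ 1ℤ e (ring (s i) (s ((m ∸ 1) * i)))
      where
      ring : ∀ u v → v +ᶻ -ᶻ u ≡ 1ℤ *ᶻ (-1ℤ *ᶻ u +ᶻ v +ᶻ -ᶻ + 0)
      ring = ℤ-ring

  module _ {x y : Seq} (K : Kernel m k a b x y) where
    open Kernel K

    -- x is even about 0 and about 1.
    period-2 : Period 2 x × Period 2 y
    period-2 = two-reflections x x-period (λ i → proj₁ (symmetric K i)) (λ i → proj₁ (symmetric (Kernel-shift 1 K) i))
             , two-reflections y y-period (λ i → proj₂ (symmetric K i)) (λ i → proj₂ (symmetric (Kernel-shift 1 K) i))
      where
      r = m ∸ 1
      two-reflections : ∀ s → Period m s → (∀ i → s (r * i) ≡ s i) → (∀ i → s (r * i + 1) ≡ s (i + 1)) → Period 2 s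
      two-reflections s p even₀ even₁ i = begin
        s (i + 2)           ≡⟨ cong s (sym (ℕₚ.+-assoc i 1 1)) ⟩
        s (i + 1 + 1)       ≡⟨ sym (even₁ (i + 1)) ⟩
        s (r * (i + 1) + 1) ≡⟨ cong s (trans (ring r i) (cong (λ n → r * i + n) (ℕₚ.suc-pred m))) ⟩
        s (r * i + m)       ≡⟨ p (r * i) ⟩
        s (r * i)           ≡⟨ even₀ i ⟩
        s i                 ∎
        where
        ring : ∀ r i → r * (i + 1) + 1 ≡ r * i + suc r
        ring = ℕ-ring

    -- Adding the rows at 0 and 1 for sequences of period 2, each of the three rim neighbours
    -- contributes the same sum. So u = x₀ + x₁ and v = y₀ + y₁ satisfy 3u + v = 0 = 3v + u, a
    -- system of determinant 8.
    alternating : (∀ i → x (i + 1) ≡ -ᶻ x i) × (∀ i → y (i + 1) ≡ -ᶻ y i)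
    alternating = (λ i → opposite (x i) (x (i + 1)) (trans (pair x (proj₁ period-2) i) x≡0))
                , (λ i → opposite (y i) (y (i + 1)) (trans (pair y (proj₂ period-2) i) y≡0))
      where
      pair : ∀ s → Period 2 s → ∀ i → s i +ᶻ s (i + 1) ≡ s 0 +ᶻ s 1
      pair s p zero    = refl
      pair s p (suc i) = trans (cong₂ _+ᶻ_ (cong s (ℕₚ.+-comm 1 i)) (trans (cong s (sym (ℕₚ.+-suc i 1))) (p i)))
        (trans (ℤₚ.+-comm (s (i + 1)) (s i)) (pair s p i))
      opposite : ∀ u v → u +ᶻ v ≡ 0ℤ → v ≡ -ᶻ u
      opposite u v e = linear₁ 1ℤ e (ring u v)
        where
        ring : ∀ u v → v +ᶻ -ᶻ (-ᶻ u) ≡ 1ℤ *ᶻ (u +ᶻ v +ᶻ -ᶻ + 0)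
        ring = ℤ-ring
      rows : ∀ s t → Period 2 s → Period 2 t → ∀ {c d} →
        (∀ i → s (i + c) +ᶻ s (i + d) +ᶻ s (i + k) +ᶻ t i ≡ 0ℤ) → + 3 *ᶻ (s 0 +ᶻ s 1) +ᶻ (t 0 +ᶻ t 1) ≡ 0ℤ
      rows s t ps pt {c} {d} row = trans
        (trans (ring₁ (s 0 +ᶻ s 1) (t 0) (t 1))
               (trans (sym (cong₂ _+ᶻ_ (cong₂ _+ᶻ_ (cong₂ _+ᶻ_ (pair′ c) (pair′ d)) (pair′ k)) refl))
                      (ring₂ (s c) (s (1 + c)) (s d) (s (1 + d)) (s k) (s (1 + k)) (t 0) (t 1))))
        (cong₂ _+ᶻ_ (row 0) (row 1))
        where
        pair′ : ∀ c → s c +ᶻ s (1 + c) ≡ s 0 +ᶻ s 1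
        pair′ c = trans (cong (λ n → s c +ᶻ s n) (ℕₚ.+-comm 1 c)) (pair s ps c)
        ring₁ : ∀ u t₀ t₁ → + 3 *ᶻ u +ᶻ (t₀ +ᶻ t₁) ≡ u +ᶻ u +ᶻ u +ᶻ (t₀ +ᶻ t₁)
        ring₁ = ℤ-ring
        ring₂ : ∀ c c′ d d′ k k′ t t′ → c +ᶻ c′ +ᶻ (d +ᶻ d′) +ᶻ (k +ᶻ k′) +ᶻ (t +ᶻ t′)
          ≡ c +ᶻ d +ᶻ k +ᶻ t +ᶻ (c′ +ᶻ d′ +ᶻ k′ +ᶻ t′)
        ring₂ = ℤ-ring
      x-rows = rows x y (proj₁ period-2) (proj₂ period-2) x-row
      y-rows = rows y x (proj₂ period-2) (proj₁ period-2) y-row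
      solve : ∀ u v → + 3 *ᶻ u +ᶻ v ≡ 0ℤ → + 3 *ᶻ v +ᶻ u ≡ 0ℤ → u ≡ 0ℤ
      solve u v e f = ℤₚ.*-cancelˡ-≡ (+ 8) _ _ (linear₂ (+ 3) -1ℤ e f (ring u v))
        where
        ring : ∀ u v → + 8 *ᶻ u +ᶻ -ᶻ (+ 8 *ᶻ + 0) ≡ + 3 *ᶻ (+ 3 *ᶻ u +ᶻ v +ᶻ -ᶻ + 0) +ᶻ -1ℤ *ᶻ (+ 3 *ᶻ v +ᶻ u +ᶻ -ᶻ + 0)
        ring = ℤ-ring
      x≡0 : x 0 +ᶻ x 1 ≡ 0ℤ
      x≡0 = solve _ _ x-rows y-rows
      y≡0 : y 0 +ᶻ y 1 ≡ 0ℤ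
      y≡0 = solve _ _ y-rows x-rows

    alternating-sign : ∀ s → (∀ i → s (i + 1) ≡ -ᶻ s i) → ∀ i → s i ≡ sign i *ᶻ s 0
    alternating-sign s alt zero    = sym (ℤₚ.*-identityˡ (s 0))
    alternating-sign s alt (suc i) = trans (cong s (ℕₚ.+-comm 1 i)) (trans (alt i)
      (trans (cong -ᶻ_ (alternating-sign s alt i)) (ℤₚ.neg-distribˡ-* (sign i) (s 0))))

    sign-∸ : ∀ {c} → c ≤ m → sign (m ∸ c) ≡ sign c
    sign-∸ {c} c≤m = begin
      sign (m ∸ c)                         ≡⟨ sym (ℤₚ.*-identityˡ _) ⟩
      1ℤ *ᶻ sign (m ∸ c)                   ≡⟨ cong (_*ᶻ sign (m ∸ c)) (sym (sign² c)) ⟩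
      sign c *ᶻ sign c *ᶻ sign (m ∸ c)     ≡⟨ ℤₚ.*-assoc (sign c) (sign c) (sign (m ∸ c)) ⟩
      sign c *ᶻ (sign c *ᶻ sign (m ∸ c))   ≡⟨ cong (sign c *ᶻ_) (trans (sym (sign-+ c (m ∸ c))) (cong sign (ℕₚ.m+[n∸m]≡n c≤m))) ⟩
      sign c *ᶻ sign m                     ≡⟨ cong (sign c *ᶻ_) (sign-even (subst (2 ∣_) (sym m≡2k) (m∣m*n k))) ⟩
      sign c *ᶻ 1ℤ                         ≡⟨ ℤₚ.*-identityʳ (sign c) ⟩
      sign c                               ∎

    eigen-row : ∀ s t → (∀ i → s (i + 1) ≡ -ᶻ s i) → ∀ {c} → c ≤ m →
      s c +ᶻ s (m ∸ c) +ᶻ s k +ᶻ t ≡ 0ℤ → (+ 2 *ᶻ sign c +ᶻ sign k) *ᶻ s 0 +ᶻ t ≡ 0ℤ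
    eigen-row s t alt {c} c≤m row = trans (ring (sign c) (sign k) (s 0) t) (trans (sym (cong (_+ᶻ t)
      (cong₂ _+ᶻ_ (cong₂ _+ᶻ_ (alternating-sign s alt c)
        (trans (alternating-sign s alt (m ∸ c)) (cong (_*ᶻ s 0) (sign-∸ c≤m)))) (alternating-sign s alt k)))) row)
      where
      ring : ∀ c k s t → (+ 2 *ᶻ c +ᶻ k) *ᶻ s +ᶻ t ≡ c *ᶻ s +ᶻ c *ᶻ s +ᶻ k *ᶻ s +ᶻ t
      ring = ℤ-ring

    -- The two factors are the eigenvalues of the rims on the alternating vector; eliminating y₀
    -- from the two rows at 0 leaves their product minus 1.
    eigenvalues : ((+ 2 *ᶻ sign a +ᶻ sign k) *ᶻ (+ 2 *ᶻ sign b +ᶻ sign k) -ᶻ 1ℤ) *ᶻ x 0 ≡ 0ℤ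
    eigenvalues = linear₂ (+ 2 *ᶻ sign b +ᶻ sign k) -1ℤ
      (eigen-row x (y 0) (proj₁ alternating) a≤m (x-row 0)) (eigen-row y (x 0) (proj₂ alternating) b≤m (y-row 0))
      (ring (+ 2 *ᶻ sign a +ᶻ sign k) (+ 2 *ᶻ sign b +ᶻ sign k) (x 0) (y 0))
      where
      ring : ∀ α β x y → (α *ᶻ β +ᶻ -ᶻ 1ℤ) *ᶻ x +ᶻ -ᶻ + 0 ≡
        β *ᶻ (α *ᶻ x +ᶻ y +ᶻ -ᶻ + 0) +ᶻ -1ℤ *ᶻ (β *ᶻ y +ᶻ x +ᶻ -ᶻ + 0)
      ring = ℤ-ring

  -- sin (nπ/2), a sequence with T² = -1 and a zero at 0.
  quarter : Seq
  quarter zero          = 0ℤ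
  quarter (suc zero)    = 1ℤ
  quarter (suc (suc n)) = -ᶻ quarter n

  quarter-+2 : ∀ n i → quarter (i + 2 * n) ≡ sign n *ᶻ quarter i
  quarter-+2 zero    i = trans (cong quarter (ℕₚ.+-identityʳ i)) (sym (ℤₚ.*-identityˡ (quarter i)))
  quarter-+2 (suc n) i = trans (cong quarter (ring n i)) (trans (cong -ᶻ_ (quarter-+2 n i)) (ℤₚ.neg-distribˡ-* (sign n) (quarter i)))
    where
    ring : ∀ n i → i + 2 * suc n ≡ suc (suc (i + 2 * n))
    ring = ℕ-ring

  -- The two odd shifts are 1 and 3 modulo 4 in some order, and T³ = -T on `quarter`.
  quarter-cancel : ∀ {c d} → Odd c → Odd d → 4 ∣ c + d → ∀ i → quarter (i + c) +ᶻ quarter (i + d) ≡ 0ℤ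
  quarter-cancel {c} {d} (g , refl) (h , refl) (divides q e) i = begin
    quarter (i + suc (2 * g)) +ᶻ quarter (i + suc (2 * h)) ≡⟨ cong₂ _+ᶻ_ (at g) (at h) ⟩
    sign g *ᶻ quarter (suc i) +ᶻ sign h *ᶻ quarter (suc i) ≡⟨ cong (λ u → u *ᶻ quarter (suc i) +ᶻ sign h *ᶻ quarter (suc i)) opposite ⟩
    (-ᶻ sign h) *ᶻ quarter (suc i) +ᶻ sign h *ᶻ quarter (suc i) ≡⟨ ring (sign h) (quarter (suc i)) ⟩
    0ℤ ∎
    where
    at : ∀ g → quarter (i + suc (2 * g)) ≡ sign g *ᶻ quarter (suc i)
    at g = trans (cong quarter (ℕₚ.+-suc i (2 * g))) (quarter-+2 g (suc i))
    ring : ∀ s u → (-ᶻ s) *ᶻ u +ᶻ s *ᶻ u ≡ + 0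
    ring = ℤ-ring
    half : suc (g + h) ≡ q * 2
    half = ℕₚ.*-cancelˡ-≡ _ _ 2 (trans (ring₁ g h) (trans e (ring₂ q)))
      where
      ring₁ : ∀ g h → 2 * suc (g + h) ≡ suc (2 * g) + suc (2 * h)
      ring₁ = ℕ-ring
      ring₂ : ∀ q → q * 4 ≡ 2 * (q * 2)
      ring₂ = ℕ-ring
    opposite : sign g ≡ -ᶻ sign h
    opposite = linear₂ (-ᶻ sign h) (-ᶻ sign g)
      (trans (cong -ᶻ_ (sym (sign-+ g h))) (sign-even (divides q half))) (sign² h) (ring₃ (sign g) (sign h))
      where
      ring₃ : ∀ s t → s +ᶻ -ᶻ (-ᶻ t) ≡ (-ᶻ t) *ᶻ (-ᶻ (s *ᶻ t) +ᶻ -ᶻ 1ℤ) +ᶻ (-ᶻ s) *ᶻ (t *ᶻ t +ᶻ -ᶻ 1ℤ)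
      ring₃ = ℤ-ring

  odd-∸ : ∀ {c} → c ≤ m → Odd c → Odd (m ∸ c)
  odd-∸ {c} c≤m odd with parity (m ∸ c)
  ... | inj₂ odd′ = odd′
  ... | inj₁ 2∣m∸c = ⊥-elim (2≢1 (odd-coprime odd (∣m+n∣m⇒∣n (subst (2 ∣_) (sym sum) (subst (2 ∣_) (sym m≡2k) (m∣m*n k))) 2∣m∸c , ∣-refl)))
    where
    2≢1 : 2 ≢ 1
    2≢1 ()
    sum : m ∸ c + c ≡ m
    sum = ℕₚ.m∸n+n≡m c≤m

  -- Here both rim eigenvalues on the alternating vector are -1, so `eigenvalues` gives no
  -- contradiction. But X and Y kill `quarter`, and T^k acts on it as (-1)^h for k = 2h, so y =
  -- -(-1)^h x solves both rows with x₀ = 0 and x₁ = 1.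
  ¬even-odd-odd : 2 ∣ k → Odd a → Odd b → ⊥
  ¬even-odd-odd (divides h k≡h2) odd-a odd-b with proj₁ (rigid quarter (λ i → (-ᶻ sign h) *ᶻ quarter i) K refl 1)
    where
    4∣m : 4 ∣ m
    4∣m = divides h (trans m≡2k (trans (cong (2 *_) k≡h2) (ring h)))
      where
      ring : ∀ h → 2 * (h * 2) ≡ h * 4
      ring = ℕ-ring
    cancel : ∀ {c} → c ≤ m → Odd c → ∀ i → quarter (i + c) +ᶻ quarter (i + (m ∸ c)) ≡ 0ℤ
    cancel c≤m odd = quarter-cancel odd (odd-∸ c≤m odd) (subst (4 ∣_) (sym (ℕₚ.m+[n∸m]≡n c≤m)) 4∣m)
    quarter-k : ∀ i → quarter (i + k) ≡ sign h *ᶻ quarter i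
    quarter-k i = trans (cong (λ n → quarter (i + n)) (trans k≡h2 (ℕₚ.*-comm h 2))) (quarter-+2 h i)
    quarter-m : Period m quarter
    quarter-m i = trans (cong (λ n → quarter (i + n)) m≡2k) (trans (quarter-+2 k i)
      (trans (cong (_*ᶻ quarter i) (sign-even (divides h k≡h2))) (ℤₚ.*-identityˡ (quarter i))))
    K : Kernel m k a b quarter (λ i → (-ᶻ sign h) *ᶻ quarter i)
    K = record
      { x-period = quarter-m
      ; y-period = λ i → cong ((-ᶻ sign h) *ᶻ_) (quarter-m i)
      ; x-row    = λ i → linear₂ 1ℤ 1ℤ (cancel a≤m odd-a i) (quarter-k i)
          (ring₁ (sign h) (quarter (i + a)) (quarter (i + (m ∸ a))) (quarter (i + k)) (quarter i))
      ; y-row    = λ i → linear₃ (-ᶻ sign h) (-ᶻ sign h) (-ᶻ quarter i) (cancel b≤m odd-b i) (quarter-k i) (sign² h)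
          (ring₂ (sign h) (quarter (i + b)) (quarter (i + (m ∸ b))) (quarter (i + k)) (quarter i))
      }
      where
      ring₁ : ∀ s u v w q → u +ᶻ v +ᶻ w +ᶻ (-ᶻ s) *ᶻ q +ᶻ -ᶻ + 0 ≡ 1ℤ *ᶻ (u +ᶻ v +ᶻ -ᶻ + 0) +ᶻ 1ℤ *ᶻ (w +ᶻ -ᶻ (s *ᶻ q))
      ring₁ = ℤ-ring
      ring₂ : ∀ s u v w q → (-ᶻ s) *ᶻ u +ᶻ (-ᶻ s) *ᶻ v +ᶻ (-ᶻ s) *ᶻ w +ᶻ q +ᶻ -ᶻ + 0
        ≡ (-ᶻ s) *ᶻ (u +ᶻ v +ᶻ -ᶻ + 0) +ᶻ (-ᶻ s) *ᶻ (w +ᶻ -ᶻ (s *ᶻ q)) +ᶻ (-ᶻ q) *ᶻ (s *ᶻ s +ᶻ -ᶻ 1ℤ)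
      ring₂ = ℤ-ring
  ... | ()

  -- The rim eigenvalues are 3 or -1 for even k and 1 or -3 for odd k. Their product is 1 only as
  -- (-1)(-1), the case excluded separately, or as 1 · 1.
  parities : ∀ {x y} → Kernel m k a b x y → x 0 ≢ 0ℤ → Odd k × 2 ∣ a × 2 ∣ b
  parities {x} K x0≢0 = by-parity (parity k) (parity a) (parity b)
    where
    excluded : ∀ {α β κ} → sign a ≡ α → sign b ≡ β → sign k ≡ κ →
      (+ 2 *ᶻ α +ᶻ κ) *ᶻ (+ 2 *ᶻ β +ᶻ κ) -ᶻ 1ℤ ≢ 0ℤ → ⊥
    excluded refl refl refl ≢0 with ℤₚ.i*j≡0⇒i≡0∨j≡0 _ (eigenvalues K)
    ... | inj₁ ≡0 = ≢0 ≡0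
    ... | inj₂ x0≡0 = x0≢0 x0≡0
    by-parity : 2 ∣ k ⊎ Odd k → 2 ∣ a ⊎ Odd a → 2 ∣ b ⊎ Odd b → Odd k × 2 ∣ a × 2 ∣ b
    by-parity (inj₂ odd-k) (inj₁ 2∣a) (inj₁ 2∣b) = odd-k , 2∣a , 2∣b
    by-parity (inj₁ 2∣k) (inj₂ odd-a) (inj₂ odd-b) = ⊥-elim (¬even-odd-odd 2∣k odd-a odd-b)
    by-parity (inj₁ 2∣k) (inj₁ 2∣a) (inj₁ 2∣b) = ⊥-elim (excluded (sign-even 2∣a) (sign-even 2∣b) (sign-even 2∣k) (λ ()))
    by-parity (inj₁ 2∣k) (inj₁ 2∣a) (inj₂ odd-b) = ⊥-elim (excluded (sign-even 2∣a) (sign-odd odd-b) (sign-even 2∣k) (λ ()))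
    by-parity (inj₁ 2∣k) (inj₂ odd-a) (inj₁ 2∣b) = ⊥-elim (excluded (sign-odd odd-a) (sign-even 2∣b) (sign-even 2∣k) (λ ()))
    by-parity (inj₂ odd-k) (inj₁ 2∣a) (inj₂ odd-b) = ⊥-elim (excluded (sign-even 2∣a) (sign-odd odd-b) (sign-odd odd-k) (λ ()))
    by-parity (inj₂ odd-k) (inj₂ odd-a) (inj₁ 2∣b) = ⊥-elim (excluded (sign-odd odd-a) (sign-even 2∣b) (sign-odd odd-k) (λ ()))
    by-parity (inj₂ odd-k) (inj₂ odd-a) (inj₂ odd-b) = ⊥-elim (excluded (sign-odd odd-a) (sign-odd odd-b) (sign-odd odd-k) (λ ()))

  module _ .{{_ : NonZero k}} (odd : Odd k) (2∣a : 2 ∣ a) (2∣b : 2 ∣ b) where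

    twisted-vanishes : ∀ f g → Period k f → Period k g →
      (∀ i → f (i + a) +ᶻ f (i + (m ∸ a)) -ᶻ f i +ᶻ g i ≡ 0ℤ) →
      (∀ i → g (i + b) +ᶻ g (i + (m ∸ b)) -ᶻ g i +ᶻ f i ≡ 0ℤ) → f 0 ≡ 0ℤ → ∀ i → f i ≡ 0ℤ
    twisted-vanishes f g pf pg f-row g-row f0≡0 i
      with ℤₚ.i*j≡0⇒i≡0∨j≡0 (sign i) (proj₁ (rigid _ _ (twisted-kernel m≡2k a≤m b≤m odd 2∣a 2∣b f g pf pg f-row g-row)
             (trans (ℤₚ.*-identityˡ (f 0)) f0≡0) i))
    ... | inj₂ f≡0 = f≡0
    ... | inj₁ sign≡0 with trans (sym (sign² i)) (trans (cong (_*ᶻ sign i) sign≡0) (ℤₚ.*-zeroˡ (sign i)))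
    ... | ()

    m-multiple : ∀ {n} → n ∣ k → n ∣ m
    m-multiple n∣k = subst (_ ∣_) (sym m≡2k) (∣n⇒∣m*n 2 n∣k)

    -- If d divides k, a and b, then X = Y = 2 on sequences f of period d, and (f, -f) satisfies the
    -- twisted rows as 2f - f - f = 0.
    gcd≡1 : gcd (gcd k a) b ≡ 1
    gcd≡1 with gcd (gcd k a) b ℕₚ.≟ 1
    ... | yes d≡1 = d≡1
    ... | no  d≢1 = ⊥-elim (1≢0 (trans (sym (δ-∣ (subst (d ∣_) last ∣-refl))) (f≡0 (d ∸ 1))))
      where
      d = gcd (gcd k a) b
      d∣k : d ∣ k
      d∣k = ∣-trans (gcd[m,n]∣m (gcd k a) b) (gcd[m,n]∣m k a)
      d∣a : d ∣ a
      d∣a = ∣-trans (gcd[m,n]∣m (gcd k a) b) (gcd[m,n]∣n k a)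
      d∣b : d ∣ b
      d∣b = gcd[m,n]∣n (gcd k a) b
      -- The offset 1 puts a zero at index 0, since d is not 1, and the entry 1 at index d - 1.
      f : Seq
      f i = δ d (i + 1)
      d-period : Period d f
      d-period i = trans (cong (δ d) (trans (ℕₚ.+-assoc i d 1) (trans (cong (λ n → i + n) (ℕₚ.+-comm d 1)) (sym (ℕₚ.+-assoc i 1 d)))))
        (δ-period d (i + 1))
      pd : ∀ {n} → d ∣ n → Period n f
      pd = period-∣ f d-period
      row₁ : ∀ u → u +ᶻ u +ᶻ -ᶻ u +ᶻ -ᶻ u ≡ + 0
      row₁ = ℤ-ring
      row₂ : ∀ u → -ᶻ u +ᶻ -ᶻ u +ᶻ -ᶻ (-ᶻ u) +ᶻ u ≡ + 0
      row₂ = ℤ-ring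
      f≡0 : ∀ i → f i ≡ 0ℤ
      f≡0 = twisted-vanishes f (λ i → -ᶻ f i) (pd d∣k) (λ i → cong -ᶻ_ (pd d∣k i))
        (λ i → trans (cong₂ (λ u v → u +ᶻ v -ᶻ f i +ᶻ -ᶻ f i) (pd d∣a i) (pd (∣-∸ (m-multiple d∣k) d∣a) i)) (row₁ (f i)))
        (λ i → trans (cong₂ (λ u v → -ᶻ u +ᶻ -ᶻ v -ᶻ (-ᶻ f i) +ᶻ f i) (pd d∣b i) (pd (∣-∸ (m-multiple d∣k) d∣b) i)) (row₂ (f i)))
        (δ-∤ (λ d∣1 → d≢1 (∣1⇒≡1 d∣1)))
      last : d ≡ d ∸ 1 + 1
      last = sym (ℕₚ.m∸n+n≡m (ℕₚ.n≢0⇒n>0 (λ d≡0 → ≢-nonZero⁻¹ k (0∣⇒≡0 (subst (_∣ k) d≡0 d∣k)))))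

    -- c ≡ ± r modulo 5
    Class : ℕ → ℕ → Set
    Class r c = ∃ λ q → c ≡ r + q * 5 ⊎ c + r ≡ q * 5

    class : ∀ c → ¬ 5 ∣ c → Class 1 c ⊎ Class 2 c
    class c 5∤c with c % 5 | m%n<n c 5 | m≡m%n+[m/n]*n c 5
    ... | 0 | _ | e = ⊥-elim (5∤c (divides (c / 5) e))
    ... | 1 | _ | e = inj₁ (c / 5 , inj₁ e)
    ... | 2 | _ | e = inj₂ (c / 5 , inj₁ e)
    ... | 3 | _ | e = inj₂ (suc (c / 5) , inj₂ (trans (cong (_+ 2) e) (ℕₚ.+-comm (3 + c / 5 * 5) 2)))
    ... | 4 | _ | e = inj₁ (suc (c / 5) , inj₂ (trans (cong (_+ 1) e) (ℕₚ.+-comm (4 + c / 5 * 5) 1)))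
    ... | suc (suc (suc (suc (suc _)))) | s≤s (s≤s (s≤s (s≤s (s≤s ())))) | _

    same-class : ∀ r → Class r a → Class r b → 5 ∣ (b ∸ a) ⊎ 5 ∣ (a + b)
    same-class r (q , inj₁ refl) (q′ , inj₁ refl) = inj₁ (subst (5 ∣_) (sym (ℕₚ.[m+n]∸[m+o]≡n∸o r (q′ * 5) (q * 5)))
      (∣-∸ (n∣m*n q′) (n∣m*n q)))
    same-class r (q , inj₂ e) (q′ , inj₂ e′) = inj₁ (subst (5 ∣_)
      (trans (cong₂ _∸_ (trans (sym e′) (ℕₚ.+-comm b r)) (trans (sym e) (ℕₚ.+-comm a r))) (ℕₚ.[m+n]∸[m+o]≡n∸o r b a))
      (∣-∸ (n∣m*n q′) (n∣m*n q)))
    same-class r (q , inj₁ refl) (q′ , inj₂ e′) = inj₂ (divides (q + q′)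
      (trans (ring r q b) (trans (cong (λ n → q * 5 + n) e′) (sym (ℕₚ.*-distribʳ-+ 5 q q′)))))
      where
      ring : ∀ r q b → r + q * 5 + b ≡ q * 5 + (b + r)
      ring = ℕ-ring
    same-class r (q , inj₂ e) (q′ , inj₁ refl) = inj₂ (divides (q + q′)
      (trans (ring r q′ a) (trans (cong (_+ q′ * 5) e) (sym (ℕₚ.*-distribʳ-+ 5 q q′)))))
      where
      ring : ∀ r q a → a + (r + q * 5) ≡ a + r + q * 5
      ring = ℕ-ring

    -- On period 5 the operator T^c + T^(-c) depends on c only up to sign modulo 5, and m - c
    -- represents -c because 5 divides m.
    class-shift : ∀ {r c} → r ≤ 5 → c ≤ m → 5 ∣ k → Class r c → ∀ f → Period 5 f →
      ∀ i → f (i + c) +ᶻ f (i + (m ∸ c)) ≡ f (i + r) +ᶻ f (i + (5 ∸ r))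
    class-shift {r} {c} r≤5 c≤m 5∣k (q , inj₁ c≡) f p i = cong₂ _+ᶻ_
      (period-agree f (p5 (5 ∣0)) (p5 (n∣m*n q)) (trans (ℕₚ.+-identityʳ c) c≡) i)
      (period-agree f (p5 (∣m∣n⇒∣m+n ∣-refl (n∣m*n q))) (p5 (subst (5 ∣_) (sym (ℕₚ.m+[n∸m]≡n c≤m)) (m-multiple 5∣k)))
        (trans (cong (λ n → m ∸ c + (n + q * 5)) (sym (ℕₚ.m+[n∸m]≡n r≤5)))
          (trans (ring (m ∸ c) r (5 ∸ r) (q * 5)) (cong (λ n → 5 ∸ r + (n + (m ∸ c))) (sym c≡)))) i)
      where
      p5 : ∀ {n} → 5 ∣ n → Period n f
      p5 = period-∣ f p
      ring : ∀ d r s t → d + (r + s + t) ≡ s + (r + t + d)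
      ring = ℕ-ring
    class-shift {r} {c} r≤5 c≤m 5∣k (q , inj₂ c+r≡) f p i = trans (cong₂ _+ᶻ_
      (period-agree f p (p5 (n∣m*n q)) (trans (cong (λ n → c + n) (sym (ℕₚ.m+[n∸m]≡n r≤5)))
        (trans (ring c r (5 ∸ r)) (cong (λ n → 5 ∸ r + n) c+r≡))) i)
      (period-agree f (p5 (n∣m*n q)) (p5 (subst (5 ∣_) (sym (ℕₚ.m+[n∸m]≡n c≤m)) (m-multiple 5∣k)))
        (trans (cong (λ n → m ∸ c + n) (sym c+r≡)) (ring₂ (m ∸ c) c r)) i))
      (ℤₚ.+-comm (f (i + (5 ∸ r))) (f (i + r)))
      where
      p5 : ∀ {n} → 5 ∣ n → Period n f
      p5 = period-∣ f p
      ring : ∀ c r s → c + (r + s) ≡ s + (c + r)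
      ring = ℕ-ring
      ring₂ : ∀ d c r → d + (c + r) ≡ r + (c + d)
      ring₂ = ℕ-ring

    -- For a ≡ ±r and b ≡ ±s with {r , s} = {1 , 2}, any f of period 5 gives a vector in the kernel.
    different-classes : 5 ∣ k → ∀ {r s} → r ≤ 5 → s ≤ 5 → Class r a → Class s b →
      (∀ (F : ℕ → ℤ) → (∀ n → F (n + 5) ≡ F n) →
        F s -ᶻ (F (s + r) +ᶻ F (s + (5 ∸ r))) +ᶻ (F (5 ∸ s) -ᶻ (F (5 ∸ s + r) +ᶻ F (5 ∸ s + (5 ∸ r))))
          -ᶻ (F 0 -ᶻ (F r +ᶻ F (5 ∸ r))) +ᶻ F 0 ≡ 0ℤ) → ⊥
    different-classes 5∣k {r} {s} r≤5 s≤5 class-a class-b identity = 1≢0 (trans (sym (δ-∣ (∣-refl {5})))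
      (twisted-vanishes f g (p5 5∣k) g-period f-row g-row (δ-∤ (∤-between {5} {1} (s≤s z≤n) (s≤s (s≤s z≤n)))) 4))
      where
      f g : Seq
      f i = δ 5 (i + 1)
      -- The first row forces g = (1 - X) f. The second becomes (X + Y - X Y) f = 0, which holds
      -- because (T + T⁻¹) (T² + T⁻²) = T + T⁻¹ + T² + T⁻² when T⁵ = 1.
      g i = f i -ᶻ (f (i + a) +ᶻ f (i + (m ∸ a)))
      f-period : Period 5 f
      f-period i = trans (cong (δ 5) (trans (ℕₚ.+-assoc i 5 1) (sym (ℕₚ.+-assoc i 1 5)))) (δ-period 5 (i + 1))
      p5 : ∀ {n} → 5 ∣ n → Period n f
      p5 = period-∣ f f-period
      g-at : ∀ i n → g (i + n) ≡ f (i + n) -ᶻ (f (i + (n + r)) +ᶻ f (i + (n + (5 ∸ r))))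
      g-at i n = cong (λ u → f (i + n) -ᶻ u) (trans (class-shift r≤5 a≤m 5∣k class-a f f-period (i + n))
        (cong₂ (λ u v → f u +ᶻ f v) (ℕₚ.+-assoc i n r) (ℕₚ.+-assoc i n (5 ∸ r))))
      g-at-0 : ∀ i → g i ≡ f (i + 0) -ᶻ (f (i + r) +ᶻ f (i + (5 ∸ r)))
      g-at-0 i = trans (cong g (sym (ℕₚ.+-identityʳ i))) (g-at i 0)
      g-period₅ : Period 5 g
      g-period₅ i = cong₂ _-ᶻ_ (f-period i) (cong₂ _+ᶻ_ (moved a) (moved (m ∸ a)))
        where
        swap : ∀ i c → i + 5 + c ≡ i + c + 5
        swap = ℕ-ring
        moved : ∀ c → f (i + 5 + c) ≡ f (i + c)
        moved c = trans (cong f (swap i c)) (f-period (i + c))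
      g-period : Period k g
      g-period = period-∣ g g-period₅ 5∣k
      f-row : ∀ i → f (i + a) +ᶻ f (i + (m ∸ a)) -ᶻ f i +ᶻ g i ≡ 0ℤ
      f-row i = ring (f (i + a)) (f (i + (m ∸ a))) (f i)
        where
        ring : ∀ u v w → u +ᶻ v +ᶻ -ᶻ w +ᶻ (w +ᶻ -ᶻ (u +ᶻ v)) ≡ + 0
        ring = ℤ-ring
      g-row : ∀ i → g (i + b) +ᶻ g (i + (m ∸ b)) -ᶻ g i +ᶻ f i ≡ 0ℤ
      g-row i = trans
        (cong₂ _+ᶻ_ (cong₂ _-ᶻ_ (trans (class-shift s≤5 b≤m 5∣k class-b g g-period₅ i)
          (cong₂ _+ᶻ_ (g-at i s) (g-at i (5 ∸ s)))) (g-at-0 i)) (cong f (sym (ℕₚ.+-identityʳ i))))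
        (identity (λ n → f (i + n)) (λ n → trans (cong f (sym (ℕₚ.+-assoc i n 5))) (f-period (i + n))))

    mod-5 : 5 ∣ k → 5 ∣ a ⊎ 5 ∣ b ⊎ 5 ∣ (b ∸ a) ⊎ 5 ∣ (a + b)
    mod-5 5∣k with 5 ∣? a | 5 ∣? b
    ... | yes 5∣a | _       = inj₁ 5∣a
    ... | no  _   | yes 5∣b = inj₂ (inj₁ 5∣b)
    ... | no 5∤a  | no 5∤b with class a 5∤a | class b 5∤b
    ... | inj₁ class-a | inj₁ class-b = inj₂ (inj₂ (same-class 1 class-a class-b))
    ... | inj₂ class-a | inj₂ class-b = inj₂ (inj₂ (same-class 2 class-a class-b))
    ... | inj₁ class-a | inj₂ class-b = ⊥-elim (different-classes 5∣k (s≤s z≤n) (s≤s (s≤s z≤n)) class-a class-b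
      (λ F p → trans (cong₂ (λ u v → F 2 -ᶻ (F 3 +ᶻ u) +ᶻ (F 3 -ᶻ (F 4 +ᶻ v)) -ᶻ (F 0 -ᶻ (F 1 +ᶻ F 4)) +ᶻ F 0) (p 1) (p 2))
        (ring (F 0) (F 1) (F 2) (F 3) (F 4))))
      where
      ring : ∀ f₀ f₁ f₂ f₃ f₄ → f₂ +ᶻ -ᶻ (f₃ +ᶻ f₁) +ᶻ (f₃ +ᶻ -ᶻ (f₄ +ᶻ f₂)) +ᶻ -ᶻ (f₀ +ᶻ -ᶻ (f₁ +ᶻ f₄)) +ᶻ f₀ ≡ + 0
      ring = ℤ-ring
    ... | inj₂ class-a | inj₁ class-b = ⊥-elim (different-classes 5∣k (s≤s (s≤s z≤n)) (s≤s z≤n) class-a class-b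
      (λ F p → trans (cong₂ (λ u v → F 1 -ᶻ (F 3 +ᶻ F 4) +ᶻ (F 4 -ᶻ (u +ᶻ v)) -ᶻ (F 0 -ᶻ (F 2 +ᶻ F 3)) +ᶻ F 0) (p 1) (p 2))
        (ring (F 0) (F 1) (F 2) (F 3) (F 4))))
      where
      ring : ∀ f₀ f₁ f₂ f₃ f₄ → f₁ +ᶻ -ᶻ (f₃ +ᶻ f₄) +ᶻ (f₄ +ᶻ -ᶻ (f₁ +ᶻ f₂)) +ᶻ -ᶻ (f₀ +ᶻ -ᶻ (f₂ +ᶻ f₃)) +ᶻ f₀ ≡ + 0
      ring = ℤ-ring

-- Translation between m and its half, and the equivalence

odd-half⇒%4≡2 : ∀ {m k} → m ≡ 2 * k → Odd k → m % 4 ≡ 2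
odd-half⇒%4≡2 refl (h , refl) = trans (cong (_% 4) (ring h)) ([m+kn]%n≡m%n 2 h 4)
  where
  ring : ∀ h → 2 * suc (2 * h) ≡ 2 + h * 4
  ring = ℕ-ring

%4≡2⇒odd-half : ∀ {m k} → m ≡ 2 * k → m % 4 ≡ 2 → Odd k
%4≡2⇒odd-half {k = k} refl m%4≡2 with parity k
... | inj₂ odd = odd
... | inj₁ (divides q refl) = ⊥-elim (0≢2 (trans (sym ([m+kn]%n≡m%n 0 q 4)) (trans (cong (_% 4) (sym (ring q))) m%4≡2)))
  where
  0≢2 : 0 ≢ 2
  0≢2 ()
  ring : ∀ q → 2 * (q * 2) ≡ q * 4
  ring = ℕ-ring

module HalfOrder {m k a b : ℕ} .{{_ : NonZero m}} .{{_ : NonZero k}} (m/2≡k : m / 2 ≡ k) (m≡2k : m ≡ 2 * k)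
  (0<a : 0 < a) (a≤b : a ≤ b) (b<k : b < k) where

  Conditions : Set
  Conditions = (m % 4 ≡ 2) × (2 ∣ a × 2 ∣ b) × (gcd (gcd k a) b ≡ 1) ×
    (5 ∣ m → 5 ∣ a ⊎ 5 ∣ b ⊎ 5 ∣ (b ∸ a) ⊎ 5 ∣ (a + b))

  private
    b≤m : b ≤ m
    b≤m = ℕₚ.≤-trans (ℕₚ.<⇒≤ b<k) (subst (k ≤_) (sym m≡2k) (ℕₚ.m≤m+n k _))
    a≤m : a ≤ m
    a≤m = ℕₚ.≤-trans a≤b b≤m

  open Graph {m} {k} {a} {b} m/2≡k m≡2k 0<a (ℕₚ.≤-<-trans a≤b b<k) (ℕₚ.≤-trans 0<a a≤b) b<k

  necessary : IsNutGraph (m + m) (B₁ m a b) → Conditions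
  necessary nut =
    let (rigid , x , y , K , x0≢0) = nut⇒rigid nut
        (odd , 2∣a , 2∣b) = Necessity.parities {m} {k} {a} {b} m≡2k a≤m b≤m rigid {x} {y} K x0≢0
    in odd-half⇒%4≡2 m≡2k odd
     , (2∣a , 2∣b)
     , Necessity.gcd≡1 {m} {k} {a} {b} m≡2k a≤m b≤m rigid odd 2∣a 2∣b
     , λ 5∣m → Necessity.mod-5 {m} {k} {a} {b} m≡2k a≤m b≤m rigid odd 2∣a 2∣b
         (odd-cancel-2 (2 , refl) (subst (5 ∣_) m≡2k 5∣m))

  sufficient : Conditions → IsNutGraph (m + m) (B₁ m a b)
  sufficient (m%4≡2 , (2∣a , 2∣b) , gcd≡1 , mod-5) = rigid⇒nut
    (conditions⇒rigid m≡2k a≤m b≤m odd 2∣a 2∣b a≤b gcd≡1 (λ 5∣k → mod-5 (subst (5 ∣_) (sym m≡2k) (∣n⇒∣m*n 2 5∣k))))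
    -- On the alternating vector X = Y = 2 and T^k = -1, so y = -x makes every row 2 - 1 - 1 = 0 up
    -- to sign.
    {λ i → sign i *ᶻ 1ℤ} {λ i → sign i *ᶻ -1ℤ}
    (twisted-kernel m≡2k a≤m b≤m odd 2∣a 2∣b (λ _ → 1ℤ) (λ _ → -1ℤ)
      (λ _ → refl) (λ _ → refl) (λ _ → refl) (λ _ → refl))
    refl (sign*≢0 1ℤ (λ ())) (sign*≢0 -1ℤ (λ ()))
    where
    odd : Odd k
    odd = %4≡2⇒odd-half m≡2k m%4≡2
    sign*≢0 : ∀ c → c ≢ 0ℤ → ∀ i → sign i *ᶻ c ≢ 0ℤ
    sign*≢0 c c≢0 i e with ℤₚ.i*j≡0⇒i≡0∨j≡0 (sign i) e
    ... | inj₂ c≡0 = c≢0 c≡0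
    ... | inj₁ sign≡0 = 1≢0 (trans (sym (sign² i)) (trans (cong (_*ᶻ sign i) sign≡0) (ℤₚ.*-zeroˡ (sign i))))

theorem3p1 : (m a b : ℕ) → .{{_ : NonZero m}} →
    2 ∣ m → 4 ≤ m → 1 ≤ a → a ≤ b → b < m / 2 →
    IsNutGraph (m + m) (B₁ m a b)
    ⇔ ((m % 4 ≡ 2)
    × (2 ∣ a × 2 ∣ b)
    × (gcd (gcd (m / 2) a) b ≡ 1)
    × (5 ∣ m → 5 ∣ a ⊎ 5 ∣ b ⊎ 5 ∣ (b ∸ a) ⊎ 5 ∣ (a + b)))
theorem3p1 m a b 2∣m 4≤m 1≤a a≤b b<m/2 = mk⇔ necessary sufficient
  where
  instance
    m/2≢0 : NonZero (m / 2)
    m/2≢0 = >-nonZero (ℕₚ.≤-<-trans z≤n b<m/2)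
  m≡2[m/2] : m ≡ 2 * (m / 2)
  m≡2[m/2] = trans (sym (m/n*n≡m 2∣m)) (ℕₚ.*-comm (m / 2) 2)
  open HalfOrder {m} {m / 2} {a} {b} refl m≡2[m/2] 1≤a a≤b b<m/2
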